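{- Let $w\geq 4$ and let $C=(C_1,C_2)$ be an equitable $2$-partition of $J(2w,w)$ whose quotient matrix has the eigenvalue $\lambda_2(2w,w)=(w-2)^2-2$. (a) If $w\geq 7$, then $C$ is equivalent to one of the following partitions $(D_1,D_2)$ of $J(2w,w)$ ($D_2$ the complement of $D_1$): (i) $D_1=\{x: (x_1,\dots,x_5)\in B_1\}$ with $B_1=\{(1,0,0,0,0),(1,1,0,0,0),(1,0,1,0,0),(0,0,0,1,1),(0,1,1,1,1),(0,0,1,1,1),(0,1,0,1,1),(1,1,1,0,0)\}$; (ii) $D_1=\{x: x_1+x_2\in\{0,2\}\}$; (iii) $D_1=\{x: (x_1,\dots,x_5)\in B_3\}$ with $B_3=\{(0,0,0,0,0),(0,0,1,0,0),(0,0,0,1,0),(0,0,0,0,1),(1,0,1,0,0),(0,1,0,1,0),(0,0,1,0,1),(0,0,0,1,1),(1,1,1,1,1),(1,1,0,1,1),(1,1,1,0,1),(1,1,1,1,0),(0,1,0,1,1),(1,0,1,0,1),(1,1,0,1,0),(1,1,1,0,0)\}$; (iv) $D_1=\{x: (x_1,x_2,x_3)\in\{(0,0,0),(1,1,1)\}\}$. (b) If $w\in\{4,5,6\}$, then, after possibly interchanging the two cells, the quotient matrix of $C$ is one of $\begin{pmatrix} w^2-3w+2 & 3w-2\\ w & w^2-w\end{pmatrix}$, $\begin{pmatrix} w^2-2w & 2w\\ 2w-2 & w^2-2w+2\end{pmatrix}$, $\begin{pmatrix} w^2-3w & 3w\\ w-2 & w^2-w+2\end{pmatrix}$.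
   Context: The Johnson graph $J(n,w)$ has as vertices the binary vectors of length $n$ with exactly $w$ ones; two vertices are adjacent if they have exactly $w-1$ common ones; its eigenvalues are $\lambda_i(n,w)=(w-i)(n-w-i)-i$, $i=0,\dots,w$. A partition $(C_1,C_2)$ of the vertex set is equitable with quotient matrix $S=(s_{ij})$ if every vertex of $C_i$ has exactly $s_{ij}$ neighbours in $C_j$. $\chi_A$ denotes the characteristic function of $A$. Two functions on $J(n,w)$ are equivalent if they differ by a permutation of coordinates; two equitable $2$-partitions $(C_1,C_2)$, $(C_1',C_2')$ are equivalent if $\chi_{C_1}$ is equivalent to $\chi_{C_1'}$ or to $\chi_{C_2'}$. -}

module Defs where

open import Data.Nat using (ℕ; zero; suc; _+_; _*_; _∸_; _≡ᵇ_; _≟_; _≤_)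
open import Data.Integer as ℤ using (ℤ; +_)
open import Data.Bool using (Bool; true; false; if_then_else_; _∧_)
open import Data.Fin using (Fin; zero; suc)
open import Data.Fin.Permutation using (Permutation′; _⟨$⟩ʳ_)
open import Data.Vec using (Vec; []; _∷_; lookup)
open import Data.List using (List; []; _∷_; _++_; map; mapMaybe; filterᵇ; length; concatMap)
open import Data.Maybe using (Maybe; just; nothing)
open import Data.Product using (Σ; ∃; _,_; proj₁; _×_)
open import Data.Sum using (_⊎_)
open import Relation.Nullary using (¬_; yes; no)
open import Relation.Binary.PropositionalEquality using (_≡_)

b2n : Bool → ℕ
b2n true  = 1
b2n false = 0

weight : ∀ {n} → Vec Bool n → ℕ
weight []      = 0
weight (b ∷ v) = b2n b + weight v

common : ∀ {n} → Vec Bool n → Vec Bool n → ℕ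
common []      []      = 0
common (a ∷ u) (b ∷ v) = b2n (a ∧ b) + common u v

allVecs : (n : ℕ) → List (Vec Bool n)
allVecs zero    = [] ∷ []
allVecs (suc n) = map (true ∷_) (allVecs n) ++ map (false ∷_) (allVecs n)

Vertex : ℕ → ℕ → Set
Vertex n w = Σ (Vec Bool n) (λ x → weight x ≡ w)

vertices : (n w : ℕ) → List (Vertex n w)
vertices n w = mapMaybe pick (allVecs n)
  where
  pick : Vec Bool n → Maybe (Vertex n w)
  pick x with weight x ≟ w
  ... | yes p = just (x , p)
  ... | no _  = nothing

adjᵇ : ∀ {n w} → Vertex n w → Vertex n w → Bool
adjᵇ {n} {w} x y = common (proj₁ x) (proj₁ y) ≡ᵇ (w ∸ 1)

eigJ : (n w i : ℕ) → ℤ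
eigJ n w i = ((+ w) ℤ.- (+ i)) ℤ.* (((+ n) ℤ.- (+ w)) ℤ.- (+ i)) ℤ.- (+ i)

-- 2-partitions, given by the characteristic function f = χ_{C₁};
-- C₁ = f⁻¹(true), C₂ = f⁻¹(false).

cell : ∀ {n w} → (Vertex n w → Bool) → Vertex n w → Fin 2
cell f x = if f x then zero else suc zero

sameFin2 : Fin 2 → Fin 2 → Bool
sameFin2 zero          zero          = true
sameFin2 (suc zero)    (suc zero)    = true
sameFin2 _             _             = false

nbrsIn : ∀ {n w} → (Vertex n w → Bool) → Fin 2 → Vertex n w → ℕ
nbrsIn {n} {w} f j x =
  length (filterᵇ (λ y → adjᵇ x y ∧ sameFin2 (cell f y) j) (vertices n w))

IsEquitable2 : ∀ {n w} → (Vertex n w → Bool) → (Fin 2 → Fin 2 → ℕ) → Set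
IsEquitable2 {n} {w} f S =
  (∃ λ (x : Vertex n w) → f x ≡ true) ×
  (∃ λ (x : Vertex n w) → f x ≡ false) ×
  (∀ (x : Vertex n w) (j : Fin 2) → nbrsIn f j x ≡ S (cell f x) j)

IsEigenvalue2 : (Fin 2 → Fin 2 → ℕ) → ℤ → Set
IsEigenvalue2 S λ′ = Σ (Fin 2 → ℤ) λ v →
  ¬ (∀ i → v i ≡ + 0) ×
  (∀ i → (+ S i zero) ℤ.* v zero ℤ.+ (+ S i (suc zero)) ℤ.* v (suc zero)
         ≡ λ′ ℤ.* v i)

FunEquiv : ∀ {n w} → (Vertex n w → Bool) → (Vertex n w → Bool) → Set
FunEquiv {n} {w} f g = Σ (Permutation′ n) λ π →
  ∀ (x y : Vertex n w) → (∀ i → lookup (proj₁ y) i ≡ lookup (proj₁ x) (π ⟨$⟩ʳ i)) →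
  g x ≡ f y

notF : ∀ {n w} → (Vertex n w → Bool) → Vertex n w → Bool
notF f x = Data.Bool.not (f x)
  where import Data.Bool

PartEquiv : ∀ {n w} → (Vertex n w → Bool) → (Vertex n w → Bool) → Set
PartEquiv f g = FunEquiv f g ⊎ FunEquiv f (notF g)

-- The partitions (i)–(iv); coordinate k (1-based) read as x_k,
-- (out-of-range coordinates, never used for n ≥ 14, read as false)

coord : ∀ {n} → Vec Bool n → ℕ → Bool
coord []      _       = false
coord (b ∷ v) zero    = b
coord (b ∷ v) (suc k) = coord v k

first5 : ∀ {n} → Vec Bool n → Vec Bool 5
first5 x = coord x 0 ∷ coord x 1 ∷ coord x 2 ∷ coord x 3 ∷ coord x 4 ∷ []

eqVec : ∀ {m} → Vec Bool m → Vec Bool m → Bool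
eqVec []      []      = true
eqVec (a ∷ u) (b ∷ v) = Data.Bool.not (a Data.Bool.xor b) ∧ eqVec u v
  where import Data.Bool

memb : ∀ {m} → Vec Bool m → List (Vec Bool m) → Bool
memb v []       = false
memb v (u ∷ us) = if eqVec v u then true else memb v us

private
  t f : Bool
  t = true
  f = false

B1 : List (Vec Bool 5)
B1 = (t ∷ f ∷ f ∷ f ∷ f ∷ []) ∷ (t ∷ t ∷ f ∷ f ∷ f ∷ []) ∷ (t ∷ f ∷ t ∷ f ∷ f ∷ []) ∷
     (f ∷ f ∷ f ∷ t ∷ t ∷ []) ∷ (f ∷ t ∷ t ∷ t ∷ t ∷ []) ∷ (f ∷ f ∷ t ∷ t ∷ t ∷ []) ∷
     (f ∷ t ∷ f ∷ t ∷ t ∷ []) ∷ (t ∷ t ∷ t ∷ f ∷ f ∷ []) ∷ []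

B3 : List (Vec Bool 5)
B3 = (f ∷ f ∷ f ∷ f ∷ f ∷ []) ∷ (f ∷ f ∷ t ∷ f ∷ f ∷ []) ∷ (f ∷ f ∷ f ∷ t ∷ f ∷ []) ∷
     (f ∷ f ∷ f ∷ f ∷ t ∷ []) ∷ (t ∷ f ∷ t ∷ f ∷ f ∷ []) ∷ (f ∷ t ∷ f ∷ t ∷ f ∷ []) ∷
     (f ∷ f ∷ t ∷ f ∷ t ∷ []) ∷ (f ∷ f ∷ f ∷ t ∷ t ∷ []) ∷ (t ∷ t ∷ t ∷ t ∷ t ∷ []) ∷
     (t ∷ t ∷ f ∷ t ∷ t ∷ []) ∷ (t ∷ t ∷ t ∷ f ∷ t ∷ []) ∷ (t ∷ t ∷ t ∷ t ∷ f ∷ []) ∷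
     (f ∷ t ∷ f ∷ t ∷ t ∷ []) ∷ (t ∷ f ∷ t ∷ f ∷ t ∷ []) ∷ (t ∷ t ∷ f ∷ t ∷ f ∷ []) ∷
     (t ∷ t ∷ t ∷ f ∷ f ∷ []) ∷ []

D1-i : ∀ {n w} → Vertex n w → Bool
D1-i x = memb (first5 (proj₁ x)) B1

-- (ii)  x_1 + x_2 ∈ {0,2}, i.e. x_1 = x_2
D1-ii : ∀ {n w} → Vertex n w → Bool
D1-ii x = eqVec (coord (proj₁ x) 0 ∷ []) (coord (proj₁ x) 1 ∷ [])

D1-iii : ∀ {n w} → Vertex n w → Bool
D1-iii x = memb (first5 (proj₁ x)) B3

D1-iv : ∀ {n w} → Vertex n w → Bool
D1-iv x = memb (coord (proj₁ x) 0 ∷ coord (proj₁ x) 1 ∷ coord (proj₁ x) 2 ∷ [])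
               ((f ∷ f ∷ f ∷ []) ∷ (t ∷ t ∷ t ∷ []) ∷ [])

Mat2 : Set
Mat2 = Fin 2 → Fin 2 → ℕ

mat2 : ℕ → ℕ → ℕ → ℕ → Mat2
mat2 a b c d zero       zero       = a
mat2 a b c d zero       (suc zero) = b
mat2 a b c d (suc zero) zero       = c
mat2 a b c d (suc zero) (suc zero) = d

swap2 : Fin 2 → Fin 2
swap2 zero       = suc zero
swap2 (suc zero) = zero

MatEq : Mat2 → Mat2 → Set
MatEq S T = ∀ i j → S i j ≡ T i j

MatEqUpToSwap : Mat2 → Mat2 → Set
MatEqUpToSwap S T = MatEq S T ⊎ MatEq (λ i j → S (swap2 i) (swap2 j)) T

{-# OPTIONS --safe #-}
-- Let F be the characteristic function of C₁ and n = 2w.  Differencing F along two disjoint pairs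
-- of coordinates gives an eigenfunction of J(n − 4, w − 2) for the valency (w − 2)², which is
-- constant by the maximum principle: F is "quadratic".  Its odd part under complementation is
-- linear, hence in the λ₁-eigenspace, hence zero.  So the derivative of F along one pair i, j is an
-- odd linear form with values in {−1, 0, 1}; such a form involves at most two coordinates p, q, and
-- fixing suitable values of x_i, x_j, x_p, x_q makes F constant.  Then the derivative along any
-- other pair is A·U + B·V with |A| + |B| ≤ 1, where U and V are fixed functions of these four
-- coordinates, and Boolean values leave room for only one more relevant coordinate.  For w ≥ 5 this
-- makes F an even quadratic function of five coordinates, and these are enumerated.  For w = 4 the
-- matrices follow from |C₁| = 5c, which is even because C₁ is closed under complementation.
module Submission where

open import Defs
open import Data.Nat using (ℕ; zero; suc; _+_; _*_; _∸_; _≤_; _<_; z≤n; s≤s; _≡ᵇ_; _≟_)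
import Data.Nat.Properties as ℕ
open import Data.Integer using (ℤ; 0ℤ; 1ℤ; -1ℤ; ∣_∣; _⊓_; _⊔_; +≤+; -≤+) renaming (+_ to pos; _+_ to _+ᶻ_; _*_ to _*ᶻ_; _-_ to _-ᶻ_; -_ to neg; _≤_ to _≤ᶻ_)
import Data.Integer.Properties as ℤ
open import Data.Integer.Tactic.RingSolver using (solve-∀)
open import Data.Bool using (Bool; true; false; if_then_else_; _∧_; _∨_; _xor_; not)
import Data.Bool.Properties as Bool
open import Data.Fin using (Fin; zero; suc; _↑ˡ_; punchIn; punchOut)
import Data.Fin.Properties as Fin
open import Data.Fin.Permutation using (Permutation′; _⟨$⟩ʳ_; _⟨$⟩ˡ_)
import Data.Fin.Permutation as Perm
open import Data.Vec using (Vec; []; _∷_; lookup; map; _++_; tabulate; _[_]≔_)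
import Data.Vec.Properties as Vec
open import Data.List as List using (List; []; _∷_; concatMap; filterᵇ; mapMaybe; length)
open import Data.Maybe using (Maybe; just; nothing; maybe′)
open import Data.Bool.ListAction using (any)
open import Data.Sum using (_⊎_; inj₁; inj₂)
open import Data.Product using (Σ; ∃; ∃₂; _×_; _,_; proj₁; proj₂)
open import Function using (_∘_; case_of_)
open import Function.Definitions using (Injective)
open import Relation.Nullary using (yes; no; contradiction; does; ¬?; Dec)
open import Relation.Nullary.Decidable using (dec-true)
open import Relation.Binary.PropositionalEquality
open import Data.Vec.Relation.Unary.All using ([]; _∷_)
open import Data.Vec.Relation.Unary.AllPairs using ([]; _∷_; allPairs?)
open import Data.Vec.Relation.Unary.Unique.Propositional using (Unique)
open import Data.Vec.Relation.Unary.Unique.Propositional.Properties using (lookup-injective; map⁺)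
open import Algebra.Properties.AbelianGroup ℤ.+-0-abelianGroup using () renaming (∙-cancelʳ to +ᶻ-cancelʳ)
open import Algebra.Properties.CommutativeMonoid.Sum ℤ.+-0-commutativeMonoid using (sum; sum-cong-≗; ∑-distrib-+; ∑-comm; sum-permute; sum-replicate-zero)

-- A characteristic function is an eigenfunction only up to a constant: its neighbour sums are λ₂ F
-- + c, where c counts the neighbours in the first cell of a vertex of the second. This c is carried
-- along and cancels in the first derivative. Each derivative along a pair adds one to the
-- eigenvalue and takes one from the weight, which is why two of them turn λ₂ into a valency. From
-- there integrality does the work. A linear form running from 1 down to -1 between complementary
-- vertices has slopes of total deviation 2 from a common value, hence at most two exceptional
-- slopes. For the later derivatives, (A, B) is a difference of potentials in ℤ², and any two
-- potentials have ℓ¹ distance at most 1. The grid has no triangles, so at most two potentials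
-- occur; if both occurred twice, two successive moves would change F by 2 in total. The obstacle at
-- w = 4 is room. Free choice of five bits needs five ones and five zeros in a vertex, and so does
-- placing two ones next to a pattern of weight three.

variable
  n m : ℕ

-- Weights, moves and complements of bit vectors

t≢f : ∀ {b} → b ≡ true → b ≡ false → ∀ {a} {X : Set a} → X
t≢f refl ()

β : Bool → ℤ
β true  = 1ℤ
β false = 0ℤ

when : Bool → ℤ → ℤ
when b z = if b then z else 0ℤ

-- A total function; it is a step of the Johnson graph when bit `i` is one and bit `j` is zero.
move : Fin n → Fin n → Vec Bool n → Vec Bool n
move i j x = (x [ i ]≔ false) [ j ]≔ true

compl : Vec Bool n → Vec Bool n
compl = map not

lookup-set-false : ∀ (x : Vec Bool n) i j → lookup x j ≡ false → lookup (x [ i ]≔ false) j ≡ false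
lookup-set-false (b ∷ x) zero    zero    e = refl
lookup-set-false (b ∷ x) zero    (suc j) e = e
lookup-set-false (b ∷ x) (suc i) zero    e = e
lookup-set-false (b ∷ x) (suc i) (suc j) e = lookup-set-false x i j e

weight-set-true : ∀ (x : Vec Bool n) j → lookup x j ≡ false → weight (x [ j ]≔ true) ≡ suc (weight x)
weight-set-true (false ∷ x) zero    e = refl
weight-set-true (b ∷ x)     (suc j) e = trans (cong (b2n b +_) (weight-set-true x j e)) (ℕ.+-suc (b2n b) (weight x))

weight-set-false : ∀ (x : Vec Bool n) j → lookup x j ≡ true → suc (weight (x [ j ]≔ false)) ≡ weight x
weight-set-false (true ∷ x) zero    e = refl
weight-set-false (b ∷ x)    (suc j) e = trans (sym (ℕ.+-suc (b2n b) _)) (cong (b2n b +_) (weight-set-false x j e))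

weight-move : ∀ (x : Vec Bool n) i j → lookup x i ≡ true → lookup x j ≡ false → weight (move i j x) ≡ weight x
weight-move x i j p q = trans (weight-set-true (x [ i ]≔ false) j (lookup-set-false x i j q)) (weight-set-false x i p)

weight-compl : (x : Vec Bool n) → weight x + weight (compl x) ≡ n
weight-compl []          = refl
weight-compl (true ∷ x)  = cong suc (weight-compl x)
weight-compl (false ∷ x) = trans (ℕ.+-suc _ _) (cong suc (weight-compl x))

compl-involutive : (x : Vec Bool n) → compl (compl x) ≡ x
compl-involutive []      = refl
compl-involutive (b ∷ x) = cong₂ _∷_ (Bool.not-involutive b) (compl-involutive x)

lookup-ext : {x y : Vec Bool n} → (∀ i → lookup x i ≡ lookup y i) → x ≡ y
lookup-ext {x = x} {y} h = trans (sym (Vec.tabulate∘lookup x)) (trans (Vec.tabulate-cong h) (Vec.tabulate∘lookup y))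

lookup-move-1 : ∀ (x : Vec Bool n) i j → lookup (move i j x) j ≡ true
lookup-move-1 x i j = Vec.lookup∘updateAt j (x [ i ]≔ false)

lookup-move-0 : ∀ (x : Vec Bool n) {i j} → i ≢ j → lookup (move i j x) i ≡ false
lookup-move-0 x {i} {j} i≢j = trans (Vec.lookup∘updateAt′ i j i≢j (x [ i ]≔ false)) (Vec.lookup∘updateAt i x)

lookup-move : ∀ (x : Vec Bool n) {i j k} → k ≢ i → k ≢ j → lookup (move i j x) k ≡ lookup x k
lookup-move x {i} {j} {k} k≢i k≢j = trans (Vec.lookup∘updateAt′ k j k≢j (x [ i ]≔ false)) (Vec.lookup∘updateAt′ k i k≢i x)

tf⇒≢ : ∀ (x : Vec Bool n) {i j} → lookup x i ≡ true → lookup x j ≡ false → i ≢ j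
tf⇒≢ x p q refl = t≢f p q

-- Geodesics in the Johnson graph

-- Each step records the bits of the target at the two moved coordinates. An induction along the
-- path therefore knows that coordinates on which both ends agree are never touched.
data Path {n} : Vec Bool n → Vec Bool n → Set where
  done : ∀ {x} → Path x x
  step : ∀ {x y} k l → lookup x k ≡ true → lookup y k ≡ false → lookup x l ≡ false → lookup y l ≡ true →
         Path (move k l x) y → Path x y

cons-path : ∀ b {x y : Vec Bool n} → Path x y → Path (b ∷ x) (b ∷ y)
cons-path b done                  = done
cons-path b (step k l p q r s ps) = step (suc k) (suc l) p q r s (cons-path b ps)

excess : ∀ (x y : Vec Bool n) → weight x < weight y → ∃ λ l → lookup x l ≡ false × lookup y l ≡ true
excess (false ∷ x) (true ∷ y)  h = zero , refl , refl
excess (true ∷ x)  (true ∷ y)  h = let l , p , q = excess x y (ℕ.≤-pred h) in suc l , p , q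
excess (false ∷ x) (false ∷ y) h = let l , p , q = excess x y h in suc l , p , q
excess (true ∷ x)  (false ∷ y) h = let l , p , q = excess x y (ℕ.≤-trans (ℕ.n≤1+n _) h) in suc l , p , q

-- Where the heads differ, equal total weight forces the opposite imbalance in the tails; `excess`
-- locates a coordinate there, and one move corrects both.
path : ∀ (x y : Vec Bool n) → weight x ≡ weight y → Path x y
path []          []          e = done
path (true ∷ x)  (true ∷ y)  e = cons-path true (path x y (ℕ.suc-injective e))
path (false ∷ x) (false ∷ y) e = cons-path false (path x y e)
path (true ∷ x)  (false ∷ y) e with excess x y (ℕ.≤-reflexive e)
... | l , p , q = step zero (suc l) refl refl p q (cons-path false (path _ y (trans (weight-set-true x l p) e)))
path (false ∷ x) (true ∷ y)  e with excess y x (ℕ.≤-reflexive (sym e))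
... | l , p , q = step (suc l) zero q p refl refl (cons-path true (path _ y (ℕ.suc-injective (trans (weight-set-false x l q) e))))

-- Finite sums of integers

sum-sub : (f g : Fin n → ℤ) → sum (λ i → f i -ᶻ g i) ≡ sum f -ᶻ sum g
sum-sub {zero}  f g = refl
sum-sub {suc n} f g rewrite sum-sub (f ∘ suc) (g ∘ suc) = lem (f zero) (g zero) (sum (f ∘ suc)) (sum (g ∘ suc))
  where
  lem : ∀ a b c d → (a -ᶻ b) +ᶻ (c -ᶻ d) ≡ (a +ᶻ c) -ᶻ (b +ᶻ d)
  lem = solve-∀

sum-nonneg : (f : Fin n → ℤ) → (∀ i → 0ℤ ≤ᶻ f i) → 0ℤ ≤ᶻ sum f
sum-nonneg {zero}  f h = ℤ.≤-refl
sum-nonneg {suc n} f h = ℤ.+-mono-≤ (h zero) (sum-nonneg (f ∘ suc) (h ∘ suc))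

sum-nonneg-zero : (f : Fin n → ℤ) → (∀ i → 0ℤ ≤ᶻ f i) → sum f ≡ 0ℤ → ∀ i → f i ≡ 0ℤ
sum-nonneg-zero {suc n} f h e i = go i
  where
  t≥ : 0ℤ ≤ᶻ sum (f ∘ suc)
  t≥ = sum-nonneg (f ∘ suc) (h ∘ suc)
  f0 : f zero ≡ 0ℤ
  f0 = ℤ.≤-antisym (subst₂ _≤ᶻ_ (ℤ.+-identityʳ (f zero)) e (ℤ.+-monoʳ-≤ (f zero) t≥)) (h zero)
  go : ∀ i → f i ≡ 0ℤ
  go zero    = f0
  go (suc i) = sum-nonneg-zero (f ∘ suc) (h ∘ suc)
    (trans (sym (ℤ.+-identityˡ (sum (f ∘ suc)))) (trans (cong (_+ᶻ sum (f ∘ suc)) (sym f0)) e)) i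

when-sub : ∀ b y z → when b (y -ᶻ z) ≡ when b y -ᶻ when b z
when-sub true  y z = refl
when-sub false y z = refl

-- Up, down and adjacency operators

Fun : ℕ → Set
Fun n = Vec Bool n → ℤ

-- Defined on the whole cube and not on one slice: splitting off a coordinate changes the weight,
-- and the three operators together are closed under that recursion.
up down adj : Fun n → Fun n
up φ x   = sum λ j → when (not (lookup x j)) (φ (x [ j ]≔ true))
down φ x = sum λ i → when (lookup x i) (φ (x [ i ]≔ false))
adj φ x  = sum λ i → sum λ j → when (lookup x i ∧ not (lookup x j)) (φ (move i j x))

up-true : ∀ (φ : Fun (suc n)) x → up φ (true ∷ x) ≡ up (φ ∘ (true ∷_)) x
up-true φ x = ℤ.+-identityˡ _

down-false : ∀ (φ : Fun (suc n)) x → down φ (false ∷ x) ≡ down (φ ∘ (false ∷_)) x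
down-false φ x = ℤ.+-identityˡ _

adj-true : ∀ (φ : Fun (suc n)) x → adj φ (true ∷ x) ≡ up (φ ∘ (false ∷_)) x +ᶻ adj (φ ∘ (true ∷_)) x
adj-true {n} φ x = cong₂ _+ᶻ_ (ℤ.+-identityˡ (up (φ ∘ (false ∷_)) x)) (sum-cong-≗ λ i →
  trans (cong (_+ᶻ a i) (cong (λ b → when b (φ (move (suc i) zero (true ∷ x)))) (Bool.∧-zeroʳ (lookup x i)))) (ℤ.+-identityˡ (a i)))
  where
  a : Fin n → ℤ
  a i = sum λ j → when (lookup x i ∧ not (lookup x j)) (φ (true ∷ move i j x))

adj-false : ∀ (φ : Fun (suc n)) x → adj φ (false ∷ x) ≡ down (φ ∘ (true ∷_)) x +ᶻ adj (φ ∘ (false ∷_)) x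
adj-false {n} φ x = begin
  (0ℤ +ᶻ sum {n} (λ _ → 0ℤ)) +ᶻ sum (λ i → d′ i +ᶻ a i)  ≡⟨ cong (_+ᶻ sum (λ i → d′ i +ᶻ a i)) (trans (ℤ.+-identityˡ _) (sum-replicate-zero n)) ⟩
  0ℤ +ᶻ sum (λ i → d′ i +ᶻ a i)                          ≡⟨ ℤ.+-identityˡ _ ⟩
  sum (λ i → d′ i +ᶻ a i)                                ≡⟨ sum-cong-≗ (λ i → cong (_+ᶻ a i) (cong (λ b → when b (φ (true ∷ (x [ i ]≔ false)))) (Bool.∧-identityʳ (lookup x i)))) ⟩
  sum (λ i → d i +ᶻ a i)                                 ≡⟨ ∑-distrib-+ d a ⟩
  sum d +ᶻ sum a                                         ∎
  where
  open ≡-Reasoning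
  d d′ a : Fin n → ℤ
  d i  = when (lookup x i) (φ (true ∷ (x [ i ]≔ false)))
  d′ i = when (lookup x i ∧ true) (φ (true ∷ (x [ i ]≔ false)))
  a i  = sum λ j → when (lookup x i ∧ not (lookup x j)) (φ (false ∷ move i j x))

up-cong : ∀ {φ ψ : Fun n} → (∀ x → φ x ≡ ψ x) → ∀ x → up φ x ≡ up ψ x
up-cong h x = sum-cong-≗ λ j → cong (when (not (lookup x j))) (h _)

down-cong : ∀ {φ ψ : Fun n} → (∀ x → φ x ≡ ψ x) → ∀ x → down φ x ≡ down ψ x
down-cong h x = sum-cong-≗ λ j → cong (when (lookup x j)) (h _)

∧-not-true : ∀ b c → b ∧ not c ≡ true → b ≡ true × c ≡ false
∧-not-true true false e = refl , refl

when-cong : ∀ b {y z} → (b ≡ true → y ≡ z) → when b y ≡ when b z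
when-cong true  h = h refl
when-cong false h = refl

adj-cong-local : ∀ (φ ψ : Fun n) x → (∀ i j → lookup x i ≡ true → lookup x j ≡ false → φ (move i j x) ≡ ψ (move i j x)) →
  adj φ x ≡ adj ψ x
adj-cong-local φ ψ x h = sum-cong-≗ λ i → sum-cong-≗ λ j →
  when-cong (lookup x i ∧ not (lookup x j)) λ e → let p , q = ∧-not-true _ _ e in h i j p q

adj-cong : ∀ {φ ψ : Fun n} w → (∀ x → weight x ≡ w → φ x ≡ ψ x) → ∀ x → weight x ≡ w → adj φ x ≡ adj ψ x
adj-cong {φ = φ} {ψ} w h x e = adj-cong-local φ ψ x λ i j p q → h (move i j x) (trans (weight-move x i j p q) e)

adj-sub : ∀ (φ ψ : Fun n) x → adj (λ y → φ y -ᶻ ψ y) x ≡ adj φ x -ᶻ adj ψ x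
adj-sub φ ψ x = trans (sum-cong-≗ λ i → trans (sum-cong-≗ λ j → when-sub (lookup x i ∧ not (lookup x j)) _ _) (sum-sub (λ j → when (lookup x i ∧ not (lookup x j)) (φ (move i j x))) _)) (sum-sub (λ i → sum λ j → when (lookup x i ∧ not (lookup x j)) (φ (move i j x))) _)

-- Derivatives along a pair of coordinates lower the degree of an eigenfunction

deriv : Fun (2 + n) → Fun n
deriv φ x = φ (true ∷ false ∷ x) -ᶻ φ (false ∷ true ∷ x)

-- The neighbours of (1,0,x) and of (0,1,x) that begin with (0,0) or (1,1) are the same and cancel.
-- Those keeping the first two bits give `adj (deriv φ)`, and the exchange of the two bits
-- contributes minus `deriv φ`.
adj-deriv : ∀ (φ : Fun (2 + n)) x → adj (deriv φ) x ≡ deriv (adj φ) x +ᶻ deriv φ x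
adj-deriv φ x
  rewrite adj-sub (λ y → φ (true ∷ false ∷ y)) (λ y → φ (false ∷ true ∷ y)) x
        | adj-true φ (false ∷ x) | adj-false φ (true ∷ x)
        | adj-true (φ ∘ (false ∷_)) x | adj-false (φ ∘ (true ∷_)) x
        = lem (φ (true ∷ false ∷ x)) (φ (false ∷ true ∷ x)) _ _ _ _
  where
  lem : ∀ p q u d a b → a -ᶻ b ≡ (((q +ᶻ u) +ᶻ (d +ᶻ a)) -ᶻ ((p +ᶻ d) +ᶻ (u +ᶻ b))) +ᶻ (p -ᶻ q)
  lem = solve-∀

-- Linear forms under the three operators

dot : (Fin n → ℤ) → Vec Bool n → ℤ
dot d []      = 0ℤ
dot d (b ∷ x) = d zero *ᶻ β b +ᶻ dot (d ∘ suc) x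

wt wt̄ : Vec Bool n → ℤ
wt x  = pos (weight x)
wt̄ x = pos (weight (compl x))

up-linear : ∀ κ (d : Fin n → ℤ) x → up (λ y → κ +ᶻ dot d y) x ≡ wt̄ x *ᶻ (κ +ᶻ dot d x) +ᶻ dot d (compl x)
up-linear κ d []          = refl
up-linear κ d (true ∷ x)  = begin
  up φ (true ∷ x)           ≡⟨ up-true φ x ⟩
  up (φ ∘ (true ∷_)) x      ≡⟨ up-cong (λ y → sym (ℤ.+-assoc κ _ (dot (d ∘ suc) y))) x ⟩
  up (λ y → κ′ +ᶻ dot (d ∘ suc) y) x ≡⟨ up-linear κ′ (d ∘ suc) x ⟩
  wt̄ x *ᶻ (κ′ +ᶻ dot (d ∘ suc) x) +ᶻ dot (d ∘ suc) (compl x) ≡⟨ lem κ (d zero) (wt̄ x) _ _ ⟩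
  wt̄ x *ᶻ φ (true ∷ x) +ᶻ dot d (compl (true ∷ x)) ∎
  where
  open ≡-Reasoning
  φ = λ y → κ +ᶻ dot d y
  κ′ = κ +ᶻ d zero *ᶻ 1ℤ
  lem : ∀ κ e z s t → z *ᶻ ((κ +ᶻ e *ᶻ 1ℤ) +ᶻ s) +ᶻ t ≡ z *ᶻ (κ +ᶻ (e *ᶻ 1ℤ +ᶻ s)) +ᶻ (e *ᶻ 0ℤ +ᶻ t)
  lem = solve-∀
up-linear κ d (false ∷ x) = begin
  φ (true ∷ x) +ᶻ up (φ ∘ (false ∷_)) x ≡⟨ cong (φ (true ∷ x) +ᶻ_) (up-cong (λ y → sym (ℤ.+-assoc κ _ (dot (d ∘ suc) y))) x) ⟩
  φ (true ∷ x) +ᶻ up (λ y → κ′ +ᶻ dot (d ∘ suc) y) x ≡⟨ cong (φ (true ∷ x) +ᶻ_) (up-linear κ′ (d ∘ suc) x) ⟩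
  φ (true ∷ x) +ᶻ (wt̄ x *ᶻ (κ′ +ᶻ dot (d ∘ suc) x) +ᶻ dot (d ∘ suc) (compl x)) ≡⟨ lem κ (d zero) (wt̄ x) _ _ ⟩
  (1ℤ +ᶻ wt̄ x) *ᶻ φ (false ∷ x) +ᶻ dot d (compl (false ∷ x)) ∎
  where
  open ≡-Reasoning
  φ = λ y → κ +ᶻ dot d y
  κ′ = κ +ᶻ d zero *ᶻ 0ℤ
  lem : ∀ κ e z s t → (κ +ᶻ (e *ᶻ 1ℤ +ᶻ s)) +ᶻ (z *ᶻ ((κ +ᶻ e *ᶻ 0ℤ) +ᶻ s) +ᶻ t) ≡ (1ℤ +ᶻ z) *ᶻ (κ +ᶻ (e *ᶻ 0ℤ +ᶻ s)) +ᶻ (e *ᶻ 1ℤ +ᶻ t)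
  lem = solve-∀

down-linear : ∀ κ (d : Fin n → ℤ) x → down (λ y → κ +ᶻ dot d y) x ≡ wt x *ᶻ (κ +ᶻ dot d x) -ᶻ dot d x
down-linear κ d []          = refl
down-linear κ d (false ∷ x) = begin
  down φ (false ∷ x)           ≡⟨ down-false φ x ⟩
  down (φ ∘ (false ∷_)) x      ≡⟨ down-cong (λ y → sym (ℤ.+-assoc κ _ (dot (d ∘ suc) y))) x ⟩
  down (λ y → κ′ +ᶻ dot (d ∘ suc) y) x ≡⟨ down-linear κ′ (d ∘ suc) x ⟩
  wt x *ᶻ (κ′ +ᶻ dot (d ∘ suc) x) -ᶻ dot (d ∘ suc) x ≡⟨ lem κ (d zero) (wt x) _ ⟩
  wt x *ᶻ φ (false ∷ x) -ᶻ dot d (false ∷ x) ∎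
  where
  open ≡-Reasoning
  φ = λ y → κ +ᶻ dot d y
  κ′ = κ +ᶻ d zero *ᶻ 0ℤ
  lem : ∀ κ e z s → z *ᶻ ((κ +ᶻ e *ᶻ 0ℤ) +ᶻ s) -ᶻ s ≡ z *ᶻ (κ +ᶻ (e *ᶻ 0ℤ +ᶻ s)) -ᶻ (e *ᶻ 0ℤ +ᶻ s)
  lem = solve-∀
down-linear κ d (true ∷ x) = begin
  φ (false ∷ x) +ᶻ down (φ ∘ (true ∷_)) x ≡⟨ cong (φ (false ∷ x) +ᶻ_) (down-cong (λ y → sym (ℤ.+-assoc κ _ (dot (d ∘ suc) y))) x) ⟩
  φ (false ∷ x) +ᶻ down (λ y → κ′ +ᶻ dot (d ∘ suc) y) x ≡⟨ cong (φ (false ∷ x) +ᶻ_) (down-linear κ′ (d ∘ suc) x) ⟩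
  φ (false ∷ x) +ᶻ (wt x *ᶻ (κ′ +ᶻ dot (d ∘ suc) x) -ᶻ dot (d ∘ suc) x) ≡⟨ lem κ (d zero) (wt x) _ ⟩
  (1ℤ +ᶻ wt x) *ᶻ φ (true ∷ x) -ᶻ dot d (true ∷ x) ∎
  where
  open ≡-Reasoning
  φ = λ y → κ +ᶻ dot d y
  κ′ = κ +ᶻ d zero *ᶻ 1ℤ
  lem : ∀ κ e z s → (κ +ᶻ (e *ᶻ 0ℤ +ᶻ s)) +ᶻ (z *ᶻ ((κ +ᶻ e *ᶻ 1ℤ) +ᶻ s) -ᶻ s) ≡ (1ℤ +ᶻ z) *ᶻ (κ +ᶻ (e *ᶻ 1ℤ +ᶻ s)) -ᶻ (e *ᶻ 1ℤ +ᶻ s)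
  lem = solve-∀

-- Every one of x is removed by `wt̄ x` moves and every zero is filled by `wt x` moves. The constant
-- κ is present because the recursion absorbs the contribution of the head bit into it.
adj-linear : ∀ κ (d : Fin n → ℤ) x →
  adj (λ y → κ +ᶻ dot d y) x ≡ (wt x *ᶻ wt̄ x) *ᶻ (κ +ᶻ dot d x) -ᶻ wt̄ x *ᶻ dot d x +ᶻ wt x *ᶻ dot d (compl x)
adj-linear κ d []          = refl
adj-linear κ d (true ∷ x)  = begin
  adj φ (true ∷ x)
    ≡⟨ adj-true φ x ⟩
  up (φ ∘ (false ∷_)) x +ᶻ adj (φ ∘ (true ∷_)) x
    ≡⟨ cong₂ _+ᶻ_ (trans (up-cong (λ y → sym (ℤ.+-assoc κ _ (dot (d ∘ suc) y))) x) (up-linear (κ +ᶻ d zero *ᶻ 0ℤ) (d ∘ suc) x))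
         (trans (adj-cong-local (φ ∘ (true ∷_)) (λ y → (κ +ᶻ d zero *ᶻ 1ℤ) +ᶻ dot (d ∘ suc) y) x λ i j _ _ → sym (ℤ.+-assoc κ _ (dot (d ∘ suc) (move i j x)))) (adj-linear (κ +ᶻ d zero *ᶻ 1ℤ) (d ∘ suc) x)) ⟩
  (wt̄ x *ᶻ ((κ +ᶻ d zero *ᶻ 0ℤ) +ᶻ s) +ᶻ t) +ᶻ ((wt x *ᶻ wt̄ x) *ᶻ ((κ +ᶻ d zero *ᶻ 1ℤ) +ᶻ s) -ᶻ wt̄ x *ᶻ s +ᶻ wt x *ᶻ t)
    ≡⟨ lem κ (d zero) (wt x) (wt̄ x) s t ⟩
  ((1ℤ +ᶻ wt x) *ᶻ wt̄ x) *ᶻ φ (true ∷ x) -ᶻ wt̄ x *ᶻ dot d (true ∷ x) +ᶻ (1ℤ +ᶻ wt x) *ᶻ dot d (compl (true ∷ x)) ∎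
  where
  open ≡-Reasoning
  φ = λ y → κ +ᶻ dot d y
  s = dot (d ∘ suc) x
  t = dot (d ∘ suc) (compl x)
  lem : ∀ κ e w z s t → (z *ᶻ ((κ +ᶻ e *ᶻ 0ℤ) +ᶻ s) +ᶻ t) +ᶻ ((w *ᶻ z) *ᶻ ((κ +ᶻ e *ᶻ 1ℤ) +ᶻ s) -ᶻ z *ᶻ s +ᶻ w *ᶻ t)
    ≡ ((1ℤ +ᶻ w) *ᶻ z) *ᶻ (κ +ᶻ (e *ᶻ 1ℤ +ᶻ s)) -ᶻ z *ᶻ (e *ᶻ 1ℤ +ᶻ s) +ᶻ (1ℤ +ᶻ w) *ᶻ (e *ᶻ 0ℤ +ᶻ t)
  lem = solve-∀
adj-linear κ d (false ∷ x) = begin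
  adj φ (false ∷ x)
    ≡⟨ adj-false φ x ⟩
  down (φ ∘ (true ∷_)) x +ᶻ adj (φ ∘ (false ∷_)) x
    ≡⟨ cong₂ _+ᶻ_ (trans (down-cong (λ y → sym (ℤ.+-assoc κ _ (dot (d ∘ suc) y))) x) (down-linear (κ +ᶻ d zero *ᶻ 1ℤ) (d ∘ suc) x))
         (trans (adj-cong-local (φ ∘ (false ∷_)) (λ y → (κ +ᶻ d zero *ᶻ 0ℤ) +ᶻ dot (d ∘ suc) y) x λ i j _ _ → sym (ℤ.+-assoc κ _ (dot (d ∘ suc) (move i j x)))) (adj-linear (κ +ᶻ d zero *ᶻ 0ℤ) (d ∘ suc) x)) ⟩
  (wt x *ᶻ ((κ +ᶻ d zero *ᶻ 1ℤ) +ᶻ s) -ᶻ s) +ᶻ ((wt x *ᶻ wt̄ x) *ᶻ ((κ +ᶻ d zero *ᶻ 0ℤ) +ᶻ s) -ᶻ wt̄ x *ᶻ s +ᶻ wt x *ᶻ t)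
    ≡⟨ lem κ (d zero) (wt x) (wt̄ x) s t ⟩
  (wt x *ᶻ (1ℤ +ᶻ wt̄ x)) *ᶻ φ (false ∷ x) -ᶻ (1ℤ +ᶻ wt̄ x) *ᶻ dot d (false ∷ x) +ᶻ wt x *ᶻ dot d (compl (false ∷ x)) ∎
  where
  open ≡-Reasoning
  φ = λ y → κ +ᶻ dot d y
  s = dot (d ∘ suc) x
  t = dot (d ∘ suc) (compl x)
  lem : ∀ κ e w z s t → (w *ᶻ ((κ +ᶻ e *ᶻ 1ℤ) +ᶻ s) -ᶻ s) +ᶻ ((w *ᶻ z) *ᶻ ((κ +ᶻ e *ᶻ 0ℤ) +ᶻ s) -ᶻ z *ᶻ s +ᶻ w *ᶻ t)
    ≡ (w *ᶻ (1ℤ +ᶻ z)) *ᶻ (κ +ᶻ (e *ᶻ 0ℤ +ᶻ s)) -ᶻ (1ℤ +ᶻ z) *ᶻ (e *ᶻ 0ℤ +ᶻ s) +ᶻ w *ᶻ (e *ᶻ 1ℤ +ᶻ t)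
  lem = solve-∀

-- Algebra of moves

compl-move : ∀ (x : Vec Bool n) {i j} → i ≢ j → compl (move i j x) ≡ move j i (compl x)
compl-move x {i} {j} i≢j = begin
  compl (move i j x)                          ≡⟨ Vec.map-[]≔ not (x [ i ]≔ false) j ⟩
  compl (x [ i ]≔ false) [ j ]≔ false         ≡⟨ cong (_[ j ]≔ false) (Vec.map-[]≔ not x i) ⟩
  (compl x [ i ]≔ true) [ j ]≔ false          ≡⟨ Vec.[]≔-commutes (compl x) i j i≢j ⟩
  move j i (compl x)                          ∎
  where open ≡-Reasoning

set-same : ∀ (x : Vec Bool n) i {b} → lookup x i ≡ b → x [ i ]≔ b ≡ x
set-same x i e = trans (cong (x [ i ]≔_) (sym e)) (Vec.[]≔-lookup x i)

move-trans : ∀ (x : Vec Bool n) {i j k} → lookup x i ≡ true → lookup x j ≡ false → move j k (move i j x) ≡ move i k x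
move-trans x {i} {j} {k} p q = begin
  (((x [ i ]≔ false) [ j ]≔ true) [ j ]≔ false) [ k ]≔ true ≡⟨ cong (_[ k ]≔ true) (Vec.[]≔-idempotent (x [ i ]≔ false) j) ⟩
  ((x [ i ]≔ false) [ j ]≔ false) [ k ]≔ true               ≡⟨ cong (_[ k ]≔ true) (set-same (x [ i ]≔ false) j (lookup-set-false x i j q)) ⟩
  move i k x                                                ∎
  where open ≡-Reasoning

move-back : ∀ (x : Vec Bool n) {i j} → lookup x i ≡ true → lookup x j ≡ false → move j i (move i j x) ≡ x
move-back x {i} {j} p q = begin
  move j i (move i j x)           ≡⟨ move-trans x p q ⟩
  (x [ i ]≔ false) [ i ]≔ true    ≡⟨ Vec.[]≔-idempotent x i ⟩
  x [ i ]≔ true                   ≡⟨ set-same x i p ⟩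
  x                               ∎
  where open ≡-Reasoning

move-comm : ∀ (x : Vec Bool n) {i j k l} → i ≢ k → i ≢ l → j ≢ k → j ≢ l → move i j (move k l x) ≡ move k l (move i j x)
move-comm x {i} {j} {k} {l} ik il jk jl = begin
  (((x [ k ]≔ false) [ l ]≔ true) [ i ]≔ false) [ j ]≔ true ≡⟨ cong (_[ j ]≔ true) (Vec.[]≔-commutes (x [ k ]≔ false) l i (il ∘ sym)) ⟩
  (((x [ k ]≔ false) [ i ]≔ false) [ l ]≔ true) [ j ]≔ true ≡⟨ Vec.[]≔-commutes _ l j (jl ∘ sym) ⟩
  (((x [ k ]≔ false) [ i ]≔ false) [ j ]≔ true) [ l ]≔ true ≡⟨ cong (λ y → (y [ j ]≔ true) [ l ]≔ true) (Vec.[]≔-commutes x k i (ik ∘ sym)) ⟩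
  (((x [ i ]≔ false) [ k ]≔ false) [ j ]≔ true) [ l ]≔ true ≡⟨ cong (_[ l ]≔ true) (Vec.[]≔-commutes (x [ i ]≔ false) k j (jk ∘ sym)) ⟩
  move k l (move i j x) ∎
  where open ≡-Reasoning

-- Permuting coordinates

-- Position a of the result reads coordinate π(a) of x. Thus a permutation starting with given
-- coordinates brings them to the front, and `Perm.flip π` puts them back.
act : Permutation′ n → Vec Bool n → Vec Bool n
act π x = tabulate λ a → lookup x (π ⟨$⟩ʳ a)

lookup-act : ∀ (π : Permutation′ n) x a → lookup (act π x) a ≡ lookup x (π ⟨$⟩ʳ a)
lookup-act π x a = Vec.lookup∘tabulate _ a

act-flip : ∀ (π : Permutation′ n) x → act (Perm.flip π) (act π x) ≡ x
act-flip π x = lookup-ext λ a → trans (lookup-act (Perm.flip π) (act π x) a)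
  (trans (lookup-act π x _) (cong (lookup x) (Perm.inverseʳ π)))

perm-injective : ∀ (π : Permutation′ n) {a b} → π ⟨$⟩ʳ a ≡ π ⟨$⟩ʳ b → a ≡ b
perm-injective π e = trans (sym (Perm.inverseˡ π)) (trans (cong (π ⟨$⟩ˡ_) e) (Perm.inverseˡ π))

act-set : ∀ (π : Permutation′ n) x i b → act π x [ i ]≔ b ≡ act π (x [ π ⟨$⟩ʳ i ]≔ b)
act-set π x i b = lookup-ext eq
  where
  eq : ∀ a → lookup (act π x [ i ]≔ b) a ≡ lookup (act π (x [ π ⟨$⟩ʳ i ]≔ b)) a
  eq a rewrite lookup-act π (x [ π ⟨$⟩ʳ i ]≔ b) a with a Fin.≟ i
  ... | yes refl = trans (Vec.lookup∘updateAt a (act π x)) (sym (Vec.lookup∘updateAt (π ⟨$⟩ʳ a) x))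
  ... | no a≢i   = trans (Vec.lookup∘updateAt′ a i a≢i (act π x)) (trans (lookup-act π x a)
                     (sym (Vec.lookup∘updateAt′ _ _ (a≢i ∘ perm-injective π) x)))

act-move : ∀ (π : Permutation′ n) x i j → move i j (act π x) ≡ act π (move (π ⟨$⟩ʳ i) (π ⟨$⟩ʳ j) x)
act-move π x i j = trans (cong (_[ j ]≔ true) (act-set π x i false)) (act-set π (x [ π ⟨$⟩ʳ i ]≔ false) j true)

wt-sum : (x : Vec Bool n) → wt x ≡ sum (λ i → β (lookup x i))
wt-sum []          = refl
wt-sum (true ∷ x)  = cong (1ℤ +ᶻ_) (wt-sum x)
wt-sum (false ∷ x) = trans (wt-sum x) (sym (ℤ.+-identityˡ _))

weight-act : ∀ (π : Permutation′ n) x → weight (act π x) ≡ weight x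
weight-act π x = ℤ.+-injective (begin
  wt (act π x)                          ≡⟨ wt-sum (act π x) ⟩
  sum (λ i → β (lookup (act π x) i))    ≡⟨ sum-cong-≗ (λ i → cong β (lookup-act π x i)) ⟩
  sum (λ i → β (lookup x (π ⟨$⟩ʳ i)))   ≡⟨ sum-permute (β ∘ lookup x) π ⟨
  sum (λ i → β (lookup x i))            ≡⟨ wt-sum x ⟨
  wt x                                  ∎)
  where open ≡-Reasoning

adj-act : ∀ (π : Permutation′ n) (φ : Fun n) x → adj (φ ∘ act π) x ≡ adj φ (act π x)
adj-act {n} π φ x = begin
  sum (λ i → sum (T i))                             ≡⟨ sum-permute (λ i → sum (T i)) π ⟩
  sum (λ i → sum (T (π ⟨$⟩ʳ i)))                    ≡⟨ sum-cong-≗ (λ i → sum-permute (T (π ⟨$⟩ʳ i)) π) ⟩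
  sum (λ i → sum (λ j → T (π ⟨$⟩ʳ i) (π ⟨$⟩ʳ j)))   ≡⟨ sum-cong-≗ (λ i → sum-cong-≗ (λ j → eq i j)) ⟩
  adj φ (act π x)                                   ∎
  where
  open ≡-Reasoning
  T : Fin n → Fin n → ℤ
  T i j = when (lookup x i ∧ not (lookup x j)) (φ (act π (move i j x)))
  eq : ∀ i j → T (π ⟨$⟩ʳ i) (π ⟨$⟩ʳ j) ≡ when (lookup (act π x) i ∧ not (lookup (act π x) j)) (φ (move i j (act π x)))
  eq i j rewrite lookup-act π x i | lookup-act π x j | act-move π x i j = refl

-- Prescribing bits at chosen coordinates

opaque
  -- Built by insertion: the other values of `p` avoid `p zero`, so `punchOut` renumbers them for
  -- the recursion.
  perm-through : ∀ r {m} (p : Fin r → Fin (r + m)) → Injective _≡_ _≡_ p →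
    Σ (Permutation′ (r + m)) λ π → ∀ a → π ⟨$⟩ʳ (a ↑ˡ m) ≡ p a
  perm-through zero        p p-inj = Perm.id , λ ()
  perm-through (suc r) {m} p p-inj = Perm.insert zero (p zero) (proj₁ rec) , eq
    where
    p₀≢ : ∀ a → p zero ≢ p (suc a)
    p₀≢ a e = case p-inj e of λ ()
    q : Fin r → Fin (r + m)
    q a = punchOut (p₀≢ a)
    rec : Σ (Permutation′ (r + m)) λ π → ∀ a → π ⟨$⟩ʳ (a ↑ˡ m) ≡ q a
    rec = perm-through r q λ {a} {b} e → Fin.suc-injective (p-inj (Fin.punchOut-injective (p₀≢ a) (p₀≢ b) e))
    eq : ∀ a → Perm.insert zero (p zero) (proj₁ rec) ⟨$⟩ʳ (a ↑ˡ m) ≡ p a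
    eq zero    = refl
    eq (suc a) = trans (cong (punchIn (p zero)) (proj₂ rec a)) (Fin.punchIn-punchOut (p₀≢ a))

front : ∀ {r m} (p : Vec (Fin (r + m)) r) → Unique p → Σ (Permutation′ (r + m)) λ π → ∀ a → π ⟨$⟩ʳ (a ↑ˡ m) ≡ lookup p a
front {r} p u = perm-through r (lookup p) (lookup-injective u _ _)

opaque
  fill : ∀ m k → k ≤ m → ∃ λ (u : Vec Bool m) → weight u ≡ k
  fill zero    zero    _       = [] , refl
  fill (suc m) zero    _       = let u , e = fill m 0 z≤n in false ∷ u , e
  fill (suc m) (suc k) (s≤s h) = let u , e = fill m k h in true ∷ u , cong suc e

weight-++ : ∀ (s : Vec Bool m) (u : Vec Bool n) → weight (s ++ u) ≡ weight s + weight u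
weight-++ []      u = refl
weight-++ (b ∷ s) u = trans (cong (b2n b +_) (weight-++ s u)) (sym (ℕ.+-assoc (b2n b) _ _))

opaque
  -- The bits are put in front, the rest is filled up to weight `W`, and the result is permuted
  -- back. The two bounds say that the prescribed ones are not too many and that the free positions
  -- can hold the others.
  pattern-exists : ∀ {r m} (p : Vec (Fin (r + m)) r) → Unique p → (s : Vec Bool r) → ∀ W → weight s ≤ W → W ≤ weight s + m →
    ∃ λ x → weight x ≡ W × (∀ a → lookup x (lookup p a) ≡ lookup s a)
  pattern-exists {r} {m} p u s W lo hi =
    let π , πp = front p u
        v , e  = fill m (W ∸ weight s) (ℕ.≤-trans (ℕ.∸-monoˡ-≤ (weight s) hi) (ℕ.≤-reflexive (ℕ.m+n∸m≡n (weight s) m)))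
        x      = act (Perm.flip π) (s ++ v)
        wx     = begin
          weight x                     ≡⟨ weight-act (Perm.flip π) (s ++ v) ⟩
          weight (s ++ v)              ≡⟨ weight-++ s v ⟩
          weight s + weight v          ≡⟨ cong (weight s +_) e ⟩
          weight s + (W ∸ weight s)    ≡⟨ ℕ.m+[n∸m]≡n lo ⟩
          W                            ∎
    in x , wx , λ a → trans (lookup-act (Perm.flip π) (s ++ v) (lookup p a))
         (trans (cong (lookup (s ++ v)) (trans (cong (π ⟨$⟩ˡ_) (sym (πp a))) (Perm.inverseˡ π))) (Vec.lookup-++ˡ s v a))
    where open ≡-Reasoning

-- Harmonic functions on a slice are constant

max-on-slice : ∀ n W (H : Fun n) → (∀ (v : Vec Bool n) → weight v ≢ W) ⊎ ∃ λ v₀ → weight v₀ ≡ W × (∀ v → weight v ≡ W → H v ≤ᶻ H v₀)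
max-on-slice zero zero    H = inj₂ ([] , refl , λ { [] _ → ℤ.≤-refl })
max-on-slice zero (suc W) H = inj₁ λ { [] () }
max-on-slice (suc n) zero H with max-on-slice n zero (H ∘ (false ∷_))
... | inj₁ none         = inj₁ λ { (true ∷ v) () ; (false ∷ v) e → none v e }
... | inj₂ (v₀ , e , h) = inj₂ (false ∷ v₀ , e , λ { (true ∷ v) () ; (false ∷ v) e′ → h v e′ })
max-on-slice (suc n) (suc W) H with max-on-slice n W (H ∘ (true ∷_)) | max-on-slice n (suc W) (H ∘ (false ∷_))
... | inj₁ none         | inj₁ none′           = inj₁ λ { (true ∷ v) e → none v (ℕ.suc-injective e) ; (false ∷ v) e → none′ v e }
... | inj₁ none         | inj₂ (v₁ , e₁ , h₁)  = inj₂ (false ∷ v₁ , e₁ , λ { (true ∷ v) e → contradiction (ℕ.suc-injective e) (none v) ; (false ∷ v) e → h₁ v e })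
... | inj₂ (v₀ , e , h) | inj₁ none′           = inj₂ (true ∷ v₀ , cong suc e , λ { (true ∷ v) e → h v (ℕ.suc-injective e) ; (false ∷ v) e → contradiction e (none′ v) })
... | inj₂ (v₀ , e , h) | inj₂ (v₁ , e₁ , h₁) with ℤ.≤-total (H (true ∷ v₀)) (H (false ∷ v₁))
...   | inj₁ le = inj₂ (false ∷ v₁ , e₁ , λ { (true ∷ v) e → ℤ.≤-trans (h v (ℕ.suc-injective e)) le ; (false ∷ v) e → h₁ v e })
...   | inj₂ ge = inj₂ (true ∷ v₀ , cong suc e , λ { (true ∷ v) e → h v (ℕ.suc-injective e) ; (false ∷ v) e → ℤ.≤-trans (h₁ v e) ge })

dot-zero : (x : Vec Bool n) → dot (λ _ → 0ℤ) x ≡ 0ℤ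
dot-zero []      = refl
dot-zero (b ∷ x) = trans (ℤ.+-identityˡ _) (dot-zero x)

adj-const : ∀ κ (x : Vec Bool n) → adj (λ _ → κ) x ≡ (wt x *ᶻ wt̄ x) *ᶻ κ
adj-const κ x = begin
  adj (λ _ → κ) x                       ≡⟨ adj-cong-local (λ _ → κ) (λ y → κ +ᶻ dot (λ _ → 0ℤ) y) x (λ i j _ _ → sym (trans (cong (κ +ᶻ_) (dot-zero (move i j x))) (ℤ.+-identityʳ κ))) ⟩
  adj (λ y → κ +ᶻ dot (λ _ → 0ℤ) y) x   ≡⟨ adj-linear κ (λ _ → 0ℤ) x ⟩
  _                                     ≡⟨ cong₂ (λ a b → (wt x *ᶻ wt̄ x) *ᶻ (κ +ᶻ a) -ᶻ wt̄ x *ᶻ a +ᶻ wt x *ᶻ b) (dot-zero x) (dot-zero (compl x)) ⟩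
  _                                     ≡⟨ lem (wt x) (wt̄ x) κ ⟩
  (wt x *ᶻ wt̄ x) *ᶻ κ                   ∎
  where
  open ≡-Reasoning
  lem : ∀ w z κ → (w *ᶻ z) *ᶻ (κ +ᶻ 0ℤ) -ᶻ z *ᶻ 0ℤ +ᶻ w *ᶻ 0ℤ ≡ (w *ᶻ z) *ᶻ κ
  lem = solve-∀

when-nonneg : ∀ b {z} → (b ≡ true → 0ℤ ≤ᶻ z) → 0ℤ ≤ᶻ when b z
when-nonneg true  h = h refl
when-nonneg false h = ℤ.≤-refl

opaque
  -- At a maximum with value M, the differences M - H over the neighbours are nonnegative and sum to
  -- zero, so every neighbour is a maximum too; paths spread this over the slice.
  harmonic-constant : ∀ W (H : Fun n) → (∀ v → weight v ≡ W → adj H v ≡ (wt v *ᶻ wt̄ v) *ᶻ H v) →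
    ∃ λ δ → ∀ v → weight v ≡ W → H v ≡ δ
  harmonic-constant {n} W H harm with max-on-slice n W H
  ... | inj₁ none              = 0ℤ , λ v e → contradiction e (none v)
  ... | inj₂ (v₀ , e₀ , bound) = M , λ v e → along (path v₀ v (trans e₀ (sym e))) e₀ refl
    where
    M : ℤ
    M = H v₀
    at-move : ∀ v → weight v ≡ W → H v ≡ M → ∀ k l → lookup v k ≡ true → lookup v l ≡ false → H (move k l v) ≡ M
    at-move v e Hv k l p q = sym (ℤ.i-j≡0⇒i≡j M _ (subst (λ b → when b (M -ᶻ H (move k l v)) ≡ 0ℤ) (cong₂ (λ b c → b ∧ not c) p q) zero-term))
      where
      T : Fin n → Fin n → ℤ
      T i j = when (lookup v i ∧ not (lookup v j)) (M -ᶻ H (move i j v))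
      T≥0 : ∀ i j → 0ℤ ≤ᶻ T i j
      T≥0 i j = when-nonneg _ λ c → let a , b = ∧-not-true _ _ c in ℤ.i≤j⇒0≤j-i (bound _ (trans (weight-move v i j a b) e))
      total : adj (λ y → M -ᶻ H y) v ≡ 0ℤ
      total = begin
        adj (λ y → M -ᶻ H y) v                              ≡⟨ adj-sub (λ _ → M) H v ⟩
        adj (λ _ → M) v -ᶻ adj H v                          ≡⟨ cong₂ _-ᶻ_ (adj-const M v) (trans (harm v e) (cong ((wt v *ᶻ wt̄ v) *ᶻ_) Hv)) ⟩
        (wt v *ᶻ wt̄ v) *ᶻ M -ᶻ (wt v *ᶻ wt̄ v) *ᶻ M          ≡⟨ ℤ.+-inverseʳ ((wt v *ᶻ wt̄ v) *ᶻ M) ⟩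
        0ℤ                                                  ∎
        where open ≡-Reasoning
      zero-term : T k l ≡ 0ℤ
      zero-term = sum-nonneg-zero (T k) (T≥0 k) (sum-nonneg-zero (λ i → sum (T i)) (λ i → sum-nonneg (T i) (T≥0 i)) total k) l
    along : ∀ {v v′} → Path v v′ → weight v ≡ W → H v ≡ M → H v′ ≡ M
    along done _ h = h
    along (step {x} k l p _ q _ ps) e h = along ps (trans (weight-move x k l p q) e) (at-move x e h k l p q)

-- Functions whose first differences are constant are linear

dot-set-true : ∀ (d : Fin n → ℤ) x j → lookup x j ≡ false → dot d (x [ j ]≔ true) ≡ dot d x +ᶻ d j
dot-set-true d (false ∷ x) zero    e = lem (d zero) _
  where
  lem : ∀ a s → a *ᶻ 1ℤ +ᶻ s ≡ (a *ᶻ 0ℤ +ᶻ s) +ᶻ a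
  lem = solve-∀
dot-set-true d (b ∷ x) (suc j) e = trans (cong (d zero *ᶻ β b +ᶻ_) (dot-set-true (d ∘ suc) x j e)) (sym (ℤ.+-assoc (d zero *ᶻ β b) _ _))

dot-set-false : ∀ (d : Fin n → ℤ) x j → lookup x j ≡ true → dot d (x [ j ]≔ false) ≡ dot d x -ᶻ d j
dot-set-false d (true ∷ x) zero    e = lem (d zero) _
  where
  lem : ∀ a s → a *ᶻ 0ℤ +ᶻ s ≡ (a *ᶻ 1ℤ +ᶻ s) -ᶻ a
  lem = solve-∀
dot-set-false d (b ∷ x) (suc j) e = trans (cong (d zero *ᶻ β b +ᶻ_) (dot-set-false (d ∘ suc) x j e)) (sym (ℤ.+-assoc (d zero *ᶻ β b) _ _))

dot-move : ∀ (d : Fin n → ℤ) x i j → lookup x i ≡ true → lookup x j ≡ false → dot d (move i j x) ≡ (dot d x -ᶻ d i) +ᶻ d j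
dot-move d x i j p q = trans (dot-set-true d (x [ i ]≔ false) j (lookup-set-false x i j q)) (cong (_+ᶻ d j) (dot-set-false d x i p))

diff : Fun n → Fin n → Fin n → Fun n
diff φ i j x = φ x -ᶻ φ (move i j x)

ConstantDifferences : ℕ → Fun n → Set
ConstantDifferences W h = ∀ k l → k ≢ l → ∃ λ δ → ∀ x → weight x ≡ W → lookup x k ≡ true → lookup x l ≡ false → diff h k l x ≡ δ

module _ {m W} {h : Fun (3 + m)} (lo : 1 ≤ W) (hi : W ≤ suc m) (const : ConstantDifferences W h) where

  -- Only differences of slopes are visible on a slice, so the slope at coordinate zero may be set
  -- to 0; the common shift goes into the constant term.
  slope : Fin (3 + m) → ℤ
  slope zero    = 0ℤ
  slope (suc k) = proj₁ (const (suc k) zero (Fin.0≢1+n ∘ sym))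

  private
    at-zero : ∀ k x → weight x ≡ W → lookup x (suc k) ≡ true → lookup x zero ≡ false → diff h (suc k) zero x ≡ slope (suc k)
    at-zero k = proj₂ (const (suc k) zero (Fin.0≢1+n ∘ sym))

  -- For k and l both different from coordinate zero, the constant difference may be computed at any
  -- vertex. One with bits 1, 0, 0 at k, l and zero is chosen: there the move from k to zero factors
  -- through l, which expresses the difference by two slopes.
  diff-slope : ∀ x k l → weight x ≡ W → lookup x k ≡ true → lookup x l ≡ false → diff h k l x ≡ slope k -ᶻ slope l
  diff-slope x zero zero e p q = t≢f p q
  diff-slope x (suc k) zero e p q = trans (at-zero k x e p q) (sym (ℤ.+-identityʳ _))
  diff-slope x zero (suc l) e p q = begin
    h x -ᶻ h y                   ≡⟨ lem (h x) (h y) ⟩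
    0ℤ -ᶻ (h y -ᶻ h x)           ≡⟨ cong (λ z → 0ℤ -ᶻ (h y -ᶻ h z)) (move-back x p q) ⟨
    0ℤ -ᶻ diff h (suc l) zero y  ≡⟨ cong (0ℤ -ᶻ_) (at-zero l y (trans (weight-move x zero (suc l) p q) e) (lookup-move-1 x zero (suc l)) (lookup-move-0 x λ ())) ⟩
    0ℤ -ᶻ slope (suc l)          ∎
    where
    open ≡-Reasoning
    y = move zero (suc l) x
    lem : ∀ a b → a -ᶻ b ≡ 0ℤ -ᶻ (b -ᶻ a)
    lem = solve-∀
  diff-slope x (suc k) (suc l) e p q = go (const (suc k) (suc l) (tf⇒≢ x p q))
    (pattern-exists (suc k ∷ suc l ∷ zero ∷ []) ((tf⇒≢ x p q ∷ (λ ()) ∷ []) ∷ ((λ ()) ∷ []) ∷ [] ∷ []) (true ∷ false ∷ false ∷ []) W lo hi)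
    where
    open ≡-Reasoning
    lem : ∀ a b c → a -ᶻ b ≡ (a -ᶻ c) -ᶻ (b -ᶻ c)
    lem = solve-∀
    go : (∃ λ δ → ∀ x → weight x ≡ W → lookup x (suc k) ≡ true → lookup x (suc l) ≡ false → diff h (suc k) (suc l) x ≡ δ) →
         (∃ λ y → weight y ≡ W × (∀ a → lookup y (lookup (suc k ∷ suc l ∷ zero ∷ []) a) ≡ lookup (true ∷ false ∷ false ∷ []) a)) →
         diff h (suc k) (suc l) x ≡ slope (suc k) -ᶻ slope (suc l)
    go (δ , isδ) (y , ey , pat) = begin
      h x -ᶻ h (move (suc k) (suc l) x)  ≡⟨ isδ x e p q ⟩
      δ                                  ≡⟨ isδ y ey pk pl ⟨
      h y -ᶻ h z                         ≡⟨ lem (h y) (h z) (h u) ⟩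
      (h y -ᶻ h u) -ᶻ (h z -ᶻ h u)       ≡⟨ cong (λ v → (h y -ᶻ h u) -ᶻ (h z -ᶻ h v)) (move-trans y pk pl) ⟨
      diff h (suc k) zero y -ᶻ diff h (suc l) zero z
                                         ≡⟨ cong₂ _-ᶻ_ (at-zero k y ey pk p0) (at-zero l z (trans (weight-move y _ _ pk pl) ey)
                                              (lookup-move-1 y (suc k) (suc l)) (trans (lookup-move y (λ ()) (λ ())) p0)) ⟩
      slope (suc k) -ᶻ slope (suc l)     ∎
      where
      pk = pat zero
      pl = pat (suc zero)
      p0 = pat (suc (suc zero))
      z = move (suc k) (suc l) y
      u = move (suc k) zero y

  private
    along : ∀ {x x′} → Path x x′ → weight x ≡ W → h x -ᶻ dot slope x ≡ h x′ -ᶻ dot slope x′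
    along done _ = refl
    along (step {x} k l p _ q _ ps) e = trans eq (along ps (trans (weight-move x k l p q) e))
      where
      eq : h x -ᶻ dot slope x ≡ h (move k l x) -ᶻ dot slope (move k l x)
      r : ∀ a b s u v → a -ᶻ s ≡ ((a -ᶻ b) -ᶻ (u -ᶻ v)) +ᶻ (b -ᶻ ((s -ᶻ u) +ᶻ v))
      r = solve-∀
      eq = trans (r (h x) (h (move k l x)) (dot slope x) (slope k) (slope l))
             (trans (cong₂ _+ᶻ_ (ℤ.i≡j⇒i-j≡0 (diff-slope x k l e p q)) (cong (h (move k l x) -ᶻ_) (sym (dot-move slope x k l p q)))) (ℤ.+-identityˡ _))

  linear-from-differences : ∃₂ λ κ d → ∀ x → weight x ≡ W → h x ≡ κ +ᶻ dot d x
  linear-from-differences = go (fill (3 + m) W (ℕ.≤-trans hi (ℕ.m≤n+m (suc m) 2)))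
    where
    cancel : ∀ a b → (a -ᶻ b) +ᶻ b ≡ a
    cancel = solve-∀
    go : ∃ (λ (x₀ : Vec Bool (3 + m)) → weight x₀ ≡ W) → ∃₂ λ κ d → ∀ x → weight x ≡ W → h x ≡ κ +ᶻ dot d x
    go (x₀ , e₀) = h x₀ -ᶻ dot slope x₀ , slope , λ x e →
      sym (trans (cong (_+ᶻ dot slope x) (along (path x₀ x (trans e₀ (sym e))) e₀)) (cancel (h x) (dot slope x)))

-- Second differences of a λ₂-eigenfunction are constant

follow : ∀ {x y : Vec Bool n} (P : Vec Bool n → Set) →
  (∀ z i j → lookup z i ≡ true → lookup z j ≡ false → lookup y i ≡ false → lookup y j ≡ true → P z → P (move i j z)) →
  Path x y → P x → P y
follow P h done                  px = px
follow P h (step k l p q r s ps) px = follow P h ps (h _ k l p r q s px)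

-- The additive c admits a characteristic function without subtracting its mean; for the first cell
-- of a partition it is the lower left entry of the quotient matrix.
record Eigen (w : ℕ) (μ c : ℤ) (φ : Fun n) : Set where
  constructor eigen
  field at : ∀ x → weight x ≡ w → adj φ x ≡ μ *ᶻ φ x +ᶻ c
open Eigen

eigen-act : ∀ {w μ c} {φ : Fun n} (π : Permutation′ n) → Eigen w μ c φ → Eigen w μ c (φ ∘ act π)
eigen-act {φ = φ} π eig .at x e = trans (adj-act π φ x) (eig .at (act π x) (trans (weight-act π x) e))

deriv-eigen : ∀ {w μ c} {φ : Fun (2 + n)} → Eigen (suc w) μ c φ → Eigen w (μ +ᶻ 1ℤ) 0ℤ (deriv φ)
deriv-eigen {μ = μ} {c} {φ} eig .at x e = trans (adj-deriv φ x)
  (trans (cong (_+ᶻ deriv φ x) (cong₂ _-ᶻ_ (eig .at (true ∷ false ∷ x) (cong suc e)) (eig .at (false ∷ true ∷ x) (cong suc e))))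
    (lem μ c (φ (true ∷ false ∷ x)) (φ (false ∷ true ∷ x))))
  where
  lem : ∀ μ c a b → ((μ *ᶻ a +ᶻ c) -ᶻ (μ *ᶻ b +ᶻ c)) +ᶻ (a -ᶻ b) ≡ (μ +ᶻ 1ℤ) *ᶻ (a -ᶻ b) +ᶻ 0ℤ
  lem = solve-∀

λ₂ : ℕ → ℤ
λ₂ w = (pos w -ᶻ pos 2) *ᶻ (pos w -ᶻ pos 2) -ᶻ pos 2

-- The last two hypotheses give s - t = 2o, so the left side of the first is (W² - 2W)o = λ₁ o.
-- Comparison with λ₂ o leaves the factor λ₁ - λ₂ = 2(W - 1).
odd-linear-eigen : ∀ W κ s t o → (W *ᶻ W) *ᶻ (κ +ᶻ s) -ᶻ W *ᶻ s +ᶻ W *ᶻ t ≡ ((W -ᶻ pos 2) *ᶻ (W -ᶻ pos 2) -ᶻ pos 2) *ᶻ o +ᶻ 0ℤ →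
  o ≡ κ +ᶻ s → κ +ᶻ t ≡ neg o → (pos 2 *ᶻ (W -ᶻ 1ℤ)) *ᶻ o ≡ 0ℤ
odd-linear-eigen W κ s t o h₁ h₂ h₃ = trans (ring W κ s t o)
  (trans (cong₂ (λ a b → a +ᶻ (W *ᶻ W -ᶻ W) *ᶻ b -ᶻ W *ᶻ ((κ +ᶻ t) -ᶻ neg o)) (ℤ.i≡j⇒i-j≡0 h₁) (ℤ.i≡j⇒i-j≡0 h₂))
    (trans (cong (λ c → 0ℤ +ᶻ (W *ᶻ W -ᶻ W) *ᶻ 0ℤ -ᶻ W *ᶻ c) (ℤ.i≡j⇒i-j≡0 h₃)) (ring₀ W)))
  where
  ring : ∀ W κ s t o → (pos 2 *ᶻ (W -ᶻ 1ℤ)) *ᶻ o ≡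
    (((W *ᶻ W) *ᶻ (κ +ᶻ s) -ᶻ W *ᶻ s +ᶻ W *ᶻ t) -ᶻ (((W -ᶻ pos 2) *ᶻ (W -ᶻ pos 2) -ᶻ pos 2) *ᶻ o +ᶻ 0ℤ))
      +ᶻ (W *ᶻ W -ᶻ W) *ᶻ (o -ᶻ (κ +ᶻ s)) -ᶻ W *ᶻ ((κ +ᶻ t) -ᶻ neg o)
  ring = solve-∀
  ring₀ : ∀ W → 0ℤ +ᶻ (W *ᶻ W -ᶻ W) *ᶻ 0ℤ -ᶻ W *ᶻ 0ℤ ≡ 0ℤ
  ring₀ = solve-∀

-- Weight and length enter through equations, so that vectors of length `4 + m` expose four bits by
-- pattern matching although the length is w + w.
module Quadratic {m u w : ℕ} (2+u≡w : 2 + u ≡ w) (n≡2w : 4 + m ≡ w + w) {c : ℤ} where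

  m≡2u : m ≡ u + u
  m≡2u = ℕ.+-cancelˡ-≡ 4 m (u + u) (trans n≡2w (trans (cong₂ _+_ (sym 2+u≡w) (sym 2+u≡w)) (cong (2 +_) (ℕ.+-comm u (2 + u)))))

  weight-compl-w : ∀ (x : Vec Bool (4 + m)) → weight x ≡ w → weight (compl x) ≡ w
  weight-compl-w x e = ℕ.+-cancelˡ-≡ w _ _ (trans (cong (_+ weight (compl x)) (sym e)) (trans (weight-compl x) n≡2w))

  second-derivative-constant : ∀ {φ : Fun (4 + m)} → Eigen w (λ₂ w) c φ → ∃ λ δ → ∀ v → weight v ≡ u → deriv (deriv φ) v ≡ δ
  second-derivative-constant {φ} eig = harmonic-constant u (deriv (deriv φ)) λ v e →
    trans (eig″ .at v e) (trans (lem (pos w) (deriv (deriv φ) v))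
      (cong (_*ᶻ deriv (deriv φ) v) (trans (cong (λ a → a *ᶻ a) w-2) (cong₂ (λ a b → pos a *ᶻ pos b) (sym e) (sym (wc v e))))))
    where
    eig″ : Eigen u (λ₂ w +ᶻ 1ℤ +ᶻ 1ℤ) 0ℤ (deriv (deriv φ))
    eig″ = deriv-eigen (deriv-eigen (subst (λ w′ → Eigen w′ (λ₂ w) c φ) (sym 2+u≡w) eig))
    w-2 : pos w -ᶻ pos 2 ≡ pos u
    w-2 = trans (cong (λ a → pos a -ᶻ pos 2) (sym 2+u≡w)) (ring (pos u))
      where
      ring : ∀ a → (pos 2 +ᶻ a) -ᶻ pos 2 ≡ a
      ring = solve-∀
    wc : ∀ v → weight v ≡ u → weight (compl v) ≡ u
    wc v e = ℕ.+-cancelˡ-≡ u _ _ (trans (cong (_+ weight (compl v)) (sym e)) (trans (weight-compl v) m≡2u))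
    lem : ∀ W h → (((W -ᶻ pos 2) *ᶻ (W -ᶻ pos 2) -ᶻ pos 2) +ᶻ 1ℤ +ᶻ 1ℤ) *ᶻ h +ᶻ 0ℤ ≡ ((W -ᶻ pos 2) *ᶻ (W -ᶻ pos 2)) *ᶻ h
    lem = solve-∀

  ConstantSecondDifference : Fun (4 + m) → (i j k l : Fin (4 + m)) → Set
  ConstantSecondDifference φ i j k l = ∃ λ δ → ∀ x → weight x ≡ w →
    lookup x i ≡ true → lookup x j ≡ false → lookup x k ≡ true → lookup x l ≡ false →
    diff φ i j x -ᶻ diff φ i j (move k l x) ≡ δ

  -- A permutation bringing i, j, k, l to the front turns this difference into the second
  -- derivative, and the eigenvalue equation is invariant under permutations.
  second-difference-constant : ∀ {φ} → Eigen w (λ₂ w) c φ → ∀ i j k l → Unique (i ∷ j ∷ k ∷ l ∷ []) → ConstantSecondDifference φ i j k l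
  second-difference-constant {φ} eig i j k l uniq = go (front (i ∷ j ∷ k ∷ l ∷ []) uniq)
    where
    shape : (y : Vec Bool (4 + m)) → lookup y zero ≡ true → lookup y (suc zero) ≡ false →
      lookup y (suc (suc zero)) ≡ true → lookup y (suc (suc (suc zero))) ≡ false →
      ∃ λ v → y ≡ true ∷ false ∷ true ∷ false ∷ v
    shape (true ∷ false ∷ true ∷ false ∷ v) refl refl refl refl = v , refl
    go : (Σ (Permutation′ (4 + m)) λ π → ∀ a → π ⟨$⟩ʳ (a ↑ˡ m) ≡ lookup (i ∷ j ∷ k ∷ l ∷ []) a) → ConstantSecondDifference φ i j k l
    go (π , πp) = proj₁ const , λ x e pi pj pk pl →
      let v , Y≡ = shape (act π x) (bit zero x pi) (bit (suc zero) x pj) (bit (suc (suc zero)) x pk) (bit (suc (suc (suc zero))) x pl)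
          we : weight v ≡ u
          we = ℕ.+-cancelˡ-≡ 2 _ _ (trans (cong weight (sym Y≡)) (trans (weight-act π x) (trans e (sym 2+u≡w))))
      in trans (cong₂ _-ᶻ_ (to-front x) (trans (to-front (move k l x)) (cong (λ y → diff ψ zero (suc zero) y) (sym (kl x)))))
           (trans (cong (λ y → diff ψ zero (suc zero) y -ᶻ diff ψ zero (suc zero) (move (suc (suc zero)) (suc (suc (suc zero))) y)) Y≡)
             (proj₂ const v we))
      where
      ψ : Fun (4 + m)
      ψ = φ ∘ act (Perm.flip π)
      const = second-derivative-constant (eigen-act (Perm.flip π) eig)
      bit : ∀ a x {b} → lookup x (lookup (i ∷ j ∷ k ∷ l ∷ []) a) ≡ b → lookup (act π x) (a ↑ˡ m) ≡ b
      bit a x p = trans (lookup-act π x (a ↑ˡ m)) (trans (cong (lookup x) (πp a)) p)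
      ψ-act : ∀ x → φ x ≡ ψ (act π x)
      ψ-act x = cong φ (sym (act-flip π x))
      ij : ∀ x → move zero (suc zero) (act π x) ≡ act π (move i j x)
      ij x = trans (act-move π x zero (suc zero)) (cong₂ (λ a b → act π (move a b x)) (πp zero) (πp (suc zero)))
      kl : ∀ x → move (suc (suc zero)) (suc (suc (suc zero))) (act π x) ≡ act π (move k l x)
      kl x = trans (act-move π x _ _) (cong₂ (λ a b → act π (move a b x)) (πp (suc (suc zero))) (πp (suc (suc (suc zero)))))
      to-front : ∀ x → diff φ i j x ≡ diff ψ zero (suc zero) (act π x)
      to-front x = cong₂ _-ᶻ_ (ψ-act x) (trans (ψ-act (move i j x)) (cong ψ (sym (ij x))))

  -- Oddness kills second differences, so the odd part is linear; but linear functions belong to λ₁ ≠ λ₂.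
  module _ {φ : Fun (4 + m)} (eig : Eigen w (λ₂ w) c φ) where

    private
      odd : Fun (4 + m)
      odd x = φ x -ᶻ φ (compl x)

      adj-compl : ∀ x → adj (φ ∘ compl) x ≡ adj φ (compl x)
      adj-compl x = trans (sum-cong-≗ λ i → sum-cong-≗ λ j → term i j)
        (∑-comm λ i j → when (lookup (compl x) j ∧ not (lookup (compl x) i)) (φ (move j i (compl x))))
        where
        term : ∀ i j → when (lookup x i ∧ not (lookup x j)) (φ (compl (move i j x))) ≡
                       when (lookup (compl x) j ∧ not (lookup (compl x) i)) (φ (move j i (compl x)))
        term i j rewrite Vec.lookup-map i not x | Vec.lookup-map j not x with lookup x i in p | lookup x j in q
        ... | true  | true  = refl
        ... | true  | false = cong φ (compl-move x (tf⇒≢ x p q))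
        ... | false | true  = refl
        ... | false | false = refl

      odd-eigen : Eigen w (λ₂ w) 0ℤ odd
      odd-eigen .at x e = trans (adj-sub φ (φ ∘ compl) x)
        (trans (cong₂ _-ᶻ_ (eig .at x e) (trans (adj-compl x) (eig .at (compl x) (weight-compl-w x e)))) (lem (λ₂ w) c (φ x) (φ (compl x))))
        where
        lem : ∀ μ c a b → (μ *ᶻ a +ᶻ c) -ᶻ (μ *ᶻ b +ᶻ c) ≡ μ *ᶻ (a -ᶻ b) +ᶻ 0ℤ
        lem = solve-∀

      -- Complementation maps the square spanned at x by the two moves onto the square spanned at
      -- `y` by the same moves, with opposite corners exchanged. Both squares have second difference
      -- δ under φ, so that of `odd` is δ - δ.
      odd-second-difference : ∀ i j k l → Unique (i ∷ j ∷ k ∷ l ∷ []) → ∀ x → weight x ≡ w →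
        lookup x i ≡ true → lookup x j ≡ false → lookup x k ≡ true → lookup x l ≡ false →
        diff odd i j (move k l x) ≡ diff odd i j x
      odd-second-difference i j k l uniq@((ij ∷ ik ∷ il ∷ []) ∷ (jk ∷ jl ∷ []) ∷ (kl ∷ []) ∷ [] ∷ []) x e pi pj pk pl =
        go (second-difference-constant eig i j k l uniq)
        where
        y = compl (move i j (move k l x))
        ey : weight y ≡ w
        ey = weight-compl-w (move i j (move k l x)) (trans (weight-move (move k l x) i j (trans (lookup-move x ik il) pi) (trans (lookup-move x jk jl) pj)) (trans (weight-move x k l pk pl) e))
        neg-bit : ∀ {b} (z : Vec Bool (4 + m)) a → lookup z a ≡ b → lookup (compl z) a ≡ not b
        neg-bit z a p = trans (Vec.lookup-map a not z) (cong not p)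
        y₁ : y ≡ move j i (compl (move k l x))
        y₁ = compl-move (move k l x) ij
        y₂ : y ≡ move l k (compl (move i j x))
        y₂ = trans (cong compl (move-comm x ik il jk jl)) (compl-move (move i j x) kl)
        ijy : move i j y ≡ compl (move k l x)
        ijy = trans (cong (move i j) y₁) (move-back (compl (move k l x)) (neg-bit (move k l x) j (trans (lookup-move x jk jl) pj)) (neg-bit (move k l x) i (trans (lookup-move x ik il) pi)))
        kly : move k l y ≡ compl (move i j x)
        kly = trans (cong (move k l) y₂) (move-back (compl (move i j x)) (neg-bit (move i j x) l (trans (lookup-move x (il ∘ sym) (jl ∘ sym)) pl)) (neg-bit (move i j x) k (trans (lookup-move x (ik ∘ sym) (jk ∘ sym)) pk)))
        ijkly : move i j (move k l y) ≡ compl x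
        ijkly = trans (cong (move i j) (trans kly (compl-move x ij))) (move-back (compl x) (neg-bit x j pj) (neg-bit x i pi))
        yi = trans (cong (λ z → lookup z i) y₁) (lookup-move-1 (compl (move k l x)) j i)
        yj = trans (cong (λ z → lookup z j) y₁) (lookup-move-0 (compl (move k l x)) (ij ∘ sym))
        yk = trans (cong (λ z → lookup z k) y₂) (lookup-move-1 (compl (move i j x)) l k)
        yl = trans (cong (λ z → lookup z l) y₂) (lookup-move-0 (compl (move i j x)) (kl ∘ sym))
        go : ConstantSecondDifference φ i j k l → diff odd i j (move k l x) ≡ diff odd i j x
        go (δ , isδ) = sym (ℤ.i-j≡0⇒i≡j _ _ (begin
          ((φ x -ᶻ φ (compl x)) -ᶻ (φ (move i j x) -ᶻ φ (compl (move i j x)))) -ᶻ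
          ((φ (move k l x) -ᶻ φ (compl (move k l x))) -ᶻ (φ (move i j (move k l x)) -ᶻ φ y))
            ≡⟨ cong₂ (λ a b → ((φ x -ᶻ a) -ᶻ (φ (move i j x) -ᶻ b)) -ᶻ
                 ((φ (move k l x) -ᶻ φ (compl (move k l x))) -ᶻ (φ (move i j (move k l x)) -ᶻ φ y))) (cong φ ijkly) (cong φ kly) ⟨
          ((φ x -ᶻ φ (move i j (move k l y))) -ᶻ (φ (move i j x) -ᶻ φ (move k l y))) -ᶻ
          ((φ (move k l x) -ᶻ φ (compl (move k l x))) -ᶻ (φ (move i j (move k l x)) -ᶻ φ y))
            ≡⟨ cong (λ a → ((φ x -ᶻ φ (move i j (move k l y))) -ᶻ (φ (move i j x) -ᶻ φ (move k l y))) -ᶻ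
                 ((φ (move k l x) -ᶻ φ a) -ᶻ (φ (move i j (move k l x)) -ᶻ φ y))) ijy ⟨
          ((φ x -ᶻ φ (move i j (move k l y))) -ᶻ (φ (move i j x) -ᶻ φ (move k l y))) -ᶻ
          ((φ (move k l x) -ᶻ φ (move i j y)) -ᶻ (φ (move i j (move k l x)) -ᶻ φ y))
            ≡⟨ lem (φ x) (φ (move i j x)) (φ (move k l x)) (φ (move i j (move k l x))) (φ y) (φ (move i j y)) (φ (move k l y)) (φ (move i j (move k l y))) ⟩
          (diff φ i j x -ᶻ diff φ i j (move k l x)) -ᶻ (diff φ i j y -ᶻ diff φ i j (move k l y))
            ≡⟨ cong₂ _-ᶻ_ (isδ x e pi pj pk pl) (isδ y ey yi yj yk yl) ⟩
          δ -ᶻ δ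
            ≡⟨ ℤ.+-inverseʳ δ ⟩
          0ℤ ∎))
          where
          open ≡-Reasoning
          lem : ∀ a b c d a′ b′ c′ d′ → ((a -ᶻ d′) -ᶻ (b -ᶻ c′)) -ᶻ ((c -ᶻ b′) -ᶻ (d -ᶻ a′)) ≡ ((a -ᶻ b) -ᶻ (c -ᶻ d)) -ᶻ ((a′ -ᶻ b′) -ᶻ (c′ -ᶻ d′))
          lem = solve-∀

      w≤2+m : w ≤ 2 + m
      w≤2+m = subst (_≤ 2 + m) 2+u≡w (s≤s (s≤s (ℕ.≤-trans (ℕ.m≤m+n u u) (ℕ.≤-reflexive (sym m≡2u)))))

      1≤w : 1 ≤ w
      1≤w = subst (1 ≤_) 2+u≡w (s≤s z≤n)

      odd-differences : ConstantDifferences w odd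
      odd-differences k l k≢l = go (pattern-exists (k ∷ l ∷ []) ((k≢l ∷ []) ∷ [] ∷ []) (true ∷ false ∷ []) w 1≤w (ℕ.m≤n⇒m≤1+n w≤2+m))
        where
        go : (∃ λ y → weight y ≡ w × (∀ a → lookup y (lookup (k ∷ l ∷ []) a) ≡ lookup (true ∷ false ∷ []) a)) →
             ∃ λ δ → ∀ x → weight x ≡ w → lookup x k ≡ true → lookup x l ≡ false → diff odd k l x ≡ δ
        go (y , ey , pat) = diff odd k l y , λ x e p q → proj₂ (proj₂ (proj₂ (follow
          (λ z → weight z ≡ w × lookup z k ≡ true × lookup z l ≡ false × diff odd k l z ≡ diff odd k l y)
          (λ { z i j zi zj xi xj (ez , zk , zl , h) →
            let k≢i = λ { refl → t≢f p xi }
                k≢j = λ { refl → t≢f zk zj }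
                l≢i = λ { refl → t≢f zi zl }
                l≢j = λ { refl → t≢f xj q }
            in trans (weight-move z i j zi zj) ez , trans (lookup-move z k≢i k≢j) zk , trans (lookup-move z l≢i l≢j) zl ,
               trans (odd-second-difference k l i j ((k≢l ∷ k≢i ∷ k≢j ∷ []) ∷ (l≢i ∷ l≢j ∷ []) ∷ (tf⇒≢ z zi zj ∷ []) ∷ [] ∷ []) z ez zk zl zi zj) h })
          (path y x (trans ey (sym e))) (ey , pat zero , pat (suc zero) , refl))))

    even : ∀ x → weight x ≡ w → φ x ≡ φ (compl x)
    even x e = go (linear-from-differences 1≤w w≤2+m odd-differences)
      where
      go : (∃₂ λ κ d → ∀ x → weight x ≡ w → odd x ≡ κ +ᶻ dot d x) → φ x ≡ φ (compl x)
      go (κ , d , lin) = ℤ.i-j≡0⇒i≡j _ _ (case ℤ.i*j≡0⇒i≡0∨j≡0 (pos 2 *ᶻ (pos w -ᶻ 1ℤ)) factor of λ { (inj₁ z) → contradiction z nonzero ; (inj₂ z) → z })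
        where
        open ≡-Reasoning
        nonzero : pos 2 *ᶻ (pos w -ᶻ 1ℤ) ≢ 0ℤ
        nonzero = subst (λ a → pos 2 *ᶻ (pos a -ᶻ 1ℤ) ≢ 0ℤ) 2+u≡w λ ()
        s = dot d x
        t = dot d (compl x)
        o = odd x
        odd-compl : κ +ᶻ t ≡ neg o
        odd-compl = begin
          κ +ᶻ t                            ≡⟨ lin (compl x) (weight-compl-w x e) ⟨
          φ (compl x) -ᶻ φ (compl (compl x)) ≡⟨ cong (λ y → φ (compl x) -ᶻ φ y) (compl-involutive x) ⟩
          φ (compl x) -ᶻ φ x                ≡⟨ ring (φ x) (φ (compl x)) ⟩
          neg (φ x -ᶻ φ (compl x))          ∎
          where
          ring : ∀ a b → b -ᶻ a ≡ neg (a -ᶻ b)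
          ring = solve-∀
        two-ways : (pos w *ᶻ pos w) *ᶻ (κ +ᶻ s) -ᶻ pos w *ᶻ s +ᶻ pos w *ᶻ t ≡ λ₂ w *ᶻ o +ᶻ 0ℤ
        two-ways = begin
          (pos w *ᶻ pos w) *ᶻ (κ +ᶻ s) -ᶻ pos w *ᶻ s +ᶻ pos w *ᶻ t
            ≡⟨ cong₂ (λ a b → (pos a *ᶻ pos b) *ᶻ (κ +ᶻ s) -ᶻ pos b *ᶻ s +ᶻ pos a *ᶻ t) e (weight-compl-w x e) ⟨
          (wt x *ᶻ wt̄ x) *ᶻ (κ +ᶻ s) -ᶻ wt̄ x *ᶻ s +ᶻ wt x *ᶻ t
            ≡⟨ adj-linear κ d x ⟨
          adj (λ y → κ +ᶻ dot d y) x
            ≡⟨ adj-cong w (λ y ey → lin y ey) x e ⟨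
          adj odd x
            ≡⟨ odd-eigen .at x e ⟩
          λ₂ w *ᶻ o +ᶻ 0ℤ ∎
        factor : (pos 2 *ᶻ (pos w -ᶻ 1ℤ)) *ᶻ o ≡ 0ℤ
        factor = odd-linear-eigen (pos w) κ s t o two-ways (lin x e) odd-compl

-- The derivative of a Boolean λ₂-eigenfunction along one pair is governed by two coordinates

total : (Fin n → ℕ) → ℕ
total {zero}  e = 0
total {suc n} e = e zero + total (e ∘ suc)

zero-support : (e : Fin n → ℕ) → total e ≤ 0 → ∀ k → e k ≡ 0
zero-support e h zero    = ℕ.n≤0⇒n≡0 (ℕ.≤-trans (ℕ.m≤m+n _ _) h)
zero-support e h (suc k) = zero-support (e ∘ suc) (ℕ.≤-trans (ℕ.m≤n+m _ (e zero)) h) k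

one-support : (e : Fin (1 + n) → ℕ) → total e ≤ 1 → ∃ λ p → ∀ k → k ≢ p → e k ≡ 0
one-support {zero}  e h = zero , λ { zero k≢ → contradiction refl k≢ }
one-support {suc n} e h with e zero in e₀
... | zero  = let p , z = one-support (e ∘ suc) h in
  suc p , λ { zero _ → e₀ ; (suc k) k≢ → z k (k≢ ∘ cong suc) }
... | suc a = zero , λ { zero k≢ → contradiction refl k≢
                       ; (suc k) _ → zero-support (e ∘ suc) (ℕ.≤-trans (ℕ.m≤n+m _ a) (ℕ.≤-pred h)) k }

two-support : (e : Fin (2 + n) → ℕ) → total e ≤ 2 → ∃₂ λ p q → p ≢ q × (∀ k → k ≢ p → k ≢ q → e k ≡ 0)
two-support {zero}  e h = zero , suc zero , (λ ()) ,
  λ { zero k≢ _ → contradiction refl k≢ ; (suc zero) _ k≢ → contradiction refl k≢ }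
two-support {suc n} e h with e zero in e₀
... | zero  = let p , q , p≢q , z = two-support (e ∘ suc) h in
  suc p , suc q , p≢q ∘ Fin.suc-injective , λ { zero _ _ → e₀ ; (suc k) k≢p k≢q → z k (k≢p ∘ cong suc) (k≢q ∘ cong suc) }
... | suc a = let q , z = one-support (e ∘ suc) (ℕ.≤-trans (ℕ.m≤n+m _ a) (ℕ.≤-pred h)) in
  zero , suc q , (λ ()) , λ { zero k≢ _ → contradiction refl k≢ ; (suc k) _ k≢q → z k (k≢q ∘ cong suc) }

Separates : Vec Bool n → (Fin n → ℤ) → ℤ → Set
Separates v d κ = ∀ k → (lookup v k ≡ true → κ ≤ᶻ d k) × (lookup v k ≡ false → d k ≤ᶻ κ)

-- The threshold is lowered by each new one and raised by each new zero; `h` keeps it on the correct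
-- side of the bits already treated. On the empty vector any value serves.
separator : ∀ (v : Vec Bool n) (d : Fin n → ℤ) → (∀ k l → lookup v k ≡ true → lookup v l ≡ false → d l ≤ᶻ d k) → ∃ (Separates v d)
separator []      d h = 0ℤ , λ ()
separator (b ∷ v) d h with separator v (d ∘ suc) (λ k l → h (suc k) (suc l))
separator (true ∷ v)  d h | κ , sep = κ ⊓ d zero , λ
  { zero    → (λ _ → ℤ.i⊓j≤j κ (d zero)) , λ ()
  ; (suc k) → (λ p → ℤ.≤-trans (ℤ.i⊓j≤i κ (d zero)) (proj₁ (sep k) p)) , λ p → ℤ.⊓-glb (proj₂ (sep k) p) (h zero (suc k) refl p) }
separator (false ∷ v) d h | κ , sep = κ ⊔ d zero , λ
  { zero    → (λ ()) , λ _ → ℤ.i≤j⊔i κ (d zero)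
  ; (suc k) → (λ p → ℤ.⊔-lub (proj₁ (sep k) p) (h (suc k) zero p refl)) , λ p → ℤ.≤-trans (proj₂ (sep k) p) (ℤ.i≤i⊔j κ (d zero)) }

-- Separation fixes the sign inside each absolute value: plus on the ones of v, minus on its zeros.
-- The sum becomes a difference of two linear forms.
total-distance : ∀ (v : Vec Bool n) d κ → Separates v d κ →
  pos (total λ k → ∣ d k -ᶻ κ ∣) ≡ (dot d v -ᶻ κ *ᶻ wt v) -ᶻ (dot d (compl v) -ᶻ κ *ᶻ wt̄ v)
total-distance []      d κ sep = lem κ
  where
  lem : ∀ κ → 0ℤ ≡ (0ℤ -ᶻ κ *ᶻ 0ℤ) -ᶻ (0ℤ -ᶻ κ *ᶻ 0ℤ)
  lem = solve-∀
total-distance (true ∷ v) d κ sep =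
  trans (cong₂ _+ᶻ_ (ℤ.0≤i⇒+∣i∣≡i (ℤ.i≤j⇒0≤j-i (proj₁ (sep zero) refl))) (total-distance v (d ∘ suc) κ (sep ∘ suc)))
    (lem (d zero) κ (dot (d ∘ suc) v) (dot (d ∘ suc) (compl v)) (wt v) (wt̄ v))
  where
  lem : ∀ a κ s t w z → (a -ᶻ κ) +ᶻ ((s -ᶻ κ *ᶻ w) -ᶻ (t -ᶻ κ *ᶻ z)) ≡
    ((a *ᶻ 1ℤ +ᶻ s) -ᶻ κ *ᶻ (1ℤ +ᶻ w)) -ᶻ ((a *ᶻ 0ℤ +ᶻ t) -ᶻ κ *ᶻ z)
  lem = solve-∀
total-distance (false ∷ v) d κ sep =
  trans (cong₂ _+ᶻ_ (trans (cong pos (ℤ.∣i-j∣≡∣j-i∣ (d zero) κ)) (ℤ.0≤i⇒+∣i∣≡i (ℤ.i≤j⇒0≤j-i (proj₂ (sep zero) refl)))) (total-distance v (d ∘ suc) κ (sep ∘ suc)))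
    (lem (d zero) κ (dot (d ∘ suc) v) (dot (d ∘ suc) (compl v)) (wt v) (wt̄ v))
  where
  lem : ∀ a κ s t w z → (κ -ᶻ a) +ᶻ ((s -ᶻ κ *ᶻ w) -ᶻ (t -ᶻ κ *ᶻ z)) ≡
    ((a *ᶻ 0ℤ +ᶻ s) -ᶻ κ *ᶻ w) -ᶻ ((a *ᶻ 1ℤ +ᶻ t) -ᶻ κ *ᶻ (1ℤ +ᶻ z))
  lem = solve-∀

-- Subtracting κ from every slope costs κ times the weight; afterwards the coordinates of slope κ
-- contribute nothing.
dot-agree : ∀ (v v′ : Vec Bool n) d κ → (∀ k → lookup v k ≡ lookup v′ k ⊎ d k ≡ κ) → dot d v -ᶻ κ *ᶻ wt v ≡ dot d v′ -ᶻ κ *ᶻ wt v′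
dot-agree []      []        d κ h = refl
dot-agree (b ∷ v) (b′ ∷ v′) d κ h =
  trans (lem b v) (trans (cong₂ _+ᶻ_ (eq (h zero)) (dot-agree v v′ (d ∘ suc) κ (h ∘ suc))) (sym (lem b′ v′)))
  where
  r₁ : ∀ a κ s w → (a *ᶻ 1ℤ +ᶻ s) -ᶻ κ *ᶻ (1ℤ +ᶻ w) ≡ (a -ᶻ κ) *ᶻ 1ℤ +ᶻ (s -ᶻ κ *ᶻ w)
  r₁ = solve-∀
  r₀ : ∀ a κ s w → (a *ᶻ 0ℤ +ᶻ s) -ᶻ κ *ᶻ w ≡ (a -ᶻ κ) *ᶻ 0ℤ +ᶻ (s -ᶻ κ *ᶻ w)
  r₀ = solve-∀
  lem : ∀ b v → dot d (b ∷ v) -ᶻ κ *ᶻ wt (b ∷ v) ≡ (d zero -ᶻ κ) *ᶻ β b +ᶻ (dot (d ∘ suc) v -ᶻ κ *ᶻ wt v)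
  lem true  v = r₁ (d zero) κ _ (wt v)
  lem false v = r₀ (d zero) κ _ (wt v)
  eq : b ≡ b′ ⊎ d zero ≡ κ → (d zero -ᶻ κ) *ᶻ β b ≡ (d zero -ᶻ κ) *ᶻ β b′
  eq (inj₁ refl) = refl
  eq (inj₂ refl) = trans (cong (_*ᶻ β b) (ℤ.+-inverseʳ κ)) (sym (cong (_*ᶻ β b′) (ℤ.+-inverseʳ κ)))

β-injective : ∀ {a b} → β a ≡ β b → a ≡ b
β-injective {true}  {true}  _ = refl
β-injective {false} {false} _ = refl

β-diff≤1 : ∀ a b → β a -ᶻ β b ≤ᶻ 1ℤ
β-diff≤1 true  true  = +≤+ z≤n
β-diff≤1 true  false = ℤ.≤-refl
β-diff≤1 false true  = -≤+
β-diff≤1 false false = +≤+ z≤n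

β-diff≡1 : ∀ a b → β a -ᶻ β b ≡ 1ℤ → a ≡ true × b ≡ false
β-diff≡1 true  false _ = refl , refl
β-diff≡1 true  true  ()
β-diff≡1 false true  ()
β-diff≡1 false false ()

module Boolean {r k w : ℕ} (5+r≡w : 5 + r ≡ w) (n≡2w : 10 + k ≡ w + w) {c : ℤ} where

  open Quadratic {6 + k} {3 + r} 5+r≡w n≡2w {c} public

  r≤k : r ≤ k
  r≤k = subst (r ≤_) (sym k≡2r) (ℕ.m≤m+n r r)
    where
    k≡2r : k ≡ r + r
    k≡2r = ℕ.+-cancelˡ-≡ 6 k (r + r) (trans m≡2u (cong (3 +_) (ℕ.+-comm r (3 + r))))

  BooleanEigen : (Vec Bool (10 + k) → Bool) → Set
  BooleanEigen F = Eigen w (λ₂ w) c (β ∘ F)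

  even-bool : ∀ {F} → BooleanEigen F → ∀ x → weight x ≡ w → F x ≡ F (compl x)
  even-bool eig x e = β-injective (even eig x e)

  module _ {F : Vec Bool (10 + k) → Bool} (eig : BooleanEigen F) where

    pair-derivative-linear : ∃₂ λ κ d → ∀ v → weight v ≡ 4 + r → deriv (β ∘ F) v ≡ κ +ᶻ dot d v
    pair-derivative-linear = linear-from-differences (s≤s z≤n) (s≤s (ℕ.+-mono-≤ {3} {5} (s≤s (s≤s (s≤s z≤n))) r≤k)) λ a b a≢b →
      let δ , isδ = second-difference-constant eig zero (suc zero) (suc (suc a)) (suc (suc b))
            (((λ ()) ∷ (λ ()) ∷ (λ ()) ∷ []) ∷ ((λ ()) ∷ (λ ()) ∷ []) ∷ ((a≢b ∘ Fin.suc-injective ∘ Fin.suc-injective) ∷ []) ∷ [] ∷ [])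
      in δ , λ v e p q → isδ (true ∷ false ∷ v) (trans (cong suc e) 5+r≡w) refl refl p q

    TwoCoordinates : Vec Bool (8 + k) → Set
    TwoCoordinates v₀ = ∃₂ λ p q → p ≢ q × (∀ v → weight v ≡ 4 + r → lookup v p ≡ lookup v₀ p → lookup v q ≡ lookup v₀ q →
      F (true ∷ false ∷ v) ≡ true × F (false ∷ true ∷ v) ≡ false)

    -- At v₀ the derivative g takes its largest possible value 1, and by evenness of F it is -1 at
    -- the complement. With κ separating the slopes on ones from those on zeros, Σ|d - κ| = g(v₀) -
    -- g(compl v₀) = 2, because both vertices have equal weight. Hence all integer slopes but two
    -- equal κ, and g stays 1 as long as those two bits are kept.
    two-coordinates : ∀ v₀ → weight v₀ ≡ 4 + r → F (true ∷ false ∷ v₀) ≡ true → F (false ∷ true ∷ v₀) ≡ false → TwoCoordinates v₀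
    two-coordinates v₀ e₀ ft ff = go pair-derivative-linear
      where
      g = deriv (β ∘ F)
      g₀≡1 : g v₀ ≡ 1ℤ
      g₀≡1 = cong₂ (λ a b → β a -ᶻ β b) ft ff
      ē₀ : weight (compl v₀) ≡ 4 + r
      ē₀ = ℕ.suc-injective (trans (weight-compl-w (true ∷ false ∷ v₀) (trans (cong suc e₀) 5+r≡w)) (sym 5+r≡w))
      ḡ₀≡-1 : g (compl v₀) ≡ -1ℤ
      ḡ₀≡-1 = cong₂ (λ a b → β a -ᶻ β b)
        (trans (sym (even-bool eig (false ∷ true ∷ v₀) (trans (cong suc e₀) 5+r≡w))) ff)
        (trans (sym (even-bool eig (true ∷ false ∷ v₀) (trans (cong suc e₀) 5+r≡w))) ft)
      go : (∃₂ λ κ d → ∀ v → weight v ≡ 4 + r → g v ≡ κ +ᶻ dot d v) → TwoCoordinates v₀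
      go (κ₀ , d , lin) = go₂ (separator v₀ d sep)
        where
        -- No value of g exceeds 1 = g(v₀), so a move from v₀ cannot raise g; its decrease is d a -
        -- d b.
        sep : ∀ a b → lookup v₀ a ≡ true → lookup v₀ b ≡ false → d b ≤ᶻ d a
        sep a b p q = ℤ.0≤i-j⇒j≤i (subst (0ℤ ≤ᶻ_) (eq) (ℤ.i≤j⇒0≤j-i (β-diff≤1 (F (true ∷ false ∷ move a b v₀)) (F (false ∷ true ∷ move a b v₀)))))
          where
          ring : ∀ κ s x y → (κ +ᶻ s) -ᶻ (κ +ᶻ ((s -ᶻ x) +ᶻ y)) ≡ x -ᶻ y
          ring = solve-∀
          eq : 1ℤ -ᶻ g (move a b v₀) ≡ d a -ᶻ d b
          eq = trans (cong₂ _-ᶻ_ (trans (sym g₀≡1) (lin v₀ e₀))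
                 (trans (lin (move a b v₀) (trans (weight-move v₀ a b p q) e₀)) (cong (κ₀ +ᶻ_) (dot-move d v₀ a b p q))))
                 (ring κ₀ (dot d v₀) (d a) (d b))
        go₂ : ∃ (Separates v₀ d) → TwoCoordinates v₀
        go₂ (κ , isSep) =
          let p , q , p≢q , vanish = two-support (λ a → ∣ d a -ᶻ κ ∣) (ℕ.≤-reflexive (ℤ.+-injective total≡2))
          in p , q , p≢q , λ v e vp vq → β-diff≡1 (F (true ∷ false ∷ v)) (F (false ∷ true ∷ v)) (trans (lin v e) (trans (cong (κ₀ +ᶻ_) (same-dot v e (support v vp vq vanish)))
               (trans (sym (lin v₀ e₀)) g₀≡1)))
          where
          support : ∀ {p q} v → lookup v p ≡ lookup v₀ p → lookup v q ≡ lookup v₀ q → (∀ a → a ≢ p → a ≢ q → ∣ d a -ᶻ κ ∣ ≡ 0) →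
            ∀ a → lookup v a ≡ lookup v₀ a ⊎ d a ≡ κ
          support {p} {q} v vp vq vanish a with a Fin.≟ p | a Fin.≟ q
          ... | yes refl | _        = inj₁ vp
          ... | no _     | yes refl = inj₁ vq
          ... | no a≢p   | no a≢q   = inj₂ (ℤ.i-j≡0⇒i≡j (d a) κ (ℤ.∣i∣≡0⇒i≡0 (vanish a a≢p a≢q)))
          sum≡2 : ∀ s t W → κ₀ +ᶻ s ≡ 1ℤ → κ₀ +ᶻ t ≡ -1ℤ → (s -ᶻ κ *ᶻ W) -ᶻ (t -ᶻ κ *ᶻ W) ≡ pos 2
          sum≡2 s t W h₁ h₂ = trans (ring κ₀ κ s t W) (cong₂ _-ᶻ_ h₁ h₂)
            where
            ring : ∀ κ₀ κ s t W → (s -ᶻ κ *ᶻ W) -ᶻ (t -ᶻ κ *ᶻ W) ≡ (κ₀ +ᶻ s) -ᶻ (κ₀ +ᶻ t)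
            ring = solve-∀
          total≡2 : pos (total λ a → ∣ d a -ᶻ κ ∣) ≡ pos 2
          total≡2 = trans (total-distance v₀ d κ isSep)
            (trans (cong (λ y → (dot d v₀ -ᶻ κ *ᶻ wt v₀) -ᶻ (dot d (compl v₀) -ᶻ κ *ᶻ pos y)) (trans ē₀ (sym e₀)))
              (sum≡2 (dot d v₀) (dot d (compl v₀)) (wt v₀) (trans (sym (lin v₀ e₀)) g₀≡1) (trans (sym (lin (compl v₀) ē₀)) ḡ₀≡-1)))
          same-dot : ∀ v → weight v ≡ 4 + r → (∀ a → lookup v a ≡ lookup v₀ a ⊎ d a ≡ κ) → dot d v ≡ dot d v₀
          same-dot v e h = +ᶻ-cancelʳ (neg (κ *ᶻ wt v)) (dot d v) (dot d v₀)
            (trans (dot-agree v v₀ d κ h) (cong (λ y → dot d v₀ -ᶻ κ *ᶻ pos y) (trans e₀ (sym e))))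

-- Eliminating all but five coordinates

data Sign : ℤ → Set where
  zer : Sign 0ℤ
  one : Sign 1ℤ
  min : Sign -1ℤ

β-diff-sign : ∀ a b → Sign (β a -ᶻ β b)
β-diff-sign true  true  = zer
β-diff-sign true  false = one
β-diff-sign false true  = min
β-diff-sign false false = zer

-- The ℓ¹ unit ball of ℤ². `Sign` conditions on A and B alone allow a 3 by 3 square; those on A + B
-- and A - B cut off its four corners.
data Ball : ℤ → ℤ → Set where
  origin : Ball 0ℤ 0ℤ
  east   : Ball 1ℤ 0ℤ
  west   : Ball -1ℤ 0ℤ
  north  : Ball 0ℤ 1ℤ
  south  : Ball 0ℤ -1ℤ

ball : ∀ {A B} → Sign A → Sign B → Sign (A +ᶻ B) → Sign (A -ᶻ B) → Ball A B
ball zer zer _ _ = origin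
ball zer one _ _ = north
ball zer min _ _ = south
ball one zer _ _ = east
ball min zer _ _ = west
ball one one () _
ball one min _ ()
ball min one _ ()
ball min min () _

data NonZero : ℤ → ℤ → Set where
  east  : NonZero 1ℤ 0ℤ
  west  : NonZero -1ℤ 0ℤ
  north : NonZero 0ℤ 1ℤ
  south : NonZero 0ℤ -1ℤ

ball-split : ∀ {A B} → Ball A B → (A ≡ 0ℤ × B ≡ 0ℤ) ⊎ NonZero A B
ball-split origin = inj₁ (refl , refl)
ball-split east   = inj₂ east
ball-split west   = inj₂ west
ball-split north  = inj₂ north
ball-split south  = inj₂ south

-- Two unit steps in the grid never add up to a unit step: the parity of A + B forbids it.
ball-sum : ∀ {A B A′ B′} → Ball A B → Ball A′ B′ → NonZero (A +ᶻ A′) (B +ᶻ B′) → (A ≡ 0ℤ × B ≡ 0ℤ) ⊎ (A′ ≡ 0ℤ × B′ ≡ 0ℤ)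
ball-sum origin b      _  = inj₁ (refl , refl)
ball-sum b      origin _  = inj₂ (refl , refl)
ball-sum east   east   ()
ball-sum east   west   ()
ball-sum east   north  ()
ball-sum east   south  ()
ball-sum west   east   ()
ball-sum west   west   ()
ball-sum west   north  ()
ball-sum west   south  ()
ball-sum north  east   ()
ball-sum north  west   ()
ball-sum north  north  ()
ball-sum north  south  ()
ball-sum south  east   ()
ball-sum south  west   ()
ball-sum south  north  ()
ball-sum south  south  ()

-- Affine forms in four bits with three prescribed zeros

dot-const : ∀ (d : Fin n → ℤ) κ → (∀ a → d a ≡ κ) → ∀ u → dot d u ≡ κ *ᶻ wt u
dot-const d κ h []          = sym (ℤ.*-zeroʳ κ)
dot-const d κ h (b ∷ u) = trans (cong₂ (λ a s → a *ᶻ β b +ᶻ s) (h zero) (dot-const (d ∘ suc) κ (h ∘ suc) u)) (eq b)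
  where
  eq : ∀ b → κ *ᶻ β b +ᶻ κ *ᶻ wt u ≡ κ *ᶻ wt (b ∷ u)
  eq true  = sym (ℤ.*-distribˡ-+ κ 1ℤ (wt u))
  eq false = trans (cong (_+ᶻ κ *ᶻ wt u) (ℤ.*-zeroʳ κ)) (ℤ.+-identityˡ _)

wt-cons : ∀ b (u : Vec Bool n) → wt (b ∷ u) ≡ β b +ᶻ wt u
wt-cons true  u = refl
wt-cons false u = refl

-- `U` and `V η` span the affine forms in four bits that vanish at (1,0,0,η), (0,1,0,η) and
-- (1,0,1,not η). Both take only the values -1, 0, 1.
U : Vec Bool 4 → ℤ
U (a ∷ b ∷ _) = β a +ᶻ β b -ᶻ 1ℤ

V : Bool → Vec Bool 4 → ℤ
V true  (_ ∷ _ ∷ c ∷ d ∷ []) = β c +ᶻ β d -ᶻ 1ℤ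
V false (_ ∷ _ ∷ c ∷ d ∷ []) = β c -ᶻ β d

affine-form : ∀ κ₀ κ d₀ d₁ d₂ d₃ b₀ b₁ b₂ b₃ W T → b₀ +ᶻ (b₁ +ᶻ (b₂ +ᶻ (b₃ +ᶻ W))) ≡ T →
  κ₀ +ᶻ (d₀ *ᶻ b₀ +ᶻ (d₁ *ᶻ b₁ +ᶻ (d₂ *ᶻ b₂ +ᶻ (d₃ *ᶻ b₃ +ᶻ κ *ᶻ W)))) ≡
  (κ₀ +ᶻ κ *ᶻ T) +ᶻ (d₀ -ᶻ κ) *ᶻ b₀ +ᶻ (d₁ -ᶻ κ) *ᶻ b₁ +ᶻ (d₂ -ᶻ κ) *ᶻ b₂ +ᶻ (d₃ -ᶻ κ) *ᶻ b₃
affine-form κ₀ κ d₀ d₁ d₂ d₃ b₀ b₁ b₂ b₃ W _ refl = ring κ₀ κ d₀ d₁ d₂ d₃ b₀ b₁ b₂ b₃ W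
  where
  ring : ∀ κ₀ κ d₀ d₁ d₂ d₃ b₀ b₁ b₂ b₃ W →
    κ₀ +ᶻ (d₀ *ᶻ b₀ +ᶻ (d₁ *ᶻ b₁ +ᶻ (d₂ *ᶻ b₂ +ᶻ (d₃ *ᶻ b₃ +ᶻ κ *ᶻ W)))) ≡
    (κ₀ +ᶻ κ *ᶻ (b₀ +ᶻ (b₁ +ᶻ (b₂ +ᶻ (b₃ +ᶻ W))))) +ᶻ (d₀ -ᶻ κ) *ᶻ b₀ +ᶻ (d₁ -ᶻ κ) *ᶻ b₁ +ᶻ (d₂ -ᶻ κ) *ᶻ b₂ +ᶻ (d₃ -ᶻ κ) *ᶻ b₃
  ring = solve-∀

affine : ℤ → (α₀ α₁ α₂ α₃ : ℤ) → Vec Bool 4 → ℤ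
affine K α₀ α₁ α₂ α₃ (b₀ ∷ b₁ ∷ b₂ ∷ b₃ ∷ []) = K +ᶻ α₀ *ᶻ β b₀ +ᶻ α₁ *ᶻ β b₁ +ᶻ α₂ *ᶻ β b₂ +ᶻ α₃ *ᶻ β b₃

-- Five coefficients satisfy three conditions, leaving α₀ and α₂ free. After α₀ `U` + α₂ `V η` is
-- split off, the remainder is a combination of the values at the three zeros.
affine-zeros : ∀ η K α₀ α₁ α₂ α₃ →
  affine K α₀ α₁ α₂ α₃ (true ∷ false ∷ false ∷ η ∷ []) ≡ 0ℤ →
  affine K α₀ α₁ α₂ α₃ (false ∷ true ∷ false ∷ η ∷ []) ≡ 0ℤ →
  affine K α₀ α₁ α₂ α₃ (true ∷ false ∷ true ∷ not η ∷ []) ≡ 0ℤ →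
  ∀ s → affine K α₀ α₁ α₂ α₃ s ≡ α₀ *ᶻ U s +ᶻ α₂ *ᶻ V η s
affine-zeros true K α₀ α₁ α₂ α₃ h₁ h₂ h₃ s@(b₀ ∷ b₁ ∷ b₂ ∷ b₃ ∷ []) =
  trans (ring K α₀ α₁ α₂ α₃ (β b₀) (β b₁) (β b₂) (β b₃))
    (trans (cong₂ (λ x y → R +ᶻ (z₃ +ᶻ (y -ᶻ x) *ᶻ β b₁ +ᶻ (x -ᶻ z₃) *ᶻ β b₃)) h₁ h₂)
      (trans (cong (λ z → R +ᶻ (z +ᶻ (0ℤ -ᶻ 0ℤ) *ᶻ β b₁ +ᶻ (0ℤ -ᶻ z) *ᶻ β b₃)) h₃) (ring₀ R (β b₁) (β b₃))))
  where
  R z₃ : ℤ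
  R = α₀ *ᶻ U s +ᶻ α₂ *ᶻ V true s
  z₃ = affine K α₀ α₁ α₂ α₃ (true ∷ false ∷ true ∷ false ∷ [])
  ring : ∀ K α₀ α₁ α₂ α₃ b₀ b₁ b₂ b₃ → K +ᶻ α₀ *ᶻ b₀ +ᶻ α₁ *ᶻ b₁ +ᶻ α₂ *ᶻ b₂ +ᶻ α₃ *ᶻ b₃ ≡
    (α₀ *ᶻ (b₀ +ᶻ b₁ -ᶻ 1ℤ) +ᶻ α₂ *ᶻ (b₂ +ᶻ b₃ -ᶻ 1ℤ)) +ᶻ
    ((K +ᶻ α₀ *ᶻ 1ℤ +ᶻ α₁ *ᶻ 0ℤ +ᶻ α₂ *ᶻ 1ℤ +ᶻ α₃ *ᶻ 0ℤ) +ᶻ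
     ((K +ᶻ α₀ *ᶻ 0ℤ +ᶻ α₁ *ᶻ 1ℤ +ᶻ α₂ *ᶻ 0ℤ +ᶻ α₃ *ᶻ 1ℤ) -ᶻ (K +ᶻ α₀ *ᶻ 1ℤ +ᶻ α₁ *ᶻ 0ℤ +ᶻ α₂ *ᶻ 0ℤ +ᶻ α₃ *ᶻ 1ℤ)) *ᶻ b₁ +ᶻ
     ((K +ᶻ α₀ *ᶻ 1ℤ +ᶻ α₁ *ᶻ 0ℤ +ᶻ α₂ *ᶻ 0ℤ +ᶻ α₃ *ᶻ 1ℤ) -ᶻ (K +ᶻ α₀ *ᶻ 1ℤ +ᶻ α₁ *ᶻ 0ℤ +ᶻ α₂ *ᶻ 1ℤ +ᶻ α₃ *ᶻ 0ℤ)) *ᶻ b₃)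
  ring = solve-∀
  ring₀ : ∀ R b₁ b₃ → R +ᶻ (0ℤ +ᶻ (0ℤ -ᶻ 0ℤ) *ᶻ b₁ +ᶻ (0ℤ -ᶻ 0ℤ) *ᶻ b₃) ≡ R
  ring₀ = solve-∀
affine-zeros false K α₀ α₁ α₂ α₃ h₁ h₂ h₃ s@(b₀ ∷ b₁ ∷ b₂ ∷ b₃ ∷ []) =
  trans (ring K α₀ α₁ α₂ α₃ (β b₀) (β b₁) (β b₂) (β b₃))
    (trans (cong₂ (λ x y → R +ᶻ (x +ᶻ (y -ᶻ x) *ᶻ β b₁ +ᶻ (z₃ -ᶻ x) *ᶻ β b₃)) h₁ h₂)
      (trans (cong (λ z → R +ᶻ (0ℤ +ᶻ (0ℤ -ᶻ 0ℤ) *ᶻ β b₁ +ᶻ (z -ᶻ 0ℤ) *ᶻ β b₃)) h₃) (ring₀ R (β b₁) (β b₃))))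
  where
  R z₃ : ℤ
  R = α₀ *ᶻ U s +ᶻ α₂ *ᶻ V false s
  z₃ = affine K α₀ α₁ α₂ α₃ (true ∷ false ∷ true ∷ true ∷ [])
  ring : ∀ K α₀ α₁ α₂ α₃ b₀ b₁ b₂ b₃ → K +ᶻ α₀ *ᶻ b₀ +ᶻ α₁ *ᶻ b₁ +ᶻ α₂ *ᶻ b₂ +ᶻ α₃ *ᶻ b₃ ≡
    (α₀ *ᶻ (b₀ +ᶻ b₁ -ᶻ 1ℤ) +ᶻ α₂ *ᶻ (b₂ -ᶻ b₃)) +ᶻ
    ((K +ᶻ α₀ *ᶻ 1ℤ +ᶻ α₁ *ᶻ 0ℤ +ᶻ α₂ *ᶻ 0ℤ +ᶻ α₃ *ᶻ 0ℤ) +ᶻ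
     ((K +ᶻ α₀ *ᶻ 0ℤ +ᶻ α₁ *ᶻ 1ℤ +ᶻ α₂ *ᶻ 0ℤ +ᶻ α₃ *ᶻ 0ℤ) -ᶻ (K +ᶻ α₀ *ᶻ 1ℤ +ᶻ α₁ *ᶻ 0ℤ +ᶻ α₂ *ᶻ 0ℤ +ᶻ α₃ *ᶻ 0ℤ)) *ᶻ b₁ +ᶻ
     ((K +ᶻ α₀ *ᶻ 1ℤ +ᶻ α₁ *ᶻ 0ℤ +ᶻ α₂ *ᶻ 1ℤ +ᶻ α₃ *ᶻ 1ℤ) -ᶻ (K +ᶻ α₀ *ᶻ 1ℤ +ᶻ α₁ *ᶻ 0ℤ +ᶻ α₂ *ᶻ 0ℤ +ᶻ α₃ *ᶻ 0ℤ)) *ᶻ b₃)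
  ring = solve-∀
  ring₀ : ∀ R b₁ b₃ → R +ᶻ (0ℤ +ᶻ (0ℤ -ᶻ 0ℤ) *ᶻ b₁ +ᶻ (0ℤ -ᶻ 0ℤ) *ᶻ b₃) ≡ R
  ring₀ = solve-∀

at-A : ∀ η A B → A *ᶻ U (true ∷ true ∷ false ∷ η ∷ []) +ᶻ B *ᶻ V η (true ∷ true ∷ false ∷ η ∷ []) ≡ A
at-A true  = ring
  where
  ring : ∀ A B → A *ᶻ 1ℤ +ᶻ B *ᶻ 0ℤ ≡ A
  ring = solve-∀
at-A false = ring
  where
  ring : ∀ A B → A *ᶻ 1ℤ +ᶻ B *ᶻ 0ℤ ≡ A
  ring = solve-∀

at-B : ∀ η A B → A *ᶻ U (true ∷ false ∷ true ∷ η ∷ []) +ᶻ B *ᶻ V η (true ∷ false ∷ true ∷ η ∷ []) ≡ B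
at-B true  = ring
  where
  ring : ∀ A B → A *ᶻ 0ℤ +ᶻ B *ᶻ 1ℤ ≡ B
  ring = solve-∀
at-B false = ring
  where
  ring : ∀ A B → A *ᶻ 0ℤ +ᶻ B *ᶻ 1ℤ ≡ B
  ring = solve-∀

at-A+B : ∀ η A B → A *ᶻ U (true ∷ true ∷ true ∷ η ∷ []) +ᶻ B *ᶻ V η (true ∷ true ∷ true ∷ η ∷ []) ≡ A +ᶻ B
at-A+B true  = ring
  where
  ring : ∀ A B → A *ᶻ 1ℤ +ᶻ B *ᶻ 1ℤ ≡ A +ᶻ B
  ring = solve-∀
at-A+B false = ring
  where
  ring : ∀ A B → A *ᶻ 1ℤ +ᶻ B *ᶻ 1ℤ ≡ A +ᶻ B
  ring = solve-∀

at-A-B : ∀ η A B → A *ᶻ U (true ∷ true ∷ false ∷ not η ∷ []) +ᶻ B *ᶻ V η (true ∷ true ∷ false ∷ not η ∷ []) ≡ A -ᶻ B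
at-A-B true  = ring
  where
  ring : ∀ A B → A *ᶻ 1ℤ +ᶻ B *ᶻ -1ℤ ≡ A -ᶻ B
  ring = solve-∀
at-A-B false = ring
  where
  ring : ∀ A B → A *ᶻ 1ℤ +ᶻ B *ᶻ -1ℤ ≡ A -ᶻ B
  ring = solve-∀

weight≤ : (s : Vec Bool n) → weight s ≤ n
weight≤ s = subst (weight s ≤_) (weight-compl s) (ℕ.m≤m+n _ _)

extend : ∀ (s : Vec Bool m) n W → weight s ≤ W → W ≤ weight s + n → ∃ λ (u : Vec Bool n) → weight (s ++ u) ≡ W
extend s n W lo hi =
  let u , e = fill n (W ∸ weight s) (ℕ.≤-trans (ℕ.∸-monoˡ-≤ (weight s) hi) (ℕ.≤-reflexive (ℕ.m+n∸m≡n (weight s) n)))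
  in u , trans (weight-++ s u) (trans (cong (weight s +_) e) (ℕ.m+[n∸m]≡n lo))

module Affine {r k w : ℕ} (5+r≡w : 5 + r ≡ w) (n≡2w : 10 + k ≡ w + w) {c : ℤ} where

  open Boolean 5+r≡w n≡2w {c}

  4+r≤4+k : 4 + r ≤ 4 + k
  4+r≤4+k = ℕ.+-monoʳ-≤ 4 r≤k

  weight-s≤ : (s : Vec Bool 4) → weight s ≤ 4 + r
  weight-s≤ s = ℕ.≤-trans (weight≤ s) (ℕ.m≤m+n 4 r)

  module _ {F : Vec Bool (10 + k) → Bool} (eig : BooleanEigen F) where

    NullOn : Vec Bool 4 → Set
    NullOn s = ∀ u → weight (s ++ u) ≡ 4 + r → deriv (β ∘ F) (s ++ u) ≡ 0ℤ

    PairForm : Bool → ℤ → ℤ → Set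
    PairForm η A B = ∀ s u → weight (s ++ u) ≡ 4 + r → deriv (β ∘ F) (s ++ u) ≡ A *ᶻ U s +ᶻ B *ᶻ V η s

    -- A move between two of the remaining coordinates stays inside the null pattern. The derivative
    -- is zero before and after it, so the two slopes coincide.
    slopes-equal : ∀ η → NullOn (true ∷ false ∷ false ∷ η ∷ []) → ∀ κ d → (∀ v → weight v ≡ 4 + r → deriv (β ∘ F) v ≡ κ +ᶻ dot d v) →
      ∀ a b → d (suc (suc (suc (suc a)))) ≡ d (suc (suc (suc (suc b))))
    slopes-equal η null κ d lin a b with a Fin.≟ b
    ... | yes refl = refl
    ... | no a≢b   = go η null (pattern-exists (a ∷ b ∷ []) ((a≢b ∷ []) ∷ [] ∷ []) (true ∷ false ∷ []) (W η) (lo η) (hi η))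
      where
      -- What is left of the weight 4 + r after the pattern (1,0,0,η).
      W : Bool → ℕ
      W true  = 2 + r
      W false = 3 + r
      lo : ∀ η → 1 ≤ W η
      lo true  = s≤s z≤n
      lo false = s≤s z≤n
      hi : ∀ η → W η ≤ 3 + k
      hi true  = ℕ.m≤n⇒m≤1+n (s≤s (s≤s r≤k))
      hi false = s≤s (s≤s (s≤s r≤k))
      wη : ∀ η (u : Vec Bool (4 + k)) → weight u ≡ W η → weight (true ∷ false ∷ false ∷ η ∷ u) ≡ 4 + r
      wη true  u e = cong (2 +_) e
      wη false u e = cong (1 +_) e
      a′ b′ : Fin (8 + k)
      a′ = suc (suc (suc (suc a)))
      b′ = suc (suc (suc (suc b)))
      ring : ∀ κ s x y → κ +ᶻ ((s -ᶻ x) +ᶻ y) ≡ (κ +ᶻ s) +ᶻ (y -ᶻ x)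
      ring = solve-∀
      go : ∀ η → NullOn (true ∷ false ∷ false ∷ η ∷ []) →
        (∃ λ y → weight y ≡ W η × (∀ i → lookup y (lookup (a ∷ b ∷ []) i) ≡ lookup (true ∷ false ∷ []) i)) → d a′ ≡ d b′
      go η null (y , ey , pat) = sym (ℤ.i-j≡0⇒i≡j (d b′) (d a′) (begin
        d b′ -ᶻ d a′                                  ≡⟨ ℤ.+-identityˡ _ ⟨
        0ℤ +ᶻ (d b′ -ᶻ d a′)                          ≡⟨ cong (_+ᶻ (d b′ -ᶻ d a′)) (trans (sym (lin v wv)) (null y wv)) ⟨
        (κ +ᶻ dot d v) +ᶻ (d b′ -ᶻ d a′)              ≡⟨ ring κ (dot d v) (d a′) (d b′) ⟨
        κ +ᶻ ((dot d v -ᶻ d a′) +ᶻ d b′)              ≡⟨ cong (κ +ᶻ_) (dot-move d v a′ b′ (pat zero) (pat (suc zero))) ⟨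
        κ +ᶻ dot d (move a′ b′ v)                     ≡⟨ lin (move a′ b′ v) wv′ ⟨
        deriv (β ∘ F) (move a′ b′ v)                  ≡⟨ null (move a b y) wv′ ⟩
        0ℤ                                            ∎))
        where
        open ≡-Reasoning
        v : Vec Bool (8 + k)
        v = true ∷ false ∷ false ∷ η ∷ y
        wv : weight v ≡ 4 + r
        wv = wη η y ey
        wv′ : weight (move a′ b′ v) ≡ 4 + r
        wv′ = trans (weight-move v a′ b′ (pat zero) (pat (suc zero))) wv

    -- The remaining coordinates share one slope κ and the total weight is fixed, so their
    -- contribution is κ times (4 + r minus the four bits): the derivative is affine in the four
    -- bits alone.
    pair-form : ∀ η → NullOn (true ∷ false ∷ false ∷ η ∷ []) → NullOn (false ∷ true ∷ false ∷ η ∷ []) → NullOn (true ∷ false ∷ true ∷ not η ∷ []) →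
      ∃₂ λ A B → PairForm η A B
    pair-form η null₁ null₂ null₃ = go (pair-derivative-linear eig)
      where
      go : (∃₂ λ κ d → ∀ v → weight v ≡ 4 + r → deriv (β ∘ F) v ≡ κ +ᶻ dot d v) → ∃₂ λ A B → PairForm η A B
      go (κ₀ , d , lin) = α zero , α (suc (suc zero)) , λ s u e →
          trans (eq s u e) (affine-zeros η K (α zero) (α (suc zero)) (α (suc (suc zero))) (α (suc (suc (suc zero))))
            (zero-at (true ∷ false ∷ false ∷ η ∷ []) null₁) (zero-at (false ∷ true ∷ false ∷ η ∷ []) null₂) (zero-at (true ∷ false ∷ true ∷ not η ∷ []) null₃) s)
        where
        κ K : ℤ
        κ = d (suc (suc (suc (suc zero))))
        K = κ₀ +ᶻ κ *ᶻ pos (4 + r)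
        α : Fin 4 → ℤ
        α i = d (i ↑ˡ (4 + k)) -ᶻ κ
        eq : ∀ s u → weight (s ++ u) ≡ 4 + r → deriv (β ∘ F) (s ++ u) ≡
          affine K (α zero) (α (suc zero)) (α (suc (suc zero))) (α (suc (suc (suc zero)))) s
        eq (b₀ ∷ b₁ ∷ b₂ ∷ b₃ ∷ []) u e = trans (lin (b₀ ∷ b₁ ∷ b₂ ∷ b₃ ∷ u) e)
          (trans (cong (λ z → κ₀ +ᶻ (d zero *ᶻ β b₀ +ᶻ (d (suc zero) *ᶻ β b₁ +ᶻ (d (suc (suc zero)) *ᶻ β b₂ +ᶻ (d (suc (suc (suc zero))) *ᶻ β b₃ +ᶻ z)))))
              (dot-const (λ a → d (suc (suc (suc (suc a))))) κ (λ a → slopes-equal η null₁ κ₀ d lin a zero) u))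
            (affine-form κ₀ κ (d zero) (d (suc zero)) (d (suc (suc zero))) (d (suc (suc (suc zero)))) (β b₀) (β b₁) (β b₂) (β b₃) (wt u) (pos (4 + r)) total-weight))
          where
          total-weight : β b₀ +ᶻ (β b₁ +ᶻ (β b₂ +ᶻ (β b₃ +ᶻ wt u))) ≡ pos (4 + r)
          total-weight = trans (sym (trans (wt-cons b₀ (b₁ ∷ b₂ ∷ b₃ ∷ u)) (cong (β b₀ +ᶻ_) (trans (wt-cons b₁ (b₂ ∷ b₃ ∷ u)) (cong (β b₁ +ᶻ_)
            (trans (wt-cons b₂ (b₃ ∷ u)) (cong (β b₂ +ᶻ_) (wt-cons b₃ u)))))))) (cong pos e)
        zero-at : ∀ s → NullOn s → affine K (α zero) (α (suc zero)) (α (suc (suc zero))) (α (suc (suc (suc zero)))) s ≡ 0ℤ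
        zero-at s null = let u , e = extend s (4 + k) (4 + r) (weight-s≤ s) (ℕ.≤-trans 4+r≤4+k (ℕ.m≤n+m (4 + k) (weight s))) in trans (sym (eq s u e)) (null u e)

    -- A, B, A + B and A - B are all attained as values of the derivative, hence are differences of
    -- two Boolean values.
    pair-form-ball : ∀ η {A B} → PairForm η A B → Ball A B
    pair-form-ball η {A} {B} form = ball
      (sign-at (true ∷ true ∷ false ∷ η ∷ []) A (at-A η A B))
      (sign-at (true ∷ false ∷ true ∷ η ∷ []) B (at-B η A B))
      (sign-at (true ∷ true ∷ true ∷ η ∷ []) (A +ᶻ B) (at-A+B η A B))
      (sign-at (true ∷ true ∷ false ∷ not η ∷ []) (A -ᶻ B) (at-A-B η A B))
      where
      sign-at : ∀ s C → A *ᶻ U s +ᶻ B *ᶻ V η s ≡ C → Sign C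
      sign-at s C h = let u , e = extend s (4 + k) (4 + r) (weight-s≤ s) (ℕ.≤-trans 4+r≤4+k (ℕ.m≤n+m (4 + k) (weight s))) in
        subst Sign (trans (form s u e) h) (β-diff-sign (F (true ∷ false ∷ s ++ u)) (F (false ∷ true ∷ s ++ u)))

-- Twin coordinates outside the four distinguished ones

split-front : ∀ (s : Vec Bool m) (x : Vec Bool (m + n)) → (∀ i → lookup x (i ↑ˡ n) ≡ lookup s i) → ∃ λ v → x ≡ s ++ v
split-front []      x       h = x , refl
split-front (b ∷ s) (c ∷ x) h = let v , e = split-front s x (h ∘ suc) in v , cong₂ _∷_ (h zero) e

all-or-some : ∀ {P Q : Fin n → Set} → (∀ i → P i ⊎ Q i) → (∀ i → P i) ⊎ ∃ Q
all-or-some {zero}  h = inj₁ λ ()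
all-or-some {suc n} h with h zero | all-or-some (h ∘ suc)
... | inj₂ q | _            = inj₂ (zero , q)
... | inj₁ p | inj₂ (i , q) = inj₂ (suc i , q)
... | inj₁ p | inj₁ all     = inj₁ λ { zero → p ; (suc i) → all i }

ConstantOn : ∀ {m n} → ℕ → (Vec Bool (m + n) → Bool) → Vec Bool m → Set
ConstantOn w F s = ∃ λ b → ∀ v → weight (s ++ v) ≡ w → F (s ++ v) ≡ b

module Twins {r k w : ℕ} (5+r≡w : 5 + r ≡ w) (n≡2w : 10 + k ≡ w + w) {c : ℤ}
  {F : Vec Bool (10 + k) → Bool} (eig : Boolean.BooleanEigen 5+r≡w n≡2w {c} F) (η : Bool)
  (const₁ : ConstantOn w F (true ∷ false ∷ false ∷ η ∷ []))
  (const₂ : ConstantOn w F (false ∷ true ∷ false ∷ η ∷ []))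
  (const₃ : ConstantOn w F (true ∷ false ∷ true ∷ not η ∷ [])) where

  open Boolean 5+r≡w n≡2w {c}
  open Affine 5+r≡w n≡2w {c}

  -- The pair (A, B) acts as the difference of the potentials of a and b in ℤ²: antisymmetric,
  -- additive, and of ℓ¹ length at most 1.
  record DerivForm (a b : Fin (6 + k)) (A B : ℤ) : Set where
    field
      eval : ∀ s v → weight (s ++ v) ≡ w → lookup v a ≡ true → lookup v b ≡ false →
        β (F (s ++ v)) -ᶻ β (F (s ++ move a b v)) ≡ A *ᶻ U s +ᶻ B *ᶻ V η s
  open DerivForm

  shift : Fin (6 + k) → Fin (10 + k)
  shift a = suc (suc (suc (suc a)))

  shift-injective : ∀ {a b} → shift a ≡ shift b → a ≡ b
  shift-injective refl = refl

  front-six : Fin (6 + k) → Fin (6 + k) → Vec (Fin (10 + k)) 6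
  front-six a b = shift a ∷ shift b ∷ zero ∷ suc zero ∷ suc (suc zero) ∷ suc (suc (suc zero)) ∷ []

  front-six-unique : ∀ {a b} → a ≢ b → Unique (front-six a b)
  front-six-unique a≢b = ((a≢b ∘ shift-injective) ∷ (λ ()) ∷ (λ ()) ∷ (λ ()) ∷ (λ ()) ∷ []) ∷ ((λ ()) ∷ (λ ()) ∷ (λ ()) ∷ (λ ()) ∷ []) ∷
    ((λ ()) ∷ (λ ()) ∷ (λ ()) ∷ []) ∷ ((λ ()) ∷ (λ ()) ∷ []) ∷ ((λ ()) ∷ []) ∷ [] ∷ []

  private
    deriv-form-proof : ∀ {a b} → a ≢ b → ∃₂ λ A B → Ball A B × DerivForm a b A B
    deriv-form-proof {a} {b} a≢b = go (front (front-six a b) (front-six-unique a≢b))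
      where
      go : (Σ (Permutation′ (10 + k)) λ π → ∀ i → π ⟨$⟩ʳ (i ↑ˡ (4 + k)) ≡ lookup (front-six a b) i) → ∃₂ λ A B → Ball A B × DerivForm a b A B
      go (π , πp) = go₂ (pair-form eig′ η (null const₁) (null const₂) (null const₃))
        where
        F′ : Vec Bool (10 + k) → Bool
        F′ = F ∘ act (Perm.flip π)
        eig′ : BooleanEigen F′
        eig′ = eigen-act (Perm.flip π) eig
        from-front : ∀ b₀ b₁ s (u : Vec Bool (4 + k)) → ∃ λ v → act (Perm.flip π) (b₀ ∷ b₁ ∷ s ++ u) ≡ s ++ v
        from-front b₀ b₁ s u = split-front s (act (Perm.flip π) (b₀ ∷ b₁ ∷ s ++ u)) λ i →
          trans (lookup-act (Perm.flip π) (b₀ ∷ b₁ ∷ s ++ u) (i ↑ˡ (6 + k)))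
            (trans (cong (lookup (b₀ ∷ b₁ ∷ s ++ u)) (π⁻¹ i)) (Vec.lookup-++ˡ s u i))
          where
          π⁻¹ : ∀ i → π ⟨$⟩ˡ (i ↑ˡ (6 + k)) ≡ suc (suc (i ↑ˡ (4 + k)))
          π⁻¹ i = trans (cong (π ⟨$⟩ˡ_) (trans (lem i) (sym (πp (suc (suc i)))))) (Perm.inverseˡ π)
            where
            lem : ∀ i → i ↑ˡ (6 + k) ≡ lookup (front-six a b) (suc (suc i))
            lem zero                   = refl
            lem (suc zero)             = refl
            lem (suc (suc zero))       = refl
            lem (suc (suc (suc zero))) = refl
        value : ∀ s → (const : ConstantOn w F s) → ∀ b₀ b₁ u → weight (b₀ ∷ b₁ ∷ s ++ u) ≡ w → F′ (b₀ ∷ b₁ ∷ s ++ u) ≡ proj₁ const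
        value s (b , h) b₀ b₁ u e = let v , eq = from-front b₀ b₁ s u in
          trans (cong F eq) (h v (trans (cong weight (sym eq)) (trans (weight-act (Perm.flip π) (b₀ ∷ b₁ ∷ s ++ u)) e)))
        null : ∀ {s} → ConstantOn w F s → NullOn eig′ s
        null {s} const u e = trans
          (cong₂ (λ x y → β x -ᶻ β y) (value s const true false u (trans (cong suc e) 5+r≡w)) (value s const false true u (trans (cong suc e) 5+r≡w)))
          (ℤ.+-inverseʳ (β (proj₁ const)))
        go₂ : (∃₂ λ A B → PairForm eig′ η A B) → ∃₂ λ A B → Ball A B × DerivForm a b A B
        go₂ (A , B , form) = A , B , pair-form-ball eig′ η form , deriv-eq
          where
          deriv-eq : DerivForm a b A B
          deriv-eq .eval s@(s₀ ∷ s₁ ∷ s₂ ∷ s₃ ∷ []) v e va vb = go₃ (split-front (true ∷ false ∷ s) (act π x) bits)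
            where
            x : Vec Bool (10 + k)
            x = s ++ v
            x-bits : ∀ i → lookup x (lookup (front-six a b) i) ≡ lookup (true ∷ false ∷ s) i
            x-bits zero                                     = va
            x-bits (suc zero)                               = vb
            x-bits (suc (suc zero))                         = refl
            x-bits (suc (suc (suc zero)))                   = refl
            x-bits (suc (suc (suc (suc zero))))             = refl
            x-bits (suc (suc (suc (suc (suc zero)))))       = refl
            bits : ∀ i → lookup (act π x) (i ↑ˡ (4 + k)) ≡ lookup (true ∷ false ∷ s) i
            bits i = trans (lookup-act π x (i ↑ˡ (4 + k))) (trans (cong (lookup x) (πp i)) (x-bits i))
            go₃ : (∃ λ u → act π x ≡ (true ∷ false ∷ s) ++ u) → β (F (s ++ v)) -ᶻ β (F (s ++ move a b v)) ≡ A *ᶻ U s +ᶻ B *ᶻ V η s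
            go₃ (u , eq) = trans (cong₂ (λ y z → β (F y) -ᶻ β (F z)) x≡ moved≡) (form s u (ℕ.suc-injective (trans we (sym 5+r≡w))))
              where
              x≡ : s ++ v ≡ act (Perm.flip π) ((true ∷ false ∷ s) ++ u)
              x≡ = trans (sym (act-flip π x)) (cong (act (Perm.flip π)) eq)
              moved≡ : s ++ move a b v ≡ act (Perm.flip π) ((false ∷ true ∷ s) ++ u)
              moved≡ = trans (sym (act-flip π (move (shift a) (shift b) x)))
                (cong (act (Perm.flip π)) (trans (sym (trans (act-move π x zero (suc zero)) (cong₂ (λ i j → act π (move i j x)) (πp zero) (πp (suc zero)))))
                  (cong (move zero (suc zero)) eq)))
              we : weight ((true ∷ false ∷ s) ++ u) ≡ w
              we = trans (cong weight (sym eq)) (trans (weight-act π x) e)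

  opaque
    deriv-form : ∀ {a b} → a ≢ b → ∃₂ λ A B → Ball A B × DerivForm a b A B
    deriv-form = deriv-form-proof

  sA sB : Vec Bool 4
  sA = true ∷ true ∷ false ∷ η ∷ []
  sB = true ∷ false ∷ true ∷ η ∷ []

  opaque
    DerivForm-sym : ∀ {a b A B} → DerivForm a b A B → DerivForm b a (neg A) (neg B)
    DerivForm-sym {a} {b} {A} {B} form .eval s v e vb va = begin
      β (F (s ++ v)) -ᶻ β (F (s ++ v′))                  ≡⟨ cong (λ z → β (F (s ++ z)) -ᶻ β (F (s ++ v′))) (move-back v vb va) ⟨
      β (F (s ++ move a b v′)) -ᶻ β (F (s ++ v′))        ≡⟨ ring₁ (β (F (s ++ v′))) (β (F (s ++ move a b v′))) ⟩
      neg (β (F (s ++ v′)) -ᶻ β (F (s ++ move a b v′)))  ≡⟨ cong neg (form .eval s v′ e′ (lookup-move-1 v b a) (lookup-move-0 v (tf⇒≢ v vb va))) ⟩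
      neg (A *ᶻ U s +ᶻ B *ᶻ V η s)                       ≡⟨ ring₂ A B (U s) (V η s) ⟩
      neg A *ᶻ U s +ᶻ neg B *ᶻ V η s                     ∎
      where
      open ≡-Reasoning
      v′ : Vec Bool (6 + k)
      v′ = move b a v
      e′ : weight (s ++ v′) ≡ w
      e′ = trans (weight-++ s v′) (trans (cong (weight s +_) (weight-move v b a vb va)) (trans (sym (weight-++ s v)) e))
      ring₁ : ∀ x y → y -ᶻ x ≡ neg (x -ᶻ y)
      ring₁ = solve-∀
      ring₂ : ∀ A B x y → neg (A *ᶻ x +ᶻ B *ᶻ y) ≡ neg A *ᶻ x +ᶻ neg B *ᶻ y
      ring₂ = solve-∀

  private
    w≡ : ∀ (s : Vec Bool 4) j (v : Vec Bool (6 + k)) → weight s + j ≡ 5 → weight v ≡ j + r → weight (s ++ v) ≡ w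
    w≡ s j v h e = trans (weight-++ s v) (trans (cong (weight s +_) e) (trans (sym (ℕ.+-assoc (weight s) j r)) (trans (cong (_+ r) h) 5+r≡w)))

  -- The index is the weight of s. Since w = 5 + r, the remaining coordinates hold 3 + r or 2 + r
  -- ones, so two ones can be placed there even when r = 0.
  data Probe (s : Vec Bool 4) : Set where
    probe₂ : weight s + 3 ≡ 5 → Probe s
    probe₃ : weight s + 2 ≡ 5 → Probe s

  probeA : Probe sA
  probeA = go η
    where
    go : ∀ η → Probe (true ∷ true ∷ false ∷ η ∷ [])
    go true  = probe₃ refl
    go false = probe₂ refl

  probeB : Probe sB
  probeB = go η
    where
    go : ∀ η → Probe (true ∷ false ∷ true ∷ η ∷ [])
    go true  = probe₃ refl
    go false = probe₂ refl

  Pattern : ∀ {q} → Vec Bool 4 → Vec (Fin (6 + k)) q → Vec Bool q → Set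
  Pattern s p t = ∃ λ v → weight (s ++ v) ≡ w × (∀ i → lookup v (lookup p i) ≡ lookup t i)

  opaque
    pattern₃ : ∀ s → Probe s → ∀ (p : Vec (Fin (6 + k)) 3) → Unique p → Pattern s p (true ∷ false ∷ false ∷ [])
    pattern₃ s (probe₂ h) p u = let v , e , pat = pattern-exists p u (true ∷ false ∷ false ∷ []) (3 + r) (s≤s z≤n) (ℕ.m≤n⇒m≤1+n (ℕ.+-monoʳ-≤ 3 r≤k)) in
      v , w≡ s 3 v h e , pat
    pattern₃ s (probe₃ h) p u = let v , e , pat = pattern-exists p u (true ∷ false ∷ false ∷ []) (2 + r) (s≤s z≤n) (ℕ.m≤n⇒m≤1+n (ℕ.m≤n⇒m≤1+n (ℕ.+-monoʳ-≤ 2 r≤k))) in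
      v , w≡ s 2 v h e , pat

  opaque
    pattern₄ : ∀ s → Probe s → ∀ (p : Vec (Fin (6 + k)) 4) → Unique p → Pattern s p (true ∷ true ∷ false ∷ false ∷ [])
    pattern₄ s (probe₂ h) p u = let v , e , pat = pattern-exists p u (true ∷ true ∷ false ∷ false ∷ []) (3 + r) (s≤s (s≤s z≤n)) (ℕ.m≤n⇒m≤1+n (ℕ.+-monoʳ-≤ 3 r≤k)) in
      v , w≡ s 3 v h e , pat
    pattern₄ s (probe₃ h) p u = let v , e , pat = pattern-exists p u (true ∷ true ∷ false ∷ false ∷ []) (2 + r) (s≤s (s≤s z≤n)) (ℕ.m≤n⇒m≤1+n (ℕ.m≤n⇒m≤1+n (ℕ.+-monoʳ-≤ 2 r≤k))) in
      v , w≡ s 2 v h e , pat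

  opaque
    -- With bits 1, 0, 0 at a, b, c, the move from a to c is the move to b followed by the one to c.
    -- The patterns `sA` and `sB` read off the two components separately.
    DerivForm-add : ∀ {a b c A B A′ B′ A″ B″} → a ≢ b → a ≢ c → b ≢ c →
      DerivForm a b A B → DerivForm b c A′ B′ → DerivForm a c A″ B″ → A +ᶻ A′ ≡ A″ × B +ᶻ B′ ≡ B″
    DerivForm-add {a} {b} {c} {A} {B} {A′} {B′} {A″} {B″} a≢b a≢c b≢c f f′ f″ =
      trans (cong₂ _+ᶻ_ (sym (at-A η A B)) (sym (at-A η A′ B′))) (trans (on sA probeA) (at-A η A″ B″)) ,
      trans (cong₂ _+ᶻ_ (sym (at-B η A B)) (sym (at-B η A′ B′))) (trans (on sB probeB) (at-B η A″ B″))
      where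
      on : ∀ s → Probe s → (A *ᶻ U s +ᶻ B *ᶻ V η s) +ᶻ (A′ *ᶻ U s +ᶻ B′ *ᶻ V η s) ≡ A″ *ᶻ U s +ᶻ B″ *ᶻ V η s
      on s pr = go (pattern₃ s pr (a ∷ b ∷ c ∷ []) ((a≢b ∷ a≢c ∷ []) ∷ (b≢c ∷ []) ∷ [] ∷ []))
        where
        go : Pattern s (a ∷ b ∷ c ∷ []) (true ∷ false ∷ false ∷ []) → (A *ᶻ U s +ᶻ B *ᶻ V η s) +ᶻ (A′ *ᶻ U s +ᶻ B′ *ᶻ V η s) ≡ A″ *ᶻ U s +ᶻ B″ *ᶻ V η s
        go (v , e , pat) = begin
          (A *ᶻ U s +ᶻ B *ᶻ V η s) +ᶻ (A′ *ᶻ U s +ᶻ B′ *ᶻ V η s)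
            ≡⟨ cong₂ _+ᶻ_ (f .eval s v e va vb) (f′ .eval s v′ e′ (lookup-move-1 v a b) (trans (lookup-move v (a≢c ∘ sym) (b≢c ∘ sym)) vc)) ⟨
          (β (F (s ++ v)) -ᶻ β (F (s ++ v′))) +ᶻ (β (F (s ++ v′)) -ᶻ β (F (s ++ move b c v′)))
            ≡⟨ ring (β (F (s ++ v))) (β (F (s ++ v′))) (β (F (s ++ move b c v′))) ⟩
          β (F (s ++ v)) -ᶻ β (F (s ++ move b c v′))
            ≡⟨ cong (λ z → β (F (s ++ v)) -ᶻ β (F (s ++ z))) (move-trans v va vb) ⟩
          β (F (s ++ v)) -ᶻ β (F (s ++ move a c v))
            ≡⟨ f″ .eval s v e va vc ⟩
          A″ *ᶻ U s +ᶻ B″ *ᶻ V η s ∎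
          where
          open ≡-Reasoning
          va : lookup v a ≡ true
          va = pat zero
          vb : lookup v b ≡ false
          vb = pat (suc zero)
          vc : lookup v c ≡ false
          vc = pat (suc (suc zero))
          v′ : Vec Bool (6 + k)
          v′ = move a b v
          e′ : weight (s ++ v′) ≡ w
          e′ = trans (weight-++ s v′) (trans (cong (weight s +_) (weight-move v a b va vb)) (trans (sym (weight-++ s v)) e))
          ring : ∀ x y z → (x -ᶻ y) +ᶻ (y -ᶻ z) ≡ x -ᶻ z
          ring = solve-∀

  Twin : Fin (6 + k) → Fin (6 + k) → Set
  Twin a b = DerivForm a b 0ℤ 0ℤ

  infix 4 _≈_
  _≈_ : Fin (6 + k) → Fin (6 + k) → Set
  a ≈ b = a ≡ b ⊎ Twin a b

  ≈-sym : ∀ {a b} → a ≈ b → b ≈ a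
  ≈-sym (inj₁ e)  = inj₁ (sym e)
  ≈-sym (inj₂ tw) = inj₂ (DerivForm-sym tw)

  opaque
    ≈-trans : ∀ {a b c} → a ≈ b → b ≈ c → a ≈ c
    ≈-trans (inj₁ refl) h           = h
    ≈-trans h           (inj₁ refl) = h
    ≈-trans {a} {b} {c} (inj₂ tw) (inj₂ tw′) with a Fin.≟ c | a Fin.≟ b | b Fin.≟ c
    ... | yes e  | _        | _        = inj₁ e
    ... | no _   | yes refl | _        = inj₂ tw′
    ... | no _   | no _     | yes refl = inj₂ tw
    ... | no a≢c | no a≢b   | no b≢c   = inj₂ (go (deriv-form a≢c))
      where
      go : (∃₂ λ A B → Ball A B × DerivForm a c A B) → Twin a c
      go (A , B , _ , form) with DerivForm-add a≢b a≢c b≢c tw tw′ form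
      ... | refl , refl = form

  Nontwin : Fin (6 + k) → Fin (6 + k) → Set
  Nontwin a b = ∃₂ λ A B → NonZero A B × DerivForm a b A B

  opaque
    twin? : ∀ {a b} → a ≢ b → Twin a b ⊎ Nontwin a b
    twin? a≢b with deriv-form a≢b
    ... | A , B , bl , form with ball-split bl
    ...   | inj₁ (refl , refl) = inj₁ form
    ...   | inj₂ nz            = inj₂ (A , B , nz , form)

  opaque
    -- The step from a to b is the sum of the steps through m; by `ball-sum` one of these vanishes.
    -- So at most two twin classes exist.
    twin-either : ∀ {a b m} → a ≢ b → a ≢ m → m ≢ b → Nontwin a b → Twin a m ⊎ Twin m b
    twin-either a≢b a≢m m≢b (A , B , nz , form) with deriv-form a≢m | deriv-form m≢b
    ... | A₁ , B₁ , bl₁ , form₁ | A₂ , B₂ , bl₂ , form₂ with DerivForm-add a≢m a≢b m≢b form₁ form₂ form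
    ...   | refl , refl with ball-sum bl₁ bl₂ nz
    ...     | inj₁ (refl , refl) = inj₁ form₁
    ...     | inj₂ (refl , refl) = inj₂ form₂

  no-double : ∀ x y z {d} → β x -ᶻ β y ≡ d → β y -ᶻ β z ≡ d → d ≡ 1ℤ ⊎ d ≡ -1ℤ → ∀ {X : Set} → X
  no-double true  true  z     refl h  (inj₁ ())
  no-double true  true  z     refl h  (inj₂ ())
  no-double true  false true  refl () unit
  no-double true  false false refl () unit
  no-double false true  true  refl () unit
  no-double false true  false refl () unit
  no-double false false z     refl h  (inj₁ ())
  no-double false false z     refl h  (inj₂ ())

  -- Moving a ↦ b and m ↦ m′ one after the other would change a Boolean value twice in the same direction.
  opaque
    two-and-two : ∀ {a b m m′} → a ≢ b → a ≢ m → a ≢ m′ → b ≢ m → b ≢ m′ → m ≢ m′ → Nontwin a b → Twin a m → Twin m′ b → ∀ {X : Set} → X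
    two-and-two {a} {b} {m} {m′} a≢b a≢m a≢m′ b≢m b≢m′ m≢m′ (A , B , nz , form) am m′b =
      go (deriv-form m≢m′) (deriv-form (b≢m ∘ sym))
      where
      go : (∃₂ λ A′ B′ → Ball A′ B′ × DerivForm m m′ A′ B′) → (∃₂ λ A″ B″ → Ball A″ B″ × DerivForm m b A″ B″) → ∀ {X : Set} → X
      go (A′ , B′ , _ , form′) (A″ , B″ , _ , form″)
        with DerivForm-add (a≢m ∘ sym) (b≢m ∘ sym) a≢b (DerivForm-sym am) form form″
           | DerivForm-add (b≢m ∘ sym) m≢m′ b≢m′ form″ (DerivForm-sym m′b) form′
      ... | eA , eB | eA′ , eB′ = finish nz
        where
        -- Additivity over the triangles m, a, b and m, b, m′, each with one twin side, carries the
        -- coefficients of the pair a, b over to m, m′.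
        A≡ : A′ ≡ A
        A≡ = trans (sym eA′) (trans (ℤ.+-identityʳ A″) (trans (sym eA) (ℤ.+-identityˡ A)))
        B≡ : B′ ≡ B
        B≡ = trans (sym eB′) (trans (ℤ.+-identityʳ B″) (trans (sym eB) (ℤ.+-identityˡ B)))
        on : ∀ s → Probe s → ∀ d → A *ᶻ U s +ᶻ B *ᶻ V η s ≡ d → d ≡ 1ℤ ⊎ d ≡ -1ℤ → ∀ {X : Set} → X
        on s pr d isd unit with pattern₄ s pr (a ∷ m ∷ b ∷ m′ ∷ [])
          ((a≢m ∷ a≢b ∷ a≢m′ ∷ []) ∷ ((b≢m ∘ sym) ∷ m≢m′ ∷ []) ∷ (b≢m′ ∷ []) ∷ [] ∷ [])
        ... | v , e , pat = no-double (F (s ++ v)) (F (s ++ v′)) (F (s ++ move m m′ v′)) {d}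
          (trans (form .eval s v e va vb) isd)
          (trans (form′ .eval s v′ e′ (trans (lookup-move v (a≢m ∘ sym) (b≢m ∘ sym)) vm) (trans (lookup-move v (a≢m′ ∘ sym) (b≢m′ ∘ sym)) vm′))
            (trans (cong₂ (λ x y → x *ᶻ U s +ᶻ y *ᶻ V η s) A≡ B≡) isd)) unit
          where
          va : lookup v a ≡ true
          va = pat zero
          vm : lookup v m ≡ true
          vm = pat (suc zero)
          vb : lookup v b ≡ false
          vb = pat (suc (suc zero))
          vm′ : lookup v m′ ≡ false
          vm′ = pat (suc (suc (suc zero)))
          v′ : Vec Bool (6 + k)
          v′ = move a b v
          e′ : weight (s ++ v′) ≡ w
          e′ = trans (weight-++ s v′) (trans (cong (weight s +_) (weight-move v a b va vb)) (trans (sym (weight-++ s v)) e))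
        finish : NonZero A B → ∀ {X : Set} → X
        finish east  = on sA probeA A (at-A η A B) (inj₁ refl)
        finish west  = on sA probeA A (at-A η A B) (inj₂ refl)
        finish north = on sB probeB B (at-B η A B) (inj₁ refl)
        finish south = on sB probeB B (at-B η A B) (inj₂ refl)

  AllTwinsBut : Fin (6 + k) → Set
  AllTwinsBut r₀ = ∀ a b → a ≢ r₀ → b ≢ r₀ → a ≈ b

  opaque
    -- There are at most two classes, and `two-and-two` forbids two members in each. If everything
    -- is equivalent to coordinate zero, any exception will do. Otherwise let l be outside its
    -- class: the exception is zero when it has no twin apart from itself, and l when it has one.
    all-twins-but-one : ∃ AllTwinsBut
    all-twins-but-one with all-or-some {P = λ l → zero ≈ l} {Q = λ l → zero ≢ l × Nontwin zero l} first-search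
      where
      first-search : ∀ l → zero ≈ l ⊎ (zero ≢ l × Nontwin zero l)
      first-search l with zero Fin.≟ l
      ... | yes e = inj₁ (inj₁ e)
      ... | no ne with twin? ne
      ...   | inj₁ tw = inj₁ (inj₂ tw)
      ...   | inj₂ nt = inj₂ (ne , nt)
    ... | inj₁ all = zero , λ a b _ _ → ≈-trans (≈-sym (all a)) (all b)
    ... | inj₂ (l , 0≢l , nt) with all-or-some {P = λ m → m ≡ zero ⊎ m ≈ l} {Q = λ m → zero ≢ m × m ≢ l × Twin zero m} second-search
      where
      second-search : ∀ m → (m ≡ zero ⊎ m ≈ l) ⊎ (zero ≢ m × m ≢ l × Twin zero m)
      second-search m with zero Fin.≟ m | m Fin.≟ l
      ... | yes e | _     = inj₁ (inj₁ (sym e))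
      ... | no _  | yes e = inj₁ (inj₂ (inj₁ e))
      ... | no 0≢m | no m≢l with twin-either 0≢l 0≢m m≢l nt
      ...   | inj₁ tw = inj₂ (0≢m , m≢l , tw)
      ...   | inj₂ tw = inj₁ (inj₂ (inj₂ tw))
    ...   | inj₁ all = zero , λ a b a≢0 b≢0 → ≈-trans (to-l a a≢0) (≈-sym (to-l b b≢0))
      where
      to-l : ∀ a → a ≢ zero → a ≈ l
      to-l a a≢0 with all a
      ... | inj₁ e = contradiction e a≢0
      ... | inj₂ h = h
    ...   | inj₂ (m , 0≢m , m≢l , tw) = l , λ a b a≢l b≢l → ≈-trans (≈-sym (to-0 a a≢l)) (to-0 b b≢l)
      where
      to-0 : ∀ a → a ≢ l → zero ≈ a
      to-0 a a≢l with zero Fin.≟ a | m Fin.≟ a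
      ... | yes e  | _        = inj₁ e
      ... | no _   | yes refl = inj₂ tw
      ... | no 0≢a | no m≢a with twin-either 0≢l 0≢a a≢l nt
      ...   | inj₁ tw′ = inj₂ tw′
      ...   | inj₂ tw′ = two-and-two 0≢l 0≢m 0≢a (m≢l ∘ sym) (a≢l ∘ sym) m≢a nt tw tw′

  -- A path from v to v′ leaves r₀ alone, since both ends agree there; all its moves exchange bits
  -- of twins and preserve F.
  five-junta : ∃ λ r₀ → ∀ s v v′ → weight (s ++ v) ≡ w → weight v ≡ weight v′ → lookup v r₀ ≡ lookup v′ r₀ → F (s ++ v) ≡ F (s ++ v′)
  five-junta = go all-twins-but-one
    where
    go : ∃ AllTwinsBut → ∃ λ r₀ → ∀ s v v′ → weight (s ++ v) ≡ w → weight v ≡ weight v′ → lookup v r₀ ≡ lookup v′ r₀ → F (s ++ v) ≡ F (s ++ v′)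
    go (r₀ , twins) = r₀ , λ s v v′ ev e h → sym (proj₂ (proj₂ (follow
      (λ z → weight (s ++ z) ≡ w × lookup z r₀ ≡ lookup v′ r₀ × F (s ++ z) ≡ F (s ++ v))
      (λ { z i j zi zj vi vj (ez , zr , hz) →
        let i≢r = λ { refl → t≢f zi (trans zr vi) }
            j≢r = λ { refl → t≢f (trans zr vj) zj }
        in trans (weight-++ s (move i j z)) (trans (cong (weight s +_) (weight-move z i j zi zj)) (trans (sym (weight-++ s z)) ez)) ,
           trans (lookup-move z (i≢r ∘ sym) (j≢r ∘ sym)) zr ,
           trans (sym (same s z ez i j zi zj (twins i j i≢r j≢r))) hz })
      (path v v′ e) (ev , h , refl))))
      where
      same : ∀ s z → weight (s ++ z) ≡ w → ∀ i j → lookup z i ≡ true → lookup z j ≡ false → i ≈ j → F (s ++ z) ≡ F (s ++ move i j z)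
      same s z e i j zi zj (inj₁ refl) = t≢f zi zj
      same s z e i j zi zj (inj₂ tw)   = β-injective (ℤ.i-j≡0⇒i≡j (β (F (s ++ z))) (β (F (s ++ move i j z))) (tw .eval s z e zi zj))

-- Even quadratic Boolean functions of five variables

allBits : ∀ n → (Vec Bool n → Bool) → Bool
allBits zero    P = P []
allBits (suc n) P = allBits n (P ∘ (false ∷_)) ∧ allBits n (P ∘ (true ∷_))

∧-true : ∀ {a b} → a ∧ b ≡ true → a ≡ true × b ≡ true
∧-true {true} {true} _ = refl , refl

allBits-sound : ∀ n P → allBits n P ≡ true → ∀ t → P t ≡ true
allBits-sound zero    P h []          = h
allBits-sound (suc n) P h (false ∷ t) = allBits-sound n _ (proj₁ (∧-true h)) t
allBits-sound (suc n) P h (true ∷ t)  = allBits-sound n _ (proj₂ (∧-true {allBits n (P ∘ (false ∷_))} h)) t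

-- Truth tables as data, so that all Boolean functions of n bits can be enumerated by evaluation.
data Table : ℕ → Set where
  leaf : Bool → Table 0
  node : ∀ {n} → Table n → Table n → Table (suc n)

table : ∀ n → (Vec Bool n → Bool) → Table n
table zero    G = leaf (G [])
table (suc n) G = node (table n (G ∘ (false ∷_))) (table n (G ∘ (true ∷_)))

read : ∀ {n} → Table n → Vec Bool n → Bool
read (leaf b)   []          = b
read (node l r) (false ∷ t) = read l t
read (node l r) (true ∷ t)  = read r t

read-table : ∀ n G t → read (table n G) t ≡ G t
read-table zero    G []          = refl
read-table (suc n) G (false ∷ t) = read-table n (G ∘ (false ∷_)) t
read-table (suc n) G (true ∷ t)  = read-table n (G ∘ (true ∷_)) t

allTables : ∀ n → (Table n → Bool) → Bool
allTables zero    P = P (leaf false) ∧ P (leaf true)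
allTables (suc n) P = allTables n λ l → allTables n λ r → P (node l r)

allTables-sound : ∀ n P → allTables n P ≡ true → ∀ T → P T ≡ true
allTables-sound zero    P h (leaf false) = proj₁ (∧-true h)
allTables-sound zero    P h (leaf true)  = proj₂ (∧-true {P (leaf false)} h)
allTables-sound (suc n) P h (node l r)   = allTables-sound n (λ r → P (node l r)) (allTables-sound n _ h l) r

data Kind : Set where
  I II III IV : Kind

-- As formulas, `B1` is a ≠ d = e, and `B3` says that c, a, b, d, read in this order, change value
-- at most once. With bits as signs ±1, the latter is ca + ab + bd - cd = 2, which shows that it is
-- quadratic.
target : Kind → Vec Bool 5 → Bool
target I   (a ∷ b ∷ c ∷ d ∷ e ∷ []) = (a xor d) ∧ not (d xor e)
target II  (a ∷ b ∷ c ∷ d ∷ e ∷ []) = not (a xor b)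
target III (a ∷ b ∷ c ∷ d ∷ e ∷ []) = if a xor b then (if a then c ∧ not d else not c ∧ d) else (if a then c ∨ d else not (c ∧ d))
target IV  (a ∷ b ∷ c ∷ d ∷ e ∷ []) = not (a xor b) ∧ not (b xor c)

record Candidate : Set where
  constructor cand
  field
    kind  : Kind
    sign  : Bool
    order : Vec (Fin 5) 5

value : Candidate → Vec Bool 5 → Bool
value (cand κ s σ) t = s xor target κ (map (lookup t) σ)

inserts : Fin 5 → ∀ {n} → Vec (Fin 5) n → List (Vec (Fin 5) (suc n))
inserts i []      = (i ∷ []) ∷ []
inserts i (j ∷ v) = (i ∷ j ∷ v) ∷ List.map (j ∷_) (inserts i v)

permutations : ∀ {n} → Vec (Fin 5) n → List (Vec (Fin 5) n)
permutations []      = [] ∷ []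
permutations (i ∷ v) = concatMap (inserts i) (permutations v)

-- Orderings modulo symmetries of the targets; discarding the others only speeds up the exhaustive search.
useful : Kind → Vec (Fin 5) 5 → Bool
useful I   (a ∷ b ∷ c ∷ d ∷ e ∷ []) = does (b Fin.<? c) ∧ does (d Fin.<? e)
useful II  (a ∷ b ∷ c ∷ d ∷ e ∷ []) = does (a Fin.<? b) ∧ does (c Fin.<? d) ∧ does (d Fin.<? e)
useful III (a ∷ b ∷ c ∷ d ∷ e ∷ []) = does (a Fin.<? b)
useful IV  (a ∷ b ∷ c ∷ d ∷ e ∷ []) = does (a Fin.<? b) ∧ does (b Fin.<? c) ∧ does (d Fin.<? e)

candidates : List Candidate
candidates = concatMap (λ κ → concatMap (λ σ → cand κ false σ ∷ cand κ true σ ∷ [])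
  (filterᵇ (useful κ) (permutations (zero ∷ suc zero ∷ suc (suc zero) ∷ suc (suc (suc zero)) ∷ suc (suc (suc (suc zero))) ∷ []))))
  (II ∷ IV ∷ I ∷ III ∷ [])

unique? : (σ : Vec (Fin 5) 5) → Dec (Unique σ)
unique? = allPairs? λ i j → ¬? (i Fin.≟ j)

-- An even function of five bits is given by its values with first bit false, which halves the truth
-- table.
extend-even : Table 4 → Vec Bool 5 → Bool
extend-even T (false ∷ t) = read T t
extend-even T (true ∷ t)  = read T (compl t)

-- Distinctness of the coordinates is tested here, so soundness of the search rests on `fits` and
-- not on how the candidates are generated.
fits : Table 4 → Candidate → Bool
fits T k = allBits 5 (λ t → not (extend-even T t xor value k t)) ∧ does (unique? (Candidate.order k))

-- Mixed second differences in arguments 0, 1 and in arguments 2, 3. Their constancy is the form in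
-- which the search uses that a function is quadratic.
Δ₀₁ Δ₂₃ : (Vec Bool 5 → Bool) → Vec Bool 3 → ℤ
Δ₀₁ G (c ∷ d ∷ e ∷ []) = (β (G (true ∷ true ∷ c ∷ d ∷ e ∷ [])) -ᶻ β (G (false ∷ true ∷ c ∷ d ∷ e ∷ [])))
  -ᶻ (β (G (true ∷ false ∷ c ∷ d ∷ e ∷ [])) -ᶻ β (G (false ∷ false ∷ c ∷ d ∷ e ∷ [])))
Δ₂₃ G (a ∷ b ∷ e ∷ []) = (β (G (a ∷ b ∷ true ∷ true ∷ e ∷ [])) -ᶻ β (G (a ∷ b ∷ false ∷ true ∷ e ∷ [])))
  -ᶻ (β (G (a ∷ b ∷ true ∷ false ∷ e ∷ [])) -ᶻ β (G (a ∷ b ∷ false ∷ false ∷ e ∷ [])))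

Δ₃ : Table 3 → Bool → ℤ
Δ₃ h e = (β (read h (true ∷ true ∷ e ∷ [])) -ᶻ β (read h (false ∷ true ∷ e ∷ []))) -ᶻ (β (read h (true ∷ false ∷ e ∷ [])) -ᶻ β (read h (false ∷ false ∷ e ∷ [])))

-- Constancy of `Δ₂₃` inside the part of the table with both leading bits fixed: a necessary
-- condition that discards a quarter table before it is paired with another.
quadratic₃ : Table 3 → Bool
quadratic₃ h = does (Δ₃ h false ℤ.≟ Δ₃ h true)

zeros₃ : Vec Bool 3
zeros₃ = false ∷ false ∷ false ∷ []

quadratic : Table 4 → Bool
quadratic T = allBits 3 (λ t → does (Δ₀₁ (extend-even T) t ℤ.≟ Δ₀₁ (extend-even T) zeros₃)) ∧
              allBits 3 (λ t → does (Δ₂₃ (extend-even T) t ℤ.≟ Δ₂₃ (extend-even T) zeros₃))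

constant : Table 4 → Bool
constant T = allBits 4 (read T) ∨ allBits 4 (not ∘ read T)

verdict : Table 4 → Bool
verdict T = not (quadratic T) ∨ (constant T ∨ any (fits T) candidates)

inner : Table 3 → Table 3 → Bool
inner h₀ h₁ = not (quadratic₃ h₁) ∨ verdict (node h₀ h₁)

outer : Table 3 → Bool
outer h₀ = not (quadratic₃ h₀) ∨ allTables 3 (inner h₀)

-- Checked by evaluation over the pairs of three-variable truth tables that survive `quadratic₃`.
exhaustive : allTables 3 outer ≡ true
exhaustive = refl

not-∨ : ∀ {a b} → a ≡ true → not a ∨ b ≡ true → b ≡ true
not-∨ refl h = h

∨-true : ∀ a {b} → a ∨ b ≡ true → a ≡ true ⊎ b ≡ true
∨-true true  h = inj₁ refl
∨-true false h = inj₂ h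

any-sound : ∀ {A : Set} (P : A → Bool) xs → any P xs ≡ true → ∃ λ x → P x ≡ true
any-sound P (x ∷ xs) h with P x in e
... | true  = x , e
... | false = any-sound P xs h

not-xor : ∀ a b → not (a xor b) ≡ true → a ≡ b
not-xor true  true  _ = refl
not-xor false false _ = refl

does-true : ∀ {P : Set} (d : Dec P) → does d ≡ true → P
does-true (yes p) _ = p

allBits-complete : ∀ n P → (∀ t → P t ≡ true) → allBits n P ≡ true
allBits-complete zero    P h = h []
allBits-complete (suc n) P h = cong₂ _∧_ (allBits-complete n _ (h ∘ (false ∷_))) (allBits-complete n _ (h ∘ (true ∷_)))

opaque
  verdict-holds : ∀ h₀ h₁ → quadratic₃ h₀ ≡ true → quadratic₃ h₁ ≡ true → verdict (node h₀ h₁) ≡ true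
  verdict-holds h₀ h₁ q₀ q₁ = not-∨ q₁ (allTables-sound 3 (inner h₀) (not-∨ q₀ (allTables-sound 3 outer exhaustive h₀)) h₁)

  verdict-sound : ∀ T → quadratic T ≡ true → verdict T ≡ true →
    (∀ t → read T t ≡ true) ⊎ (∀ t → read T t ≡ false) ⊎ ∃ λ κ → Unique (Candidate.order κ) × (∀ t → extend-even T t ≡ value κ t)
  verdict-sound T q h = go (∨-true (constant T) (not-∨ {quadratic T} q h))
    where
    Outcome : Set
    Outcome = (∀ t → read T t ≡ true) ⊎ (∀ t → read T t ≡ false) ⊎ ∃ λ κ → Unique (Candidate.order κ) × (∀ t → extend-even T t ≡ value κ t)
    fit : (∃ λ κ → fits T κ ≡ true) → Outcome
    fit (κ , e) = inj₂ (inj₂ (κ , does-true (unique? (Candidate.order κ)) (proj₂ (∧-true {allBits 5 agree} e)) ,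
      λ t → not-xor (extend-even T t) (value κ t) (allBits-sound 5 agree (proj₁ (∧-true {allBits 5 agree} e)) t)))
      where
      agree : Vec Bool 5 → Bool
      agree t = not (extend-even T t xor value κ t)
    const : allBits 4 (read T) ≡ true ⊎ allBits 4 (not ∘ read T) ≡ true → Outcome
    const (inj₁ all) = inj₁ (allBits-sound 4 (read T) all)
    const (inj₂ all) = inj₂ (inj₁ λ t → Bool.not-injective (allBits-sound 4 (not ∘ read T) all t))
    go : constant T ≡ true ⊎ any (fits T) candidates ≡ true → Outcome
    go (inj₁ c) = const (∨-true (allBits 4 (read T)) c)
    go (inj₂ a) = fit (any-sound (fits T) candidates a)

Δ₀₁-cong : ∀ {G G′} → (∀ t → G t ≡ G′ t) → ∀ s → Δ₀₁ G s ≡ Δ₀₁ G′ s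
Δ₀₁-cong h (c ∷ d ∷ e ∷ []) = cong₂ _-ᶻ_ (cong₂ (λ x y → β x -ᶻ β y) (h _) (h _)) (cong₂ (λ x y → β x -ᶻ β y) (h _) (h _))

Δ₂₃-cong : ∀ {G G′} → (∀ t → G t ≡ G′ t) → ∀ s → Δ₂₃ G s ≡ Δ₂₃ G′ s
Δ₂₃-cong h (c ∷ d ∷ e ∷ []) = cong₂ _-ᶻ_ (cong₂ (λ x y → β x -ᶻ β y) (h _) (h _)) (cong₂ (λ x y → β x -ᶻ β y) (h _) (h _))

classify-five : ∀ (G : Vec Bool 5 → Bool) → (∀ t → G t ≡ G (compl t)) → (∀ s s′ → Δ₀₁ G s ≡ Δ₀₁ G s′) → (∀ s s′ → Δ₂₃ G s ≡ Δ₂₃ G s′) →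
  (∀ t → G t ≡ true) ⊎ (∀ t → G t ≡ false) ⊎ ∃ λ κ → Unique (Candidate.order κ) × (∀ t → G t ≡ value κ t)
classify-five G G-even G₀₁ G₂₃ = go (verdict-sound T quad (verdict-holds (h false) (h true) (quad₃ false) (quad₃ true)))
  where
  h : Bool → Table 3
  h b = table 3 λ t → G (false ∷ b ∷ t)
  T : Table 4
  T = node (h false) (h true)
  T≡ : ∀ t → read T t ≡ G (false ∷ t)
  T≡ (false ∷ t) = read-table 3 (λ t → G (false ∷ false ∷ t)) t
  T≡ (true ∷ t)  = read-table 3 (λ t → G (false ∷ true ∷ t)) t
  E≡ : ∀ t → extend-even T t ≡ G t
  E≡ (false ∷ t) = T≡ t
  E≡ (true ∷ t)  = trans (T≡ (compl t)) (sym (G-even (true ∷ t)))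
  quad₃ : ∀ b → quadratic₃ (h b) ≡ true
  quad₃ b = dec-true (Δ₃ (h b) false ℤ.≟ Δ₃ (h b) true) (G₂₃ (false ∷ b ∷ false ∷ []) (false ∷ b ∷ true ∷ []))
  quad : quadratic T ≡ true
  quad = cong₂ _∧_
    (allBits-complete 3 _ λ t → dec-true (Δ₀₁ (extend-even T) t ℤ.≟ Δ₀₁ (extend-even T) zeros₃)
      (trans (Δ₀₁-cong E≡ t) (trans (G₀₁ t zeros₃) (sym (Δ₀₁-cong E≡ zeros₃)))))
    (allBits-complete 3 _ λ t → dec-true (Δ₂₃ (extend-even T) t ℤ.≟ Δ₂₃ (extend-even T) zeros₃)
      (trans (Δ₂₃-cong E≡ t) (trans (G₂₃ t zeros₃) (sym (Δ₂₃-cong E≡ zeros₃)))))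
  constant-G : ∀ {b} → (∀ t → read T t ≡ b) → ∀ t → G t ≡ b
  constant-G c (false ∷ t) = trans (sym (T≡ t)) (c t)
  constant-G c (true ∷ t)  = trans (sym (E≡ (true ∷ t))) (c (compl t))
  go : ((∀ t → read T t ≡ true) ⊎ (∀ t → read T t ≡ false) ⊎ ∃ λ κ → Unique (Candidate.order κ) × (∀ t → extend-even T t ≡ value κ t)) →
    (∀ t → G t ≡ true) ⊎ (∀ t → G t ≡ false) ⊎ ∃ λ κ → Unique (Candidate.order κ) × (∀ t → G t ≡ value κ t)
  go (inj₁ c)                  = inj₁ (constant-G c)
  go (inj₂ (inj₁ c))           = inj₂ (inj₁ (constant-G c))
  go (inj₂ (inj₂ (κ , u , h))) = inj₂ (inj₂ (κ , u , λ t → trans (sym (E≡ t)) (h t)))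

-- Classification

-- The sign s allows for interchanging the cells; p lists the five relevant coordinates, and
-- equality is asked on the slice only.
Classified : ℕ → (Vec Bool n → Bool) → Set
Classified {n} w F = ∃₂ λ κ s → Σ (Vec (Fin n) 5) λ p → Unique p × (∀ x → weight x ≡ w → F x ≡ (s xor target κ (map (lookup x) p)))

NonConstant : ℕ → (Vec Bool n → Bool) → Set
NonConstant w F = (∃ λ x → weight x ≡ w × F x ≡ true) × (∃ λ x → weight x ≡ w × F x ≡ false)

classified-act : ∀ {w} {F : Vec Bool n → Bool} (π : Permutation′ n) → Classified w (F ∘ act (Perm.flip π)) → Classified w F
classified-act {F = F} π (κ , s , p , uniq , h) = κ , s , map (π ⟨$⟩ʳ_) p , map⁺ (perm-injective π) uniq , λ x e →
  trans (cong F (sym (act-flip π x))) (trans (h (act π x) (trans (weight-act π x) e))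
    (cong (λ t → s xor target κ t) (trans (Vec.map-cong (lookup-act π x) p) (Vec.map-∘ (lookup x) (π ⟨$⟩ʳ_) p))))

nonConstant-act : ∀ {w} {F : Vec Bool n → Bool} (π : Permutation′ n) → NonConstant w F → NonConstant w (F ∘ act (Perm.flip π))
nonConstant-act {F = F} π ((x , e , h) , (x′ , e′ , h′)) =
  (act π x , trans (weight-act π x) e , trans (cong F (act-flip π x)) h) , (act π x′ , trans (weight-act π x′) e′ , trans (cong F (act-flip π x′)) h′)

module Classification {r k w : ℕ} (5+r≡w : 5 + r ≡ w) (n≡2w : 10 + k ≡ w + w) {c : ℤ} where

  open Boolean 5+r≡w n≡2w {c}

  private
    w≤5+k : w ≤ 5 + k
    w≤5+k = subst (_≤ 5 + k) 5+r≡w (ℕ.+-monoʳ-≤ 5 r≤k)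

  module FiveCoordinates {F : Vec Bool (10 + k) → Bool} (eig : BooleanEigen F)
    (junta : ∀ (t : Vec Bool 5) v v′ → weight (t ++ v) ≡ w → weight v ≡ weight v′ → F (t ++ v) ≡ F (t ++ v′)) where

    -- Every pattern of five bits extends to a vertex because a vertex has at least five ones and
    -- five zeros. This makes `G` a function on the full five-cube.
    rest : ∀ (t : Vec Bool 5) → ∃ λ (v : Vec Bool (5 + k)) → weight (t ++ v) ≡ w
    rest t = extend t (5 + k) w (ℕ.≤-trans (weight≤ t) (subst (5 ≤_) 5+r≡w (ℕ.m≤m+n 5 r))) (ℕ.≤-trans w≤5+k (ℕ.m≤n+m (5 + k) (weight t)))

    G : Vec Bool 5 → Bool
    G t = F (t ++ proj₁ (rest t))

    F≡G : ∀ t v → weight (t ++ v) ≡ w → F (t ++ v) ≡ G t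
    F≡G t v e = junta t v (proj₁ (rest t)) e
      (ℕ.+-cancelˡ-≡ (weight t) _ _ (trans (sym (weight-++ t v)) (trans e (trans (sym (proj₂ (rest t))) (weight-++ t (proj₁ (rest t)))))))

    G-even : ∀ t → G t ≡ G (compl t)
    G-even t = trans (even-bool eig (t ++ v) (proj₂ (rest t))) (trans (cong F (Vec.map-++ not t v))
      (F≡G (compl t) (compl v) (trans (cong weight (sym (Vec.map-++ not t v))) (weight-compl-w (t ++ v) (proj₂ (rest t))))))
      where
      v : Vec Bool (5 + k)
      v = proj₁ (rest t)

    -- For vertices with seven prescribed bits: two ones to be moved away, two zeros outside the
    -- five coordinates to receive them, and three arbitrary bits of weight x.
    room : ∀ {x} → x ≤ 3 → 2 + x ≤ w × w ≤ (2 + x) + (3 + k)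
    room {x} x≤3 = subst (2 + x ≤_) 5+r≡w (ℕ.≤-trans (s≤s (s≤s x≤3)) (ℕ.m≤m+n 5 r)) ,
      ℕ.≤-trans w≤5+k (ℕ.+-monoˡ-≤ (3 + k) (ℕ.m≤m+n 2 x))

    -- The moves 0 to 5 and 1 to 6 change the first two bits independently; coordinates 5 and 6 lie
    -- outside the five and only absorb the weight, so the four values of F are values of `G`.
    G₀₁ : ∃ λ δ → ∀ s → Δ₀₁ G s ≡ δ
    G₀₁ = go (second-difference-constant eig i₀ i₅ i₁ i₆ (((λ ()) ∷ (λ ()) ∷ (λ ()) ∷ []) ∷ ((λ ()) ∷ (λ ()) ∷ []) ∷ ((λ ()) ∷ []) ∷ [] ∷ []))
      where
      i₀ i₁ i₅ i₆ : Fin (10 + k)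
      i₀ = zero
      i₁ = suc zero
      i₅ = suc (suc (suc (suc (suc zero))))
      i₆ = suc (suc (suc (suc (suc (suc zero)))))
      go : ConstantSecondDifference (β ∘ F) i₀ i₅ i₁ i₆ → ∃ λ δ → ∀ s → Δ₀₁ G s ≡ δ
      go (δ , isδ) = δ , at-s
        where
        at-s : ∀ s → Δ₀₁ G s ≡ δ
        at-s s@(c ∷ d ∷ e ∷ []) = go₂ (extend (true ∷ true ∷ c ∷ d ∷ e ∷ false ∷ false ∷ []) (3 + k) w (proj₁ (room (weight≤ s))) (proj₂ (room (weight≤ s))))
          where
          go₂ : (∃ λ (v : Vec Bool (3 + k)) → weight (true ∷ true ∷ c ∷ d ∷ e ∷ false ∷ false ∷ v) ≡ w) → Δ₀₁ G s ≡ δ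
          go₂ (v , we) = trans (sym (cong₂ _-ᶻ_
              (cong₂ (λ a b → β a -ᶻ β b) (F≡G (true ∷ true ∷ s) (false ∷ false ∷ v) we) (F≡G (false ∷ true ∷ s) (true ∷ false ∷ v) w₁))
              (cong₂ (λ a b → β a -ᶻ β b) (F≡G (true ∷ false ∷ s) (false ∷ true ∷ v) w₂) (F≡G (false ∷ false ∷ s) (true ∷ true ∷ v) w₃))))
              (isδ x we refl refl refl refl)
            where
            x : Vec Bool (10 + k)
            x = true ∷ true ∷ c ∷ d ∷ e ∷ false ∷ false ∷ v
            w₁ : weight (move i₀ i₅ x) ≡ w
            w₁ = trans (weight-move x i₀ i₅ refl refl) we
            w₂ : weight (move i₁ i₆ x) ≡ w
            w₂ = trans (weight-move x i₁ i₆ refl refl) we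
            w₃ : weight (move i₀ i₅ (move i₁ i₆ x)) ≡ w
            w₃ = trans (weight-move (move i₁ i₆ x) i₀ i₅ refl refl) w₂

    G₂₃ : ∃ λ δ → ∀ s → Δ₂₃ G s ≡ δ
    G₂₃ = go (second-difference-constant eig i₂ i₅ i₃ i₆ (((λ ()) ∷ (λ ()) ∷ (λ ()) ∷ []) ∷ ((λ ()) ∷ (λ ()) ∷ []) ∷ ((λ ()) ∷ []) ∷ [] ∷ []))
      where
      i₂ i₃ i₅ i₆ : Fin (10 + k)
      i₂ = suc (suc zero)
      i₃ = suc (suc (suc zero))
      i₅ = suc (suc (suc (suc (suc zero))))
      i₆ = suc (suc (suc (suc (suc (suc zero)))))
      go : ConstantSecondDifference (β ∘ F) i₂ i₅ i₃ i₆ → ∃ λ δ → ∀ s → Δ₂₃ G s ≡ δ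
      go (δ , isδ) = δ , at-s
        where
        at-s : ∀ s → Δ₂₃ G s ≡ δ
        at-s s@(a ∷ b ∷ e ∷ []) = go₂ (extend (a ∷ b ∷ true ∷ true ∷ e ∷ false ∷ false ∷ []) (3 + k) w
            (subst (_≤ w) (sym weight≡) (proj₁ (room (weight≤ s)))) (subst (λ z → w ≤ z + (3 + k)) (sym weight≡) (proj₂ (room (weight≤ s)))))
          where
          weight≡ : weight (a ∷ b ∷ true ∷ true ∷ e ∷ false ∷ false ∷ []) ≡ 2 + weight s
          weight≡ = trans (cong (b2n a +_) (trans (ℕ.+-suc (b2n b) _) (cong suc (ℕ.+-suc (b2n b) _))))
            (trans (ℕ.+-suc (b2n a) _) (cong suc (ℕ.+-suc (b2n a) _)))
          go₂ : (∃ λ (v : Vec Bool (3 + k)) → weight (a ∷ b ∷ true ∷ true ∷ e ∷ false ∷ false ∷ v) ≡ w) → Δ₂₃ G s ≡ δ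
          go₂ (v , we) = trans (sym (cong₂ _-ᶻ_
              (cong₂ (λ x y → β x -ᶻ β y) (F≡G (a ∷ b ∷ true ∷ true ∷ e ∷ []) (false ∷ false ∷ v) we) (F≡G (a ∷ b ∷ false ∷ true ∷ e ∷ []) (true ∷ false ∷ v) w₁))
              (cong₂ (λ x y → β x -ᶻ β y) (F≡G (a ∷ b ∷ true ∷ false ∷ e ∷ []) (false ∷ true ∷ v) w₂) (F≡G (a ∷ b ∷ false ∷ false ∷ e ∷ []) (true ∷ true ∷ v) w₃))))
              (isδ x we refl refl refl refl)
            where
            x : Vec Bool (10 + k)
            x = a ∷ b ∷ true ∷ true ∷ e ∷ false ∷ false ∷ v
            w₁ : weight (move i₂ i₅ x) ≡ w
            w₁ = trans (weight-move x i₂ i₅ refl refl) we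
            w₂ : weight (move i₃ i₆ x) ≡ w
            w₂ = trans (weight-move x i₃ i₆ refl refl) we
            w₃ : weight (move i₂ i₅ (move i₃ i₆ x)) ≡ w
            w₃ = trans (weight-move (move i₃ i₆ x) i₂ i₅ refl refl) w₂

    split₅ : ∀ (x : Vec Bool (10 + k)) → ∃₂ λ (t : Vec Bool 5) v → x ≡ t ++ v × (∀ i → lookup x (i ↑ˡ (5 + k)) ≡ lookup t i)
    split₅ (a ∷ b ∷ c ∷ d ∷ e ∷ v) = a ∷ b ∷ c ∷ d ∷ e ∷ [] , v , refl , Vec.lookup-++ˡ (a ∷ b ∷ c ∷ d ∷ e ∷ []) v

    classify : NonConstant w F → Classified w F
    classify ((x₁ , e₁ , h₁) , (x₂ , e₂ , h₂)) = go (classify-five G G-even (same G₀₁) (same G₂₃))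
      where
      same : ∀ {Δ : Vec Bool 3 → ℤ} → (∃ λ δ → ∀ s → Δ s ≡ δ) → ∀ s s′ → Δ s ≡ Δ s′
      same (δ , h) s s′ = trans (h s) (sym (h s′))
      value-of : ∀ {g : Vec Bool 5 → Bool} → (∀ t → G t ≡ g t) → ∀ x → weight x ≡ w → ∃ λ t → F x ≡ g t × (∀ i → lookup x (i ↑ˡ (5 + k)) ≡ lookup t i)
      value-of h x e with split₅ x
      ... | t , v , refl , l = t , trans (F≡G t v e) (h t) , l
      go : ((∀ t → G t ≡ true) ⊎ (∀ t → G t ≡ false) ⊎ ∃ λ κ → Unique (Candidate.order κ) × (∀ t → G t ≡ value κ t)) → Classified w F
      go (inj₁ h)        = t≢f (proj₁ (proj₂ (value-of h x₂ e₂))) h₂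
      go (inj₂ (inj₁ h)) = t≢f h₁ (proj₁ (proj₂ (value-of h x₁ e₁)))
      go (inj₂ (inj₂ (cand κ s σ , uniq , h))) = κ , s , map (_↑ˡ (5 + k)) σ , map⁺ (Fin.↑ˡ-injective (5 + k) _ _) uniq , λ x e →
        let t , Fx , l = value-of h x e in
        trans Fx (cong (λ y → s xor target κ y) (trans (sym (Vec.map-cong l σ)) (Vec.map-∘ (lookup x) (_↑ˡ (5 + k)) σ)))

-- Reduction to five coordinates

module Reduction {r k w : ℕ} (5+r≡w : 5 + r ≡ w) (n≡2w : 10 + k ≡ w + w) {c : ℤ} where

  open Boolean 5+r≡w n≡2w {c}

  flip-front : ∀ {q m} (π : Permutation′ (q + m)) (p : Vec (Fin (q + m)) q) → (∀ i → π ⟨$⟩ʳ (i ↑ˡ m) ≡ lookup p i) →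
    ∀ (t : Vec Bool q) (v : Vec Bool m) i → lookup (act (Perm.flip π) (t ++ v)) (lookup p i) ≡ lookup t i
  flip-front π p πp t v i = trans (lookup-act (Perm.flip π) (t ++ v) (lookup p i))
    (trans (cong (lookup (t ++ v)) (trans (cong (π ⟨$⟩ˡ_) (sym (πp i))) (Perm.inverseˡ π))) (Vec.lookup-++ˡ t v i))

  module _ {F : Vec Bool (10 + k) → Bool} (eig : BooleanEigen F) (nonconst : NonConstant w F) where

    from-constants : ∀ η → ConstantOn w F (true ∷ false ∷ false ∷ η ∷ []) → ConstantOn w F (false ∷ true ∷ false ∷ η ∷ []) →
      ConstantOn w F (true ∷ false ∷ true ∷ not η ∷ []) → Classified w F
    from-constants η const₁ const₂ const₃ = go (Twins.five-junta 5+r≡w n≡2w eig η const₁ const₂ const₃)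
      where
      go : (∃ λ r₀ → ∀ (s : Vec Bool 4) v v′ → weight (s ++ v) ≡ w → weight v ≡ weight v′ → lookup v r₀ ≡ lookup v′ r₀ → F (s ++ v) ≡ F (s ++ v′)) → Classified w F
      go (r₀ , junta) = go₂ (front p uniq)
        where
        p : Vec (Fin (10 + k)) 5
        p = zero ∷ suc zero ∷ suc (suc zero) ∷ suc (suc (suc zero)) ∷ suc (suc (suc (suc r₀))) ∷ []
        uniq : Unique p
        uniq = ((λ ()) ∷ (λ ()) ∷ (λ ()) ∷ (λ ()) ∷ []) ∷ ((λ ()) ∷ (λ ()) ∷ (λ ()) ∷ []) ∷ ((λ ()) ∷ (λ ()) ∷ []) ∷ ((λ ()) ∷ []) ∷ [] ∷ []
        go₂ : (Σ (Permutation′ (10 + k)) λ π → ∀ i → π ⟨$⟩ʳ (i ↑ˡ (5 + k)) ≡ lookup p i) → Classified w F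
        go₂ (π , πp) = classified-act π (Classification.FiveCoordinates.classify 5+r≡w n≡2w (eigen-act (Perm.flip π) eig) junta′ (nonConstant-act π nonconst))
          where
          F′ : Vec Bool (10 + k) → Bool
          F′ = F ∘ act (Perm.flip π)
          unfront : ∀ s₀ s₁ s₂ s₃ b (v : Vec Bool (5 + k)) → ∃ λ z → act (Perm.flip π) (s₀ ∷ s₁ ∷ s₂ ∷ s₃ ∷ b ∷ v) ≡ (s₀ ∷ s₁ ∷ s₂ ∷ s₃ ∷ []) ++ z × lookup z r₀ ≡ b
          unfront s₀ s₁ s₂ s₃ b v = let z , eq = split-front (s₀ ∷ s₁ ∷ s₂ ∷ s₃ ∷ []) (act (Perm.flip π) (t ++ v)) bits in
            z , eq , trans (cong (λ y → lookup y (suc (suc (suc (suc r₀))))) (sym eq)) (flip-front π p πp t v (suc (suc (suc (suc zero)))))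
            where
            t : Vec Bool 5
            t = s₀ ∷ s₁ ∷ s₂ ∷ s₃ ∷ b ∷ []
            bits : ∀ (i : Fin 4) → lookup (act (Perm.flip π) (t ++ v)) (i ↑ˡ (6 + k)) ≡ lookup (s₀ ∷ s₁ ∷ s₂ ∷ s₃ ∷ []) i
            bits zero                   = flip-front π p πp t v zero
            bits (suc zero)             = flip-front π p πp t v (suc zero)
            bits (suc (suc zero))       = flip-front π p πp t v (suc (suc zero))
            bits (suc (suc (suc zero))) = flip-front π p πp t v (suc (suc (suc zero)))
          junta′ : ∀ (t : Vec Bool 5) v v′ → weight (t ++ v) ≡ w → weight v ≡ weight v′ → F′ (t ++ v) ≡ F′ (t ++ v′)
          junta′ t@(s₀ ∷ s₁ ∷ s₂ ∷ s₃ ∷ b ∷ []) v v′ e e′ = same (unfront s₀ s₁ s₂ s₃ b v) (unfront s₀ s₁ s₂ s₃ b v′)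
            where
            s : Vec Bool 4
            s = s₀ ∷ s₁ ∷ s₂ ∷ s₃ ∷ []
            same : (∃ λ z → act (Perm.flip π) (t ++ v) ≡ s ++ z × lookup z r₀ ≡ b) → (∃ λ z → act (Perm.flip π) (t ++ v′) ≡ s ++ z × lookup z r₀ ≡ b) →
              F′ (t ++ v) ≡ F′ (t ++ v′)
            same (z , eq , zr) (z′ , eq′ , zr′) = trans (cong F eq) (trans (junta s z z′ wz (ℕ.+-cancelˡ-≡ (weight s) _ _
                (trans (sym (weight-++ s z)) (trans wz (trans (sym wz′) (weight-++ s z′))))) (trans zr (sym zr′))) (cong F (sym eq′)))
              where
              wz : weight (s ++ z) ≡ w
              wz = trans (cong weight (sym eq)) (trans (weight-act (Perm.flip π) (t ++ v)) e)
              wz′ : weight (s ++ z′) ≡ w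
              wz′ = trans (cong weight (sym eq′)) (trans (weight-act (Perm.flip π) (t ++ v′))
                (trans (weight-++ t v′) (trans (cong (weight t +_) (sym e′)) (trans (sym (weight-++ t v)) e))))

    -- Evenness adds the complements of the two known patterns. Among the resulting four, three have
    -- the shape (1,0,0,η′), (0,1,0,η′), (1,0,1,not η′): with η′ = η if ξ is false, and η′ = not η
    -- if ξ is true.
    from-pair : ∀ ξ η → (∀ v → weight (true ∷ false ∷ ξ ∷ η ∷ v) ≡ w → F (true ∷ false ∷ ξ ∷ η ∷ v) ≡ true × F (false ∷ true ∷ ξ ∷ η ∷ v) ≡ false) →
      Classified w F
    from-pair ξ η known = go ξ η known
      where
      Known : Bool → Bool → Set
      Known ξ η = ∀ v → weight (true ∷ false ∷ ξ ∷ η ∷ v) ≡ w → F (true ∷ false ∷ ξ ∷ η ∷ v) ≡ true × F (false ∷ true ∷ ξ ∷ η ∷ v) ≡ false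
      direct₁ : ∀ ξ η → Known ξ η → ConstantOn w F (true ∷ false ∷ ξ ∷ η ∷ [])
      direct₁ ξ η kn = true , λ v e → proj₁ (kn v e)
      direct₂ : ∀ ξ η → Known ξ η → ConstantOn w F (false ∷ true ∷ ξ ∷ η ∷ [])
      direct₂ ξ η kn = false , λ v e → proj₂ (kn v e)
      opposite₁ : ∀ ξ η → Known ξ η → ConstantOn w F (true ∷ false ∷ not ξ ∷ not η ∷ [])
      opposite₁ ξ η kn = false , λ v e → trans (even-bool eig (true ∷ false ∷ not ξ ∷ not η ∷ v) e)
        (trans (cong₂ (λ a b → F (false ∷ true ∷ a ∷ b ∷ compl v)) (Bool.not-involutive ξ) (Bool.not-involutive η))
          (proj₂ (kn (compl v) (trans (cong₂ (λ a b → weight (true ∷ false ∷ a ∷ b ∷ compl v)) (sym (Bool.not-involutive ξ)) (sym (Bool.not-involutive η)))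
            (weight-compl-w (true ∷ false ∷ not ξ ∷ not η ∷ v) e)))))
      opposite₂ : ∀ ξ η → Known ξ η → ConstantOn w F (false ∷ true ∷ not ξ ∷ not η ∷ [])
      opposite₂ ξ η kn = true , λ v e → trans (even-bool eig (false ∷ true ∷ not ξ ∷ not η ∷ v) e)
        (trans (cong₂ (λ a b → F (true ∷ false ∷ a ∷ b ∷ compl v)) (Bool.not-involutive ξ) (Bool.not-involutive η))
          (proj₁ (kn (compl v) (trans (cong₂ (λ a b → weight (true ∷ false ∷ a ∷ b ∷ compl v)) (sym (Bool.not-involutive ξ)) (sym (Bool.not-involutive η)))
            (weight-compl-w (false ∷ true ∷ not ξ ∷ not η ∷ v) e)))))
      go : ∀ ξ η → Known ξ η → Classified w F
      go false η kn = from-constants η (direct₁ false η kn) (direct₂ false η kn) (opposite₁ false η kn)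
      go true  η kn = from-constants (not η) (opposite₁ true η kn) (opposite₂ true η kn)
        (subst (λ b → ConstantOn w F (true ∷ false ∷ true ∷ b ∷ [])) (sym (Bool.not-involutive η)) (direct₁ true η kn))

  from-edge : ∀ {F} (eig : BooleanEigen F) → NonConstant w F → ∀ v₀ → weight v₀ ≡ 4 + r → F (true ∷ false ∷ v₀) ≡ true → F (false ∷ true ∷ v₀) ≡ false → Classified w F
  from-edge {F} eig nonconst v₀ e₀ h₁ h₂ = go (two-coordinates eig v₀ e₀ h₁ h₂)
    where
    go : TwoCoordinates eig v₀ → Classified w F
    go (a , b , a≢b , known) = go₂ (front p uniq)
      where
      p : Vec (Fin (10 + k)) 4
      p = zero ∷ suc zero ∷ suc (suc a) ∷ suc (suc b) ∷ []
      uniq : Unique p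
      uniq = ((λ ()) ∷ (λ ()) ∷ (λ ()) ∷ []) ∷ ((λ ()) ∷ (λ ()) ∷ []) ∷ ((a≢b ∘ Fin.suc-injective ∘ Fin.suc-injective) ∷ []) ∷ [] ∷ []
      go₂ : (Σ (Permutation′ (10 + k)) λ π → ∀ i → π ⟨$⟩ʳ (i ↑ˡ (6 + k)) ≡ lookup p i) → Classified w F
      go₂ (π , πp) = classified-act π (from-pair (eigen-act (Perm.flip π) eig) (nonConstant-act π nonconst) ξ η known′)
        where
        ξ η : Bool
        ξ = lookup v₀ a
        η = lookup v₀ b
        F′ : Vec Bool (10 + k) → Bool
        F′ = F ∘ act (Perm.flip π)
        unfront : ∀ b₀ b₁ (v : Vec Bool (6 + k)) → ∃ λ z → act (Perm.flip π) (b₀ ∷ b₁ ∷ ξ ∷ η ∷ v) ≡ b₀ ∷ b₁ ∷ z × lookup z a ≡ ξ × lookup z b ≡ η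
        unfront b₀ b₁ v = let z , eq = split-front (b₀ ∷ b₁ ∷ []) (act (Perm.flip π) (t ++ v)) bits in
          z , eq , trans (cong (λ y → lookup y (suc (suc a))) (sym eq)) (flip-front π p πp t v (suc (suc zero))) ,
          trans (cong (λ y → lookup y (suc (suc b))) (sym eq)) (flip-front π p πp t v (suc (suc (suc zero))))
          where
          t : Vec Bool 4
          t = b₀ ∷ b₁ ∷ ξ ∷ η ∷ []
          bits : ∀ (i : Fin 2) → lookup (act (Perm.flip π) (t ++ v)) (i ↑ˡ (8 + k)) ≡ lookup (b₀ ∷ b₁ ∷ []) i
          bits zero       = flip-front π p πp t v zero
          bits (suc zero) = flip-front π p πp t v (suc zero)
        known′ : ∀ v → weight (true ∷ false ∷ ξ ∷ η ∷ v) ≡ w → F′ (true ∷ false ∷ ξ ∷ η ∷ v) ≡ true × F′ (false ∷ true ∷ ξ ∷ η ∷ v) ≡ false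
        known′ v e = both (unfront true false v) (unfront false true v)
          where
          both : (∃ λ z → act (Perm.flip π) (true ∷ false ∷ ξ ∷ η ∷ v) ≡ true ∷ false ∷ z × lookup z a ≡ ξ × lookup z b ≡ η) →
                 (∃ λ z → act (Perm.flip π) (false ∷ true ∷ ξ ∷ η ∷ v) ≡ false ∷ true ∷ z × lookup z a ≡ ξ × lookup z b ≡ η) →
                 F′ (true ∷ false ∷ ξ ∷ η ∷ v) ≡ true × F′ (false ∷ true ∷ ξ ∷ η ∷ v) ≡ false
          both (z , eq , za , zb) (z′ , eq′ , za′ , zb′) =
            trans (cong F eq) (proj₁ (known z (ℕ.suc-injective (trans wz (sym 5+r≡w))) za zb)) ,
            trans (cong F eq′) (proj₂ (known z′ (ℕ.suc-injective (trans wz′ (sym 5+r≡w))) za′ zb′))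
            where
            wz : weight (true ∷ false ∷ z) ≡ w
            wz = trans (cong weight (sym eq)) (trans (weight-act (Perm.flip π) (true ∷ false ∷ ξ ∷ η ∷ v)) e)
            wz′ : weight (false ∷ true ∷ z′) ≡ w
            wz′ = trans (cong weight (sym eq′)) (trans (weight-act (Perm.flip π) (false ∷ true ∷ ξ ∷ η ∷ v)) e)

  Edge : (Vec Bool (10 + k) → Bool) → Set
  Edge F = ∃ λ z → ∃₂ λ i j → weight z ≡ w × lookup z i ≡ true × lookup z j ≡ false × F z ≡ true × F (move i j z) ≡ false

  edge : ∀ {F} {x y} → Path x y → weight x ≡ w → F x ≡ true → F y ≡ false → Edge F
  edge done e h h′ = t≢f h h′
  edge {F} (step {x} i j p q r s ps) e h h′ with F (move i j x) in eq
  ... | true  = edge ps (trans (weight-move x i j p r) e) eq h′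
  ... | false = x , i , j , e , p , r , h , eq

  -- A path from a vertex with value true to one with value false contains a step where F drops; its
  -- two coordinates are brought to the front.
  classify : ∀ {F} → BooleanEigen F → NonConstant w F → Classified w F
  classify {F} eig nonconst@((x , e , h) , (x′ , e′ , h′)) = go (edge (path x x′ (trans e (sym e′))) e h h′)
    where
    go : Edge F → Classified w F
    go (z , i , j , ez , zi , zj , hz , hz′) = go₂ (front (i ∷ j ∷ []) ((tf⇒≢ z zi zj ∷ []) ∷ [] ∷ []))
      where
      go₂ : (Σ (Permutation′ (10 + k)) λ π → ∀ a → π ⟨$⟩ʳ (a ↑ˡ (8 + k)) ≡ lookup (i ∷ j ∷ []) a) → Classified w F
      go₂ (π , πp) = go₃ (split-front (true ∷ false ∷ []) (act π z) bits)
        where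
        bits : ∀ a → lookup (act π z) (a ↑ˡ (8 + k)) ≡ lookup (true ∷ false ∷ []) a
        bits zero       = trans (lookup-act π z zero) (trans (cong (lookup z) (πp zero)) zi)
        bits (suc zero) = trans (lookup-act π z (suc zero)) (trans (cong (lookup z) (πp (suc zero))) zj)
        go₃ : (∃ λ v → act π z ≡ true ∷ false ∷ v) → Classified w F
        go₃ (v , eq) = classified-act π (from-edge (eigen-act (Perm.flip π) eig) (nonConstant-act π nonconst) v
          (ℕ.suc-injective (trans (cong weight (sym eq)) (trans (weight-act π z) (trans ez (sym 5+r≡w)))))
          (trans (cong (F ∘ act (Perm.flip π)) (sym eq)) (trans (cong F (act-flip π z)) hz))
          (trans (cong (F ∘ act (Perm.flip π)) moved) (trans (cong F (act-flip π (move i j z))) hz′)))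
          where
          moved : false ∷ true ∷ v ≡ act π (move i j z)
          moved = trans (cong (move zero (suc zero)) (sym eq)) (trans (act-move π z zero (suc zero)) (cong₂ (λ a b → act π (move a b z)) (πp zero) (πp (suc zero))))

-- Counting neighbours

cubeSum : ∀ {n} → Fun n → ℤ
cubeSum {zero}  φ = φ []
cubeSum {suc n} φ = cubeSum (φ ∘ (true ∷_)) +ᶻ cubeSum (φ ∘ (false ∷_))

cubeSum-cong : ∀ {n} {φ ψ : Fun n} → (∀ x → φ x ≡ ψ x) → cubeSum φ ≡ cubeSum ψ
cubeSum-cong {zero}  h = h []
cubeSum-cong {suc n} h = cong₂ _+ᶻ_ (cubeSum-cong (h ∘ (true ∷_))) (cubeSum-cong (h ∘ (false ∷_)))

cubeSum-zero : ∀ {n} {φ : Fun n} → (∀ x → φ x ≡ 0ℤ) → cubeSum φ ≡ 0ℤ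
cubeSum-zero {zero}  h = h []
cubeSum-zero {suc n} h = cong₂ _+ᶻ_ (cubeSum-zero (h ∘ (true ∷_))) (cubeSum-zero (h ∘ (false ∷_)))

listSum : ∀ {A : Set} → (A → ℤ) → List A → ℤ
listSum φ []       = 0ℤ
listSum φ (x ∷ xs) = φ x +ᶻ listSum φ xs

listSum-++ : ∀ {A : Set} (φ : A → ℤ) xs ys → listSum φ (xs List.++ ys) ≡ listSum φ xs +ᶻ listSum φ ys
listSum-++ φ []       ys = sym (ℤ.+-identityˡ _)
listSum-++ φ (x ∷ xs) ys = trans (cong (φ x +ᶻ_) (listSum-++ φ xs ys)) (sym (ℤ.+-assoc (φ x) _ _))

listSum-map : ∀ {A B : Set} (φ : B → ℤ) (g : A → B) xs → listSum φ (List.map g xs) ≡ listSum (φ ∘ g) xs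
listSum-map φ g []       = refl
listSum-map φ g (x ∷ xs) = cong (φ (g x) +ᶻ_) (listSum-map φ g xs)

listSum-allVecs : ∀ n (φ : Fun n) → listSum φ (allVecs n) ≡ cubeSum φ
listSum-allVecs zero    φ = ℤ.+-identityʳ _
listSum-allVecs (suc n) φ = trans (listSum-++ φ (List.map (true ∷_) (allVecs n)) _)
  (cong₂ _+ᶻ_ (trans (listSum-map φ (true ∷_) (allVecs n)) (listSum-allVecs n (φ ∘ (true ∷_))))
              (trans (listSum-map φ (false ∷_) (allVecs n)) (listSum-allVecs n (φ ∘ (false ∷_)))))

count-mapMaybe : ∀ {A B : Set} (P : B → Bool) (h : A → Maybe B) xs →
  pos (length (filterᵇ P (mapMaybe h xs))) ≡ listSum (maybe′ (β ∘ P) 0ℤ ∘ h) xs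
count-mapMaybe P h []       = refl
count-mapMaybe P h (x ∷ xs) with h x
... | nothing = trans (count-mapMaybe P h xs) (sym (ℤ.+-identityˡ _))
... | just y with P y
...   | true  = cong (1ℤ +ᶻ_) (count-mapMaybe P h xs)
...   | false = trans (count-mapMaybe P h xs) (sym (ℤ.+-identityˡ _))

common≤ˡ : ∀ (x y : Vec Bool n) → common x y ≤ weight x
common≤ˡ []          []          = z≤n
common≤ˡ (true ∷ x)  (true ∷ y)  = s≤s (common≤ˡ x y)
common≤ˡ (true ∷ x)  (false ∷ y) = ℕ.m≤n⇒m≤1+n (common≤ˡ x y)
common≤ˡ (false ∷ x) (_ ∷ y)     = common≤ˡ x y

common≤ʳ : ∀ (x y : Vec Bool n) → common x y ≤ weight y
common≤ʳ []          []          = z≤n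
common≤ʳ (true ∷ x)  (true ∷ y)  = s≤s (common≤ʳ x y)
common≤ʳ (true ∷ x)  (false ∷ y) = common≤ʳ x y
common≤ʳ (false ∷ x) (true ∷ y)  = ℕ.m≤n⇒m≤1+n (common≤ʳ x y)
common≤ʳ (false ∷ x) (false ∷ y) = common≤ʳ x y

≡ᵇ-true : ∀ m n → (m ≡ᵇ n) ≡ true → m ≡ n
≡ᵇ-true zero    zero    _ = refl
≡ᵇ-true (suc m) (suc n) h = cong suc (≡ᵇ-true m n h)

≡ᵇ-complete : ∀ m n → m ≡ n → (m ≡ᵇ n) ≡ true
≡ᵇ-complete zero    zero    _ = refl
≡ᵇ-complete (suc m) (suc n) e = ≡ᵇ-complete m n (ℕ.suc-injective e)

when-absurd : ∀ b {z} → (b ≡ true → 0ℤ ≡ z) → when b z ≡ 0ℤ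
when-absurd true  h = sym (h refl)
when-absurd false h = refl

∧-≡ᵇ : ∀ a b c d → (a ≡ᵇ b) ∧ (c ≡ᵇ d) ≡ true → a ≡ b × c ≡ d
∧-≡ᵇ a b c d h = let p , q = ∧-true {a ≡ᵇ b} h in ≡ᵇ-true a b p , ≡ᵇ-true c d q

-- Equality, covering from above, covering from below and Johnson adjacency, all expressed by
-- weights and common ones. Removing one coordinate from an adjacent pair leads to the other
-- relations, so the four sums are evaluated together by recursion.
same-ind above-ind below-ind adjacent-ind : Vec Bool n → Vec Bool n → Bool
same-ind     x y = (weight y ≡ᵇ weight x) ∧ (common x y ≡ᵇ weight x)
above-ind    x y = (weight y ≡ᵇ suc (weight x)) ∧ (common x y ≡ᵇ weight x)
below-ind    x y = (suc (weight y) ≡ᵇ weight x) ∧ (suc (common x y) ≡ᵇ weight x)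
adjacent-ind x y = (weight y ≡ᵇ weight x) ∧ (suc (common x y) ≡ᵇ weight x)

too-many-common : ∀ (x y : Vec Bool n) {b c : ℤ} → common x y ≡ suc (weight x) → b ≡ c
too-many-common x y e = contradiction (subst (_≤ weight x) e (common≤ˡ x y)) ℕ.1+n≰n

sum-same : ∀ (x : Vec Bool n) (ψ : Fun n) → cubeSum (λ y → when (same-ind x y) (ψ y)) ≡ ψ x
sum-same []          ψ = refl
sum-same (true ∷ x)  ψ = trans (cong₂ _+ᶻ_ (sum-same x (ψ ∘ (true ∷_)))
  (cubeSum-zero λ y → when-absurd (same-ind (true ∷ x) (false ∷ y)) λ h → too-many-common x y (proj₂ (∧-≡ᵇ (weight y) (suc (weight x)) (common x y) (suc (weight x)) h))))
  (ℤ.+-identityʳ _)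
sum-same (false ∷ x) ψ = trans (cong₂ _+ᶻ_
  (cubeSum-zero λ y → when-absurd (same-ind (false ∷ x) (true ∷ y)) λ h →
    let p , q = ∧-≡ᵇ (suc (weight y)) (weight x) (common x y) (weight x) h in contradiction (subst (_≤ weight y) (trans q (sym p)) (common≤ʳ x y)) (ℕ.1+n≰n {weight y}))
  (sum-same x (ψ ∘ (false ∷_)))) (ℤ.+-identityˡ _)

sum-above : ∀ (x : Vec Bool n) (ψ : Fun n) → cubeSum (λ y → when (above-ind x y) (ψ y)) ≡ up ψ x
sum-above []          ψ = refl
sum-above (true ∷ x)  ψ = trans (cong₂ _+ᶻ_ (sum-above x (ψ ∘ (true ∷_)))
  (cubeSum-zero λ y → when-absurd (above-ind (true ∷ x) (false ∷ y)) λ h → too-many-common x y (proj₂ (∧-≡ᵇ (weight y) (suc (suc (weight x))) (common x y) (suc (weight x)) h))))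
  (trans (ℤ.+-identityʳ _) (sym (up-true ψ x)))
sum-above (false ∷ x) ψ = cong₂ _+ᶻ_ (sum-same x (ψ ∘ (true ∷_))) (sum-above x (ψ ∘ (false ∷_)))

sum-below : ∀ (x : Vec Bool n) (ψ : Fun n) → cubeSum (λ y → when (below-ind x y) (ψ y)) ≡ down ψ x
sum-below []          ψ = refl
sum-below (true ∷ x)  ψ = trans (cong₂ _+ᶻ_ (sum-below x (ψ ∘ (true ∷_))) (sum-same x (ψ ∘ (false ∷_)))) (ℤ.+-comm (down (ψ ∘ (true ∷_)) x) (ψ (false ∷ x)))
sum-below (false ∷ x) ψ = trans (cong₂ _+ᶻ_
  (cubeSum-zero λ y → when-absurd (below-ind (false ∷ x) (true ∷ y)) λ h →
    let p , q = ∧-≡ᵇ (suc (suc (weight y))) (weight x) (suc (common x y)) (weight x) h in contradiction (subst (_≤ weight y) (ℕ.suc-injective (trans q (sym p))) (common≤ʳ x y)) ℕ.1+n≰n)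
  (sum-below x (ψ ∘ (false ∷_)))) (trans (ℤ.+-identityˡ _) (sym (down-false ψ x)))

sum-adjacent : ∀ (x : Vec Bool n) (ψ : Fun n) → cubeSum (λ y → when (adjacent-ind x y) (ψ y)) ≡ adj ψ x
sum-adjacent []          ψ = refl
sum-adjacent (true ∷ x)  ψ = trans (cong₂ _+ᶻ_ (sum-adjacent x (ψ ∘ (true ∷_))) (sum-above x (ψ ∘ (false ∷_))))
  (trans (ℤ.+-comm (adj (ψ ∘ (true ∷_)) x) (up (ψ ∘ (false ∷_)) x)) (sym (adj-true ψ x)))
sum-adjacent (false ∷ x) ψ = trans (cong₂ _+ᶻ_ (sum-below x (ψ ∘ (true ∷_))) (sum-adjacent x (ψ ∘ (false ∷_)))) (sym (adj-false ψ x))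

module _ {n w : ℕ} (f : Vertex n w → Bool) where

  -- The value false off the slice lets sums over the slice be taken over the whole cube.
  total-extension : Vec Bool n → Bool
  total-extension y with weight y ≟ w
  ... | yes e = f (y , e)
  ... | no _  = false

  total-extension-vertex : ∀ x → total-extension (proj₁ x) ≡ f x
  total-extension-vertex (x , e) with weight x ≟ w
  ... | yes e′ = cong (λ p → f (x , p)) (ℕ.≡-irrelevant e′ e)
  ... | no ne  = contradiction e ne

  total-extension-off : ∀ y → weight y ≢ w → total-extension y ≡ false
  total-extension-off y ne with weight y ≟ w
  ... | yes e = contradiction e ne
  ... | no _  = refl

selects : Fin 2 → Bool → Bool
selects zero       b = b
selects (suc zero) b = not b

-- The enumerating function local to the definition of vertices, recovered by unification.
vertices-mapMaybe : ∀ n w → Σ (Vec Bool n → Maybe (Vertex n w)) λ pick → vertices n w ≡ mapMaybe pick (allVecs n)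
vertices-mapMaybe n w = _ , refl

-- The weight is a successor, so the truncated `w ∸ 1` in `adjᵇ` becomes the condition that common
-- ones plus one equal the weight, as in `adjacent-ind`.
neighbours : ∀ {n w} (f : Vertex n (suc w) → Bool) j x → pos (nbrsIn f j x) ≡ adj (β ∘ selects j ∘ total-extension f) (proj₁ x)
neighbours {n} {w} f j x@(xv , ex) = trans (count-mapMaybe P pick (allVecs n))
  (trans (listSum-allVecs n _) (trans (cubeSum-cong term) (sum-adjacent xv ψ)))
  where
  P : Vertex n (suc w) → Bool
  P y = adjᵇ x y ∧ sameFin2 (cell f y) j
  pick : Vec Bool n → Maybe (Vertex n (suc w))
  pick = proj₁ (vertices-mapMaybe n (suc w))
  ψ : Fun n
  ψ = β ∘ selects j ∘ total-extension f
  select-cell : ∀ j b → sameFin2 (if b then zero else suc zero) j ≡ selects j b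
  select-cell zero       true  = refl
  select-cell zero       false = refl
  select-cell (suc zero) true  = refl
  select-cell (suc zero) false = refl
  β-∧ : ∀ a b → β (a ∧ b) ≡ when a (β b)
  β-∧ true  b = refl
  β-∧ false b = refl
  term : ∀ y → maybe′ (β ∘ P) 0ℤ (pick y) ≡ when (adjacent-ind xv y) (ψ y)
  term y with weight y ≟ suc w
  ... | yes e = trans (β-∧ (common xv y ≡ᵇ w) (sameFin2 (cell f (y , e)) j)) (cong₂ when
          (trans (cong (λ z → suc (common xv y) ≡ᵇ z) (sym ex)) (cong (_∧ (suc (common xv y) ≡ᵇ weight xv)) (sym (≡ᵇ-complete (weight y) (weight xv) (trans e (sym ex))))))
          (cong β (select-cell j (f (y , e)))))
  ... | no ne = sym (when-absurd (adjacent-ind xv y) λ h → contradiction (trans (proj₁ (∧-≡ᵇ (weight y) (weight xv) (suc (common xv y)) (weight xv) h)) ex) ne)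

-- The quotient matrix

-- Both rows sum to W², so subtracting the eigenvector equations gives (W² - b - c - λ₂)(v₀ - v₁) =
-- 0, and W² - λ₂ = 4W - 2.
trace-identity : ∀ W a b c d v₀ v₁ → a +ᶻ b ≡ W *ᶻ W → c +ᶻ d ≡ W *ᶻ W →
  a *ᶻ v₀ +ᶻ b *ᶻ v₁ ≡ ((W -ᶻ pos 2) *ᶻ (W -ᶻ pos 2) -ᶻ pos 2) *ᶻ v₀ →
  c *ᶻ v₀ +ᶻ d *ᶻ v₁ ≡ ((W -ᶻ pos 2) *ᶻ (W -ᶻ pos 2) -ᶻ pos 2) *ᶻ v₁ →
  ((pos 4 *ᶻ W -ᶻ pos 2) -ᶻ (b +ᶻ c)) *ᶻ (v₀ -ᶻ v₁) ≡ 0ℤ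
trace-identity W a b c d v₀ v₁ h₁ h₂ h₃ h₄ = trans (ring W a b c d v₀ v₁)
  (trans (cong₂ (λ x y → (x -ᶻ y) -ᶻ ((a +ᶻ b) -ᶻ W *ᶻ W) *ᶻ v₀ +ᶻ ((c +ᶻ d) -ᶻ W *ᶻ W) *ᶻ v₁) (ℤ.i≡j⇒i-j≡0 h₃) (ℤ.i≡j⇒i-j≡0 h₄))
    (trans (cong₂ (λ x y → (0ℤ -ᶻ 0ℤ) -ᶻ x *ᶻ v₀ +ᶻ y *ᶻ v₁) (ℤ.i≡j⇒i-j≡0 h₁) (ℤ.i≡j⇒i-j≡0 h₂)) (ring₀ v₀ v₁)))
  where
  ring : ∀ W a b c d v₀ v₁ → ((pos 4 *ᶻ W -ᶻ pos 2) -ᶻ (b +ᶻ c)) *ᶻ (v₀ -ᶻ v₁) ≡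
    (((a *ᶻ v₀ +ᶻ b *ᶻ v₁) -ᶻ ((W -ᶻ pos 2) *ᶻ (W -ᶻ pos 2) -ᶻ pos 2) *ᶻ v₀) -ᶻ
     ((c *ᶻ v₀ +ᶻ d *ᶻ v₁) -ᶻ ((W -ᶻ pos 2) *ᶻ (W -ᶻ pos 2) -ᶻ pos 2) *ᶻ v₁))
    -ᶻ ((a +ᶻ b) -ᶻ W *ᶻ W) *ᶻ v₀ +ᶻ ((c +ᶻ d) -ᶻ W *ᶻ W) *ᶻ v₁
  ring = solve-∀
  ring₀ : ∀ v₀ v₁ → (0ℤ -ᶻ 0ℤ) -ᶻ 0ℤ *ᶻ v₀ +ᶻ 0ℤ *ᶻ v₁ ≡ 0ℤ
  ring₀ = solve-∀

-- Disposes of v₀ = v₁: a constant vector belongs to the eigenvalue W², which differs from λ₂ by 4W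
-- - 2.
constant-eigenvector : ∀ W a b v → a +ᶻ b ≡ W *ᶻ W → a *ᶻ v +ᶻ b *ᶻ v ≡ ((W -ᶻ pos 2) *ᶻ (W -ᶻ pos 2) -ᶻ pos 2) *ᶻ v →
  (pos 4 *ᶻ W -ᶻ pos 2) *ᶻ v ≡ 0ℤ
constant-eigenvector W a b v h₁ h₂ = trans (ring W a b v)
  (trans (cong₂ (λ x y → x -ᶻ y *ᶻ v) (ℤ.i≡j⇒i-j≡0 h₂) (ℤ.i≡j⇒i-j≡0 h₁)) (ring₀ v))
  where
  ring : ∀ W a b v → (pos 4 *ᶻ W -ᶻ pos 2) *ᶻ v ≡
    ((a *ᶻ v +ᶻ b *ᶻ v) -ᶻ ((W -ᶻ pos 2) *ᶻ (W -ᶻ pos 2) -ᶻ pos 2) *ᶻ v) -ᶻ ((a +ᶻ b) -ᶻ W *ᶻ W) *ᶻ v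
  ring = solve-∀
  ring₀ : ∀ v → 0ℤ -ᶻ 0ℤ *ᶻ v ≡ 0ℤ
  ring₀ = solve-∀

4w-2≢0 : ∀ w → pos 4 *ᶻ pos (suc w) -ᶻ pos 2 ≢ 0ℤ
4w-2≢0 w h = case ℤ.+-injective (trans (ℤ.pos-* 4 (suc w)) (ℤ.i-j≡0⇒i≡j (pos 4 *ᶻ pos (suc w)) (pos 2) h)) of λ e →
  contradiction (subst (4 ≤_) e (ℕ.m≤m*n 4 (suc w))) λ { (s≤s (s≤s ())) }

β-not : ∀ b → β (not b) ≡ 1ℤ -ᶻ β b
β-not true  = refl
β-not false = refl

module Equitable {n w₀ : ℕ} (n≡2w : n ≡ suc w₀ + suc w₀) (f : Vertex n (suc w₀) → Bool) (S : Fin 2 → Fin 2 → ℕ)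
  (equitable : IsEquitable2 f S) (eigenvalue : IsEigenvalue2 S (eigJ n (suc w₀) 2)) where

  w : ℕ
  w = suc w₀

  W : ℤ
  W = pos w

  F : Vec Bool n → Bool
  F = total-extension f

  a b c d : ℕ
  a = S zero zero
  b = S zero (suc zero)
  c = S (suc zero) zero
  d = S (suc zero) (suc zero)

  nonconstant : NonConstant w F
  nonconstant = let (x , h) , (x′ , h′) , _ = equitable in
    (proj₁ x , proj₂ x , trans (total-extension-vertex f x) h) , (proj₁ x′ , proj₂ x′ , trans (total-extension-vertex f x′) h′)

  count : ∀ x → weight x ≡ w → ∀ j → adj (β ∘ selects j ∘ F) x ≡ pos (S (if F x then zero else suc zero) j)
  count x e j = trans (sym (neighbours f j (x , e))) (cong pos (trans (proj₂ (proj₂ equitable) (x , e) j)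
    (cong (λ q → S (if q then zero else suc zero) j) (sym (total-extension-vertex f (x , e))))))

  degree : ∀ x → weight x ≡ w → adj (β ∘ F) x +ᶻ adj (β ∘ not ∘ F) x ≡ W *ᶻ W
  degree x e = trans (cong (adj (β ∘ F) x +ᶻ_) (trans (adj-cong-local (β ∘ not ∘ F) (λ y → 1ℤ -ᶻ β (F y)) x (λ i j _ _ → β-not (F (move i j x))))
      (adj-sub (λ _ → 1ℤ) (β ∘ F) x)))
    (trans (ring (adj (β ∘ F) x) (adj (λ _ → 1ℤ) x)) (trans (adj-const 1ℤ x) (trans (ℤ.*-identityʳ (wt x *ᶻ wt̄ x))
      (cong₂ (λ p q → pos p *ᶻ pos q) e (ℕ.+-cancelˡ-≡ w _ _ (trans (cong (_+ weight (compl x)) (sym e)) (trans (weight-compl x) n≡2w)))))))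
    where
    ring : ∀ p q → p +ᶻ (q -ᶻ p) ≡ q
    ring = solve-∀

  row : ∀ x → weight x ≡ w → ∀ q → F x ≡ q → pos (S (if q then zero else suc zero) zero) +ᶻ pos (S (if q then zero else suc zero) (suc zero)) ≡ W *ᶻ W
  row x e q refl = trans (cong₂ _+ᶻ_ (sym (count x e zero)) (sym (count x e (suc zero)))) (degree x e)

  row₀ : pos a +ᶻ pos b ≡ W *ᶻ W
  row₀ = let (x , e , h) , _ = nonconstant in row x e true h

  row₁ : pos c +ᶻ pos d ≡ W *ᶻ W
  row₁ = let _ , (x , e , h) = nonconstant in row x e false h

  eigJ≡λ₂ : eigJ n w 2 ≡ λ₂ w
  eigJ≡λ₂ = trans (cong (λ m → (W -ᶻ pos 2) *ᶻ ((pos m -ᶻ W) -ᶻ pos 2) -ᶻ pos 2) n≡2w) (ring W)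
    where
    ring : ∀ W → (W -ᶻ pos 2) *ᶻ (((W +ᶻ W) -ᶻ W) -ᶻ pos 2) -ᶻ pos 2 ≡ (W -ᶻ pos 2) *ᶻ (W -ᶻ pos 2) -ᶻ pos 2
    ring = solve-∀

  trace : pos b +ᶻ pos c ≡ pos 4 *ᶻ W -ᶻ pos 2
  trace = go eigenvalue
    where
    go : IsEigenvalue2 S (eigJ n w 2) → pos b +ᶻ pos c ≡ pos 4 *ᶻ W -ᶻ pos 2
    go (v , v≢0 , eq) = case ℤ.i*j≡0⇒i≡0∨j≡0 ((pos 4 *ᶻ W -ᶻ pos 2) -ᶻ (pos b +ᶻ pos c)) (trace-identity W (pos a) (pos b) (pos c) (pos d) v₀ v₁ row₀ row₁ eq₀ eq₁) of λ
        { (inj₁ z) → sym (ℤ.i-j≡0⇒i≡j (pos 4 *ᶻ W -ᶻ pos 2) (pos b +ᶻ pos c) z)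
        ; (inj₂ z) → contradiction (vanish (ℤ.i-j≡0⇒i≡j v₀ v₁ z)) v≢0 }
      where
      v₀ v₁ : ℤ
      v₀ = v zero
      v₁ = v (suc zero)
      eq₀ : pos a *ᶻ v₀ +ᶻ pos b *ᶻ v₁ ≡ λ₂ w *ᶻ v₀
      eq₀ = trans (eq zero) (cong (_*ᶻ v₀) eigJ≡λ₂)
      eq₁ : pos c *ᶻ v₀ +ᶻ pos d *ᶻ v₁ ≡ λ₂ w *ᶻ v₁
      eq₁ = trans (eq (suc zero)) (cong (_*ᶻ v₁) eigJ≡λ₂)
      vanish : v₀ ≡ v₁ → ∀ i → v i ≡ 0ℤ
      vanish e = λ { zero → v₀≡0 ; (suc zero) → trans (sym e) v₀≡0 }
        where
        v₀≡0 : v₀ ≡ 0ℤ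
        v₀≡0 = case ℤ.i*j≡0⇒i≡0∨j≡0 (pos 4 *ᶻ W -ᶻ pos 2) (constant-eigenvector W (pos a) (pos b) v₀ row₀ (trans (cong (λ z → pos a *ᶻ v₀ +ᶻ pos b *ᶻ z) e) eq₀)) of λ
          { (inj₁ z) → contradiction z (4w-2≢0 w₀) ; (inj₂ z) → z }

  -- A vertex has a or c neighbours in the first cell, and a - c = w² - (b + c) = λ₂, so both counts
  -- are λ₂ times the characteristic value plus c.
  is-eigenfunction : Eigen w (λ₂ w) (pos c) (β ∘ F)
  is-eigenfunction .Eigen.at x e = trans (count x e zero) (by-cell (F x))
    where
    in-first : ∀ W a b c → a +ᶻ b ≡ W *ᶻ W → b +ᶻ c ≡ pos 4 *ᶻ W -ᶻ pos 2 → a ≡ ((W -ᶻ pos 2) *ᶻ (W -ᶻ pos 2) -ᶻ pos 2) *ᶻ 1ℤ +ᶻ c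
    in-first W a b c h₁ h₂ = trans (ring₁ a b c) (trans (cong₂ (λ x y → (x -ᶻ y) +ᶻ c) h₁ h₂) (ring₂ W c))
      where
      ring₁ : ∀ a b c → a ≡ ((a +ᶻ b) -ᶻ (b +ᶻ c)) +ᶻ c
      ring₁ = solve-∀
      ring₂ : ∀ W c → (W *ᶻ W -ᶻ (pos 4 *ᶻ W -ᶻ pos 2)) +ᶻ c ≡ ((W -ᶻ pos 2) *ᶻ (W -ᶻ pos 2) -ᶻ pos 2) *ᶻ 1ℤ +ᶻ c
      ring₂ = solve-∀
    in-second : ∀ μ c → c ≡ μ *ᶻ 0ℤ +ᶻ c
    in-second = solve-∀
    by-cell : ∀ q → pos (S (if q then zero else suc zero) zero) ≡ λ₂ w *ᶻ β q +ᶻ pos c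
    by-cell true  = in-first W (pos a) (pos b) (pos c) row₀ trace
    by-cell false = in-second (λ₂ w) (pos c)

-- The four model functions and equivalence of partitions

front₅ : Vec Bool (5 + n) → Vec Bool 5
front₅ (a ∷ b ∷ c ∷ d ∷ e ∷ _) = a ∷ b ∷ c ∷ d ∷ e ∷ []

model : Kind → Bool → Vec Bool (5 + n) → Bool
model κ s x = s xor target κ (front₅ x)

modelled : ∀ {w} {F : Vec Bool (5 + m) → Bool} → Classified w F →
  ∃₂ λ κ s → Σ (Permutation′ (5 + m)) λ ρ → ∀ x → weight x ≡ w → F (act ρ x) ≡ model κ s x
modelled {m} {w} {F} (κ , s , p , uniq , h) = go (front p uniq)
  where
  go : (Σ (Permutation′ (5 + m)) λ π → ∀ i → π ⟨$⟩ʳ (i ↑ˡ m) ≡ lookup p i) →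
    ∃₂ λ κ s → Σ (Permutation′ (5 + m)) λ ρ → ∀ x → weight x ≡ w → F (act ρ x) ≡ model κ s x
  go (π , πp) = κ , s , Perm.flip π , λ x e →
    trans (h (act (Perm.flip π) x) (trans (weight-act (Perm.flip π) x) e)) (cong (λ t → s xor target κ t) (bits x))
    where
    bits : ∀ x → map (lookup (act (Perm.flip π) x)) p ≡ front₅ x
    bits x@(a ∷ b ∷ c ∷ d ∷ e ∷ v) = lookup-ext λ i → trans (Vec.lookup-map i (lookup (act (Perm.flip π) x)) p)
      (trans (lookup-act (Perm.flip π) x (lookup p i)) (trans (cong (lookup x) (trans (cong (π ⟨$⟩ˡ_) (sym (πp i))) (Perm.inverseˡ π)))
        (Vec.lookup-++ˡ (a ∷ b ∷ c ∷ d ∷ e ∷ []) v i)))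

-- Transports the equation, with the same c, to an explicit function, where c can be read off at a
-- single vertex.
model-eigen : ∀ {w μ c} {F : Vec Bool (5 + m) → Bool} → Eigen w μ c (β ∘ F) → Classified w F → ∃₂ λ κ s → Eigen w μ c (β ∘ model {m} κ s)
model-eigen {m} {w} {μ} {c} {F} eig cl = go (modelled cl)
  where
  go : (∃₂ λ κ s → Σ (Permutation′ (5 + m)) λ ρ → ∀ x → weight x ≡ w → F (act ρ x) ≡ model κ s x) → ∃₂ λ κ s → Eigen w μ c (β ∘ model {m} κ s)
  go (κ , s , ρ , h) = κ , s , eigen at-x
    where
    at-x : ∀ x → weight x ≡ w → adj (β ∘ model κ s) x ≡ μ *ᶻ β (model κ s x) +ᶻ c
    at-x x e = begin
      adj (β ∘ model κ s) x              ≡⟨ adj-cong {φ = β ∘ F ∘ act ρ} {β ∘ model κ s} w (λ y ey → cong β (h y ey)) x e ⟨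
      adj (β ∘ F ∘ act ρ) x              ≡⟨ Eigen.at (eigen-act ρ eig) x e ⟩
      μ *ᶻ β (F (act ρ x)) +ᶻ c          ≡⟨ cong (λ q → μ *ᶻ β q +ᶻ c) (h x e) ⟩
      μ *ᶻ β (model κ s x) +ᶻ c          ∎
      where open ≡-Reasoning

partition : ∀ {n w} → Kind → Vertex n w → Bool
partition I   = D1-i
partition II  = D1-ii
partition III = D1-iii
partition IV  = D1-iv

partition-target : ∀ κ {w} (x : Vertex (5 + n) w) → partition κ x ≡ target κ (front₅ (proj₁ x))
partition-target I   ((a ∷ b ∷ c ∷ d ∷ e ∷ v) , _) =
  -- The list and the formula are compared on all 32 patterns by evaluation.
  not-xor _ _ (allBits-sound 5 (λ t → not (memb t B1 xor target I t)) refl (a ∷ b ∷ c ∷ d ∷ e ∷ []))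
partition-target II  ((a ∷ b ∷ c ∷ d ∷ e ∷ v) , _) = Bool.∧-identityʳ _
partition-target III ((a ∷ b ∷ c ∷ d ∷ e ∷ v) , _) =
  not-xor _ _ (allBits-sound 5 (λ t → not (memb t B3 xor target III t)) refl (a ∷ b ∷ c ∷ d ∷ e ∷ []))
partition-target IV  ((a ∷ b ∷ c ∷ d ∷ e ∷ v) , _) = iv a b c
  where
  iv : ∀ a b c → memb (a ∷ b ∷ c ∷ []) ((false ∷ false ∷ false ∷ []) ∷ (true ∷ true ∷ true ∷ []) ∷ []) ≡ not (a xor b) ∧ not (b xor c)
  iv false false false = refl
  iv false false true  = refl
  iv false true  false = refl
  iv false true  true  = refl
  iv true  false false = refl
  iv true  false true  = refl
  iv true  true  false = refl
  iv true  true  true  = refl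

classified-equivalent : ∀ {w} (f : Vertex (5 + m) w → Bool) → Classified w (total-extension f) → ∃ λ κ → PartEquiv f (partition κ)
classified-equivalent {m} {w} f cl = go (modelled cl)
  where
  go : (∃₂ λ κ s → Σ (Permutation′ (5 + m)) λ ρ → ∀ x → weight x ≡ w → total-extension f (act ρ x) ≡ model κ s x) → ∃ λ κ → PartEquiv f (partition κ)
  go (κ , s , ρ , h) = κ , by-sign s λ x y pointwise → trans (sym (h (proj₁ x) (proj₂ x)))
      (trans (cong (total-extension f) (lookup-ext {x = act ρ (proj₁ x)} {proj₁ y} λ i → trans (lookup-act ρ (proj₁ x) i) (sym (pointwise i)))) (total-extension-vertex f y))
    where
    by-sign : ∀ s → (∀ (x y : Vertex (5 + m) w) → (∀ i → lookup (proj₁ y) i ≡ lookup (proj₁ x) (ρ ⟨$⟩ʳ i)) → model κ s (proj₁ x) ≡ f y) → PartEquiv f (partition κ)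
    by-sign false h = inj₁ (ρ , λ x y e → trans (partition-target κ x) (h x y e))
    by-sign true  h = inj₂ (ρ , λ x y e → trans (cong not (partition-target κ x)) (h x y e))

-- Double counting in J(8,4)

cubeSum-add : ∀ {n} (φ ψ : Fun n) → cubeSum (λ x → φ x +ᶻ ψ x) ≡ cubeSum φ +ᶻ cubeSum ψ
cubeSum-add {zero}  φ ψ = refl
cubeSum-add {suc n} φ ψ = trans (cong₂ _+ᶻ_ (cubeSum-add (φ ∘ (true ∷_)) (ψ ∘ (true ∷_))) (cubeSum-add (φ ∘ (false ∷_)) (ψ ∘ (false ∷_))))
  (ring (cubeSum (φ ∘ (true ∷_))) (cubeSum (ψ ∘ (true ∷_))) (cubeSum (φ ∘ (false ∷_))) (cubeSum (ψ ∘ (false ∷_))))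
  where
  ring : ∀ a b c d → (a +ᶻ b) +ᶻ (c +ᶻ d) ≡ (a +ᶻ c) +ᶻ (b +ᶻ d)
  ring = solve-∀

cubeSum-scale : ∀ {n} κ (φ : Fun n) → cubeSum (λ x → κ *ᶻ φ x) ≡ κ *ᶻ cubeSum φ
cubeSum-scale {zero}  κ φ = refl
cubeSum-scale {suc n} κ φ = trans (cong₂ _+ᶻ_ (cubeSum-scale κ (φ ∘ (true ∷_))) (cubeSum-scale κ (φ ∘ (false ∷_)))) (sym (ℤ.*-distribˡ-+ κ _ _))

cubeSum-compl : ∀ {n} (φ : Fun n) → cubeSum (φ ∘ compl) ≡ cubeSum φ
cubeSum-compl {zero}  φ = refl
cubeSum-compl {suc n} φ = trans (cong₂ _+ᶻ_ (cubeSum-compl (φ ∘ (false ∷_))) (cubeSum-compl (φ ∘ (true ∷_)))) (ℤ.+-comm (cubeSum (φ ∘ (false ∷_))) (cubeSum (φ ∘ (true ∷_))))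

cubeSum-nonneg : ∀ {n} (φ : Fun n) → (∀ x → 0ℤ ≤ᶻ φ x) → 0ℤ ≤ᶻ cubeSum φ
cubeSum-nonneg {zero}  φ h = h []
cubeSum-nonneg {suc n} φ h = ℤ.+-mono-≤ (cubeSum-nonneg _ (h ∘ (true ∷_))) (cubeSum-nonneg _ (h ∘ (false ∷_)))

term≤cubeSum : ∀ {n} (φ : Fun n) → (∀ x → 0ℤ ≤ᶻ φ x) → ∀ x → φ x ≤ᶻ cubeSum φ
term≤cubeSum {zero}  φ h []          = ℤ.≤-refl
term≤cubeSum {suc n} φ h (true ∷ x)  = subst (_≤ᶻ cubeSum φ) (ℤ.+-identityʳ _)
  (ℤ.+-mono-≤ (term≤cubeSum (φ ∘ (true ∷_)) (h ∘ (true ∷_)) x) (cubeSum-nonneg (φ ∘ (false ∷_)) (h ∘ (false ∷_))))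
term≤cubeSum {suc n} φ h (false ∷ x) = subst (_≤ᶻ cubeSum φ) (ℤ.+-identityˡ _)
  (ℤ.+-mono-≤ (cubeSum-nonneg (φ ∘ (true ∷_)) (h ∘ (true ∷_))) (term≤cubeSum (φ ∘ (false ∷_)) (h ∘ (false ∷_)) x))

cubeSum-up : ∀ {n} (φ : Fun n) → cubeSum (up φ) ≡ cubeSum (λ y → wt y *ᶻ φ y)
cubeSum-up {zero}  φ = refl
cubeSum-up {suc n} φ = begin
  cubeSum (λ x → up φ (true ∷ x)) +ᶻ cubeSum (λ x → φ (true ∷ x) +ᶻ up φf x)
    ≡⟨ cong₂ _+ᶻ_ (trans (cubeSum-cong (up-true φ)) (cubeSum-up φt)) (trans (cubeSum-add φt (up φf)) (cong (cubeSum φt +ᶻ_) (cubeSum-up φf))) ⟩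
  cubeSum (λ y → wt y *ᶻ φt y) +ᶻ (cubeSum φt +ᶻ cubeSum (λ y → wt y *ᶻ φf y))
    ≡⟨ ring (cubeSum (λ y → wt y *ᶻ φt y)) (cubeSum φt) (cubeSum (λ y → wt y *ᶻ φf y)) ⟩
  (cubeSum φt +ᶻ cubeSum (λ y → wt y *ᶻ φt y)) +ᶻ cubeSum (λ y → wt y *ᶻ φf y)
    ≡⟨ cong (_+ᶻ cubeSum (λ y → wt y *ᶻ φf y)) (trans (sym (cubeSum-add φt (λ y → wt y *ᶻ φt y))) (cubeSum-cong λ y → ring′ (wt y) (φt y))) ⟩
  cubeSum (λ y → wt (true ∷ y) *ᶻ φt y) +ᶻ cubeSum (λ y → wt y *ᶻ φf y) ∎
  where
  open ≡-Reasoning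
  φt φf : Fun n
  φt = φ ∘ (true ∷_)
  φf = φ ∘ (false ∷_)
  ring : ∀ a b c → a +ᶻ (b +ᶻ c) ≡ (b +ᶻ a) +ᶻ c
  ring = solve-∀
  ring′ : ∀ w z → z +ᶻ w *ᶻ z ≡ (1ℤ +ᶻ w) *ᶻ z
  ring′ = solve-∀

cubeSum-down : ∀ {n} (φ : Fun n) → cubeSum (down φ) ≡ cubeSum (λ y → wt̄ y *ᶻ φ y)
cubeSum-down {zero}  φ = refl
cubeSum-down {suc n} φ = begin
  cubeSum (λ x → φ (false ∷ x) +ᶻ down φt x) +ᶻ cubeSum (λ x → down φ (false ∷ x))
    ≡⟨ cong₂ _+ᶻ_ (trans (cubeSum-add φf (down φt)) (cong (cubeSum φf +ᶻ_) (cubeSum-down φt))) (trans (cubeSum-cong (down-false φ)) (cubeSum-down φf)) ⟩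
  (cubeSum φf +ᶻ cubeSum (λ y → wt̄ y *ᶻ φt y)) +ᶻ cubeSum (λ y → wt̄ y *ᶻ φf y)
    ≡⟨ ring (cubeSum (λ y → wt̄ y *ᶻ φf y)) (cubeSum φf) (cubeSum (λ y → wt̄ y *ᶻ φt y)) ⟩
  cubeSum (λ y → wt̄ y *ᶻ φt y) +ᶻ (cubeSum φf +ᶻ cubeSum (λ y → wt̄ y *ᶻ φf y))
    ≡⟨ cong (cubeSum (λ y → wt̄ y *ᶻ φt y) +ᶻ_) (trans (sym (cubeSum-add φf (λ y → wt̄ y *ᶻ φf y))) (cubeSum-cong λ y → ring′ (wt̄ y) (φf y))) ⟩
  cubeSum (λ y → wt̄ y *ᶻ φt y) +ᶻ cubeSum (λ y → wt̄ (false ∷ y) *ᶻ φf y) ∎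
  where
  open ≡-Reasoning
  φt φf : Fun n
  φt = φ ∘ (true ∷_)
  φf = φ ∘ (false ∷_)
  ring : ∀ a b c → (b +ᶻ c) +ᶻ a ≡ c +ᶻ (b +ᶻ a)
  ring = solve-∀
  ring′ : ∀ w z → z +ᶻ w *ᶻ z ≡ (1ℤ +ᶻ w) *ᶻ z
  ring′ = solve-∀

-- Double counting: a value φ y enters once for each Johnson neighbour of y, and there are wt y ·
-- wt̄ y of them. In the same way `up` reaches y from wt y vectors and `down` from wt̄ y.
cubeSum-adj : ∀ {n} (φ : Fun n) → cubeSum (adj φ) ≡ cubeSum (λ y → (wt y *ᶻ wt̄ y) *ᶻ φ y)
cubeSum-adj {zero}  φ = refl
cubeSum-adj {suc n} φ = begin
  cubeSum (λ x → adj φ (true ∷ x)) +ᶻ cubeSum (λ x → adj φ (false ∷ x))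
    ≡⟨ cong₂ _+ᶻ_ (trans (cubeSum-cong (adj-true φ)) (trans (cubeSum-add (up φf) (adj φt)) (cong₂ _+ᶻ_ (cubeSum-up φf) (cubeSum-adj φt))))
                  (trans (cubeSum-cong (adj-false φ)) (trans (cubeSum-add (down φt) (adj φf)) (cong₂ _+ᶻ_ (cubeSum-down φt) (cubeSum-adj φf)))) ⟩
  (cubeSum p +ᶻ cubeSum q) +ᶻ (cubeSum r +ᶻ cubeSum s)
    ≡⟨ ring (cubeSum p) (cubeSum q) (cubeSum r) (cubeSum s) ⟩
  (cubeSum q +ᶻ cubeSum r) +ᶻ (cubeSum s +ᶻ cubeSum p)
    ≡⟨ cong₂ _+ᶻ_ (trans (sym (cubeSum-add q r)) (cubeSum-cong λ y → ringt (wt y) (wt̄ y) (φt y)))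
                  (trans (sym (cubeSum-add s p)) (cubeSum-cong λ y → ringf (wt y) (wt̄ y) (φf y))) ⟩
  cubeSum (λ y → (wt (true ∷ y) *ᶻ wt̄ (true ∷ y)) *ᶻ φt y) +ᶻ cubeSum (λ y → (wt (false ∷ y) *ᶻ wt̄ (false ∷ y)) *ᶻ φf y) ∎
  where
  open ≡-Reasoning
  φt φf p q r s : Fun n
  φt = φ ∘ (true ∷_)
  φf = φ ∘ (false ∷_)
  p y = wt y *ᶻ φf y
  q y = (wt y *ᶻ wt̄ y) *ᶻ φt y
  r y = wt̄ y *ᶻ φt y
  s y = (wt y *ᶻ wt̄ y) *ᶻ φf y
  ring : ∀ p q r s → (p +ᶻ q) +ᶻ (r +ᶻ s) ≡ (q +ᶻ r) +ᶻ (s +ᶻ p)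
  ring = solve-∀
  ringt : ∀ w z v → (w *ᶻ z) *ᶻ v +ᶻ z *ᶻ v ≡ ((1ℤ +ᶻ w) *ᶻ z) *ᶻ v
  ringt = solve-∀
  ringf : ∀ w z v → (w *ᶻ z) *ᶻ v +ᶻ w *ᶻ v ≡ (w *ᶻ (1ℤ +ᶻ z)) *ᶻ v
  ringf = solve-∀

β≥0 : ∀ b → 0ℤ ≤ᶻ β b
β≥0 true  = +≤+ z≤n
β≥0 false = ℤ.≤-refl

slice₄ : Fun 8
slice₄ y = β (weight y ≡ᵇ 4)

slice₄-size : cubeSum slice₄ ≡ pos 70
slice₄-size = refl

-- The first cell has 5c vertices and is closed under complementation, so c is even.
module Four {c : ℕ} {F : Vec Bool 8 → Bool} (off : ∀ y → weight y ≢ 4 → F y ≡ false)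
  (eig : Eigen 4 (pos 2) (pos c) (β ∘ F)) (nonconst : NonConstant 4 F) where

  open Quadratic {4} {2} {4} refl refl {pos c}

  private
    X : ℤ
    X = cubeSum (β ∘ F)

  -- Off the slice both sides vanish with F, so the eigenvalue equation can be summed over the cube.
  adj-everywhere : ∀ y → adj (β ∘ F) y ≡ pos 2 *ᶻ β (F y) +ᶻ pos c *ᶻ slice₄ y
  adj-everywhere y with weight y ≟ 4
  ... | yes e = trans (Eigen.at eig y e) (cong (pos 2 *ᶻ β (F y) +ᶻ_) (trans (sym (ℤ.*-identityʳ (pos c))) (cong (λ b → pos c *ᶻ β b) (sym (≡ᵇ-complete (weight y) 4 e)))))
  ... | no ne = trans (adj-cong-local (β ∘ F) (λ _ → 0ℤ) y (λ i j p q → cong β (off (move i j y) (ne ∘ trans (sym (weight-move y i j p q))))))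
                  (trans (adj-const 0ℤ y) (trans (ℤ.*-zeroʳ (wt y *ᶻ wt̄ y)) (sym (trans (cong₂ (λ p q → pos 2 *ᶻ β p +ᶻ pos c *ᶻ β q) (off y ne) not-slice) (trans (ℤ.+-identityˡ (pos c *ᶻ 0ℤ)) (ℤ.*-zeroʳ (pos c)))))))
    where
    not-slice : (weight y ≡ᵇ 4) ≡ false
    not-slice with weight y ≡ᵇ 4 in eq
    ... | true  = contradiction (≡ᵇ-true (weight y) 4 eq) ne
    ... | false = refl

  degree-everywhere : ∀ y → (wt y *ᶻ wt̄ y) *ᶻ β (F y) ≡ pos 16 *ᶻ β (F y)
  degree-everywhere y with weight y ≟ 4
  ... | yes e = cong₂ (λ p q → (pos p *ᶻ pos q) *ᶻ β (F y)) e (weight-compl-w y e)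
  ... | no ne = trans (cong (λ b → (wt y *ᶻ wt̄ y) *ᶻ β b) (off y ne)) (trans (ℤ.*-zeroʳ (wt y *ᶻ wt̄ y)) (cong (λ b → pos 16 *ᶻ β b) (sym (off y ne))))

  -- With 70 vertices of valency 16, summing the equation gives 16X = 2X + 70c.
  cell-size : X ≡ pos 5 *ᶻ pos c
  cell-size = ℤ.*-cancelˡ-≡ (pos 14) X (pos 5 *ᶻ pos c) (solve-X X (pos c) (begin
    pos 16 *ᶻ X                                                  ≡⟨ cubeSum-scale (pos 16) (β ∘ F) ⟨
    cubeSum (λ y → pos 16 *ᶻ β (F y))                            ≡⟨ cubeSum-cong degree-everywhere ⟨
    cubeSum (λ y → (wt y *ᶻ wt̄ y) *ᶻ β (F y))                    ≡⟨ cubeSum-adj (β ∘ F) ⟨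
    cubeSum (adj (β ∘ F))                                        ≡⟨ cubeSum-cong adj-everywhere ⟩
    cubeSum (λ y → pos 2 *ᶻ β (F y) +ᶻ pos c *ᶻ slice₄ y)        ≡⟨ cubeSum-add (λ y → pos 2 *ᶻ β (F y)) (λ y → pos c *ᶻ slice₄ y) ⟩
    cubeSum (λ y → pos 2 *ᶻ β (F y)) +ᶻ cubeSum (λ y → pos c *ᶻ slice₄ y)
      ≡⟨ cong₂ _+ᶻ_ (cubeSum-scale (pos 2) (β ∘ F)) (trans (cubeSum-scale (pos c) slice₄) (cong (pos c *ᶻ_) slice₄-size)) ⟩
    pos 2 *ᶻ X +ᶻ pos c *ᶻ pos 70                                ∎))
    where
    open ≡-Reasoning
    solve-X : ∀ X c → pos 16 *ᶻ X ≡ pos 2 *ᶻ X +ᶻ c *ᶻ pos 70 → pos 14 *ᶻ X ≡ pos 14 *ᶻ (pos 5 *ᶻ c)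
    solve-X X c h = trans (ring₁ X) (trans (cong (_-ᶻ pos 2 *ᶻ X) h) (ring₂ X c))
      where
      ring₁ : ∀ X → pos 14 *ᶻ X ≡ pos 16 *ᶻ X -ᶻ pos 2 *ᶻ X
      ring₁ = solve-∀
      ring₂ : ∀ X c → (pos 2 *ᶻ X +ᶻ c *ᶻ pos 70) -ᶻ pos 2 *ᶻ X ≡ pos 14 *ᶻ (pos 5 *ᶻ c)
      ring₂ = solve-∀

  even-everywhere : ∀ y → β (F y) ≡ β (F (compl y))
  even-everywhere y with weight y ≟ 4
  ... | yes e = even eig y e
  ... | no ne = cong β (trans (off y ne) (sym (off (compl y) λ e → ne (trans (cong weight (sym (compl-involutive y))) (weight-compl-w (compl y) e)))))

  c-even : ∃ λ y → c ≡ 2 * y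
  c-even = ∣ Y ∣ , trans (cong ∣_∣ (double X′ (pos c) (trans (sym cell-size) halves))) (ℤ.abs-* (pos 2) Y)
    where
    X′ Y : ℤ
    X′ = cubeSum (λ v → β (F (true ∷ v)))
    -- From 5c = 2X′ follows c = 2(X′ - 2c).
    Y = X′ -ᶻ pos 2 *ᶻ pos c
    -- Complementation exchanges the members of the cell with first bit true and those with first
    -- bit false.
    halves : X ≡ X′ +ᶻ X′
    halves = cong (X′ +ᶻ_) (trans (cubeSum-cong λ v → even-everywhere (false ∷ v)) (cubeSum-compl (λ v → β (F (true ∷ v)))))
    double : ∀ X c → pos 5 *ᶻ c ≡ X +ᶻ X → c ≡ pos 2 *ᶻ (X -ᶻ pos 2 *ᶻ c)
    double X c h = trans (ring₁ c) (trans (cong (_-ᶻ pos 4 *ᶻ c) h) (ring₂ X c))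
      where
      ring₁ : ∀ c → c ≡ pos 5 *ᶻ c -ᶻ pos 4 *ᶻ c
      ring₁ = solve-∀
      ring₂ : ∀ X c → (X +ᶻ X) -ᶻ pos 4 *ᶻ c ≡ pos 2 *ᶻ (X -ᶻ pos 2 *ᶻ c)
      ring₂ = solve-∀

  c≢0 : c ≢ 0
  c≢0 refl = let (x , e , h) , _ = nonconst in
    case subst₂ _≤ᶻ_ (cong β h) cell-size (term≤cubeSum (β ∘ F) (λ y → β≥0 (F y)) x) of λ { (+≤+ ()) }

  -- Here 5c = 70 would make the first cell the whole slice; a vertex outside it contributes 1 to
  -- the sum `total₀`, which is 0.
  c≢14 : c ≢ 14
  c≢14 refl = let _ , (x , e , h) = nonconst in
    case subst₂ _≤ᶻ_ (cong₂ (λ p q → β p -ᶻ β q) (≡ᵇ-complete (weight x) 4 e) h) total₀ (term≤cubeSum rest (λ y → nonneg y) x) of λ { (+≤+ ()) }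
    where
    rest : Fun 8
    rest y = slice₄ y -ᶻ β (F y)
    nonneg : ∀ y → 0ℤ ≤ᶻ rest y
    nonneg y with weight y ≟ 4
    ... | yes e = subst (λ b → 0ℤ ≤ᶻ β b -ᶻ β (F y)) (sym (≡ᵇ-complete (weight y) 4 e)) (1-β (F y))
      where
      1-β : ∀ b → 0ℤ ≤ᶻ 1ℤ -ᶻ β b
      1-β true  = ℤ.≤-refl
      1-β false = +≤+ z≤n
    ... | no ne = subst (λ b → 0ℤ ≤ᶻ slice₄ y -ᶻ β b) (sym (off y ne)) (subst (0ℤ ≤ᶻ_) (sym (ℤ.+-identityʳ (slice₄ y))) (β≥0 (weight y ≡ᵇ 4)))
    total₀ : cubeSum rest ≡ 0ℤ
    total₀ = begin
      cubeSum rest                                                 ≡⟨ cubeSum-cong (λ y → ring (slice₄ y) (β (F y))) ⟩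
      cubeSum (λ y → slice₄ y +ᶻ -1ℤ *ᶻ β (F y))                   ≡⟨ cubeSum-add slice₄ (λ y → -1ℤ *ᶻ β (F y)) ⟩
      cubeSum slice₄ +ᶻ cubeSum (λ y → -1ℤ *ᶻ β (F y))             ≡⟨ cong₂ _+ᶻ_ slice₄-size (trans (cubeSum-scale -1ℤ (β ∘ F)) (cong (-1ℤ *ᶻ_) cell-size)) ⟩
      pos 70 +ᶻ -1ℤ *ᶻ (pos 5 *ᶻ pos 14)                           ∎
      where
      open ≡-Reasoning
      ring : ∀ a b → a -ᶻ b ≡ a +ᶻ -1ℤ *ᶻ b
      ring = solve-∀

-- Assembling the cases

-- The length n is a variable of its own because w + w does not reduce to 10 + k; matching on the
-- equation replaces it.
equivalent : ∀ {n w₀} (n≡2w : n ≡ suc w₀ + suc w₀) → ∀ r k → 5 + r ≡ suc w₀ → n ≡ 10 + k →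
  (f : Vertex n (suc w₀) → Bool) (S : Fin 2 → Fin 2 → ℕ) → IsEquitable2 f S → IsEigenvalue2 S (eigJ n (suc w₀) 2) →
  ∃ λ κ → PartEquiv f (partition κ)
equivalent n≡2w r k 5+r≡w refl f S equitable eigenvalue =
  classified-equivalent f (Reduction.classify 5+r≡w n≡2w is-eigenfunction nonconstant)
  where open Equitable n≡2w f S equitable eigenvalue

matEq : ∀ {S : Mat2} {a b c d} → S zero zero ≡ a → S zero (suc zero) ≡ b → S (suc zero) zero ≡ c → S (suc zero) (suc zero) ≡ d → MatEq S (mat2 a b c d)
matEq ea eb ec ed zero       zero       = ea
matEq ea eb ec ed zero       (suc zero) = eb
matEq ea eb ec ed (suc zero) zero       = ec
matEq ea eb ec ed (suc zero) (suc zero) = ed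

AllowedMatrix : ℕ → Mat2 → Set
AllowedMatrix w S =
  MatEqUpToSwap S (mat2 ((w * w ∸ 3 * w) + 2) (3 * w ∸ 2) w (w * w ∸ w)) ⊎
  MatEqUpToSwap S (mat2 (w * w ∸ 2 * w) (2 * w) (2 * w ∸ 2) ((w * w ∸ 2 * w) + 2)) ⊎
  MatEqUpToSwap S (mat2 (w * w ∸ 3 * w) (3 * w) (w ∸ 2) ((w * w ∸ w) + 2))

-- In each matrix the rows sum to w² and the off-diagonal entries to 4w − 2, so one off-diagonal entry determines the rest.
module Entries (S : Mat2) {q θ : ℕ} (row₀ : S zero zero + S zero (suc zero) ≡ q) (row₁ : S (suc zero) zero + S (suc zero) (suc zero) ≡ q)
  (off-diagonal : S zero (suc zero) + S (suc zero) zero ≡ θ) {C : ℕ} (ec : S (suc zero) zero ≡ C) where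

  eb : S zero (suc zero) ≡ θ ∸ C
  eb = trans (sym (ℕ.m+n∸n≡m (S zero (suc zero)) (S (suc zero) zero))) (cong₂ _∸_ off-diagonal ec)

  ea : S zero zero ≡ q ∸ (θ ∸ C)
  ea = trans (sym (ℕ.m+n∸n≡m (S zero zero) (S zero (suc zero)))) (cong₂ _∸_ row₀ eb)

  ed : S (suc zero) (suc zero) ≡ q ∸ C
  ed = trans (sym (ℕ.m+n∸m≡n (S (suc zero) zero) (S (suc zero) (suc zero)))) (cong₂ _∸_ row₁ ec)

  straight : MatEq S (mat2 (q ∸ (θ ∸ C)) (θ ∸ C) C (q ∸ C))
  straight = matEq ea eb ec ed

  swapped : MatEq (λ i j → S (swap2 i) (swap2 j)) (mat2 (q ∸ C) C (θ ∸ C) (q ∸ (θ ∸ C)))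
  swapped = matEq ed ec eb ea

module Small {w₀ : ℕ} (f : Vertex (suc w₀ + suc w₀) (suc w₀) → Bool) (S : Fin 2 → Fin 2 → ℕ)
  (equitable : IsEquitable2 f S) (eigenvalue : IsEigenvalue2 S (eigJ (suc w₀ + suc w₀) (suc w₀) 2)) where

  open Equitable refl f S equitable eigenvalue public

  row₀ℕ : a + b ≡ w * w
  row₀ℕ = ℤ.+-injective (trans row₀ (sym (ℤ.pos-* w w)))

  row₁ℕ : c + d ≡ w * w
  row₁ℕ = ℤ.+-injective (trans row₁ (sym (ℤ.pos-* w w)))

  module With {C : ℕ} θ (trace≡ : pos 4 *ᶻ pos w -ᶻ pos 2 ≡ pos θ) (ec : c ≡ C) = Entries S row₀ℕ row₁ℕ (ℤ.+-injective (trans trace trace≡)) ec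

four : ∀ f S → IsEquitable2 {8} {4} f S → IsEigenvalue2 S (eigJ 8 4 2) → AllowedMatrix 4 S
four f S equitable eigenvalue = go c-even
  where
  open Small {3} f S equitable eigenvalue
  open Four {c} {F} (total-extension-off f) is-eigenfunction nonconstant
  go : (∃ λ y → c ≡ 2 * y) → AllowedMatrix 4 S
  go (0 , e) = contradiction e c≢0
  go (1 , e) = inj₂ (inj₂ (inj₁ straight)) where open With 14 refl e
  go (2 , e) = inj₁ (inj₁ straight) where open With 14 refl e
  go (3 , e) = inj₂ (inj₁ (inj₁ straight)) where open With 14 refl e
  go (4 , e) = inj₂ (inj₁ (inj₂ swapped)) where open With 14 refl e
  go (5 , e) = inj₁ (inj₂ swapped) where open With 14 refl e
  go (6 , e) = inj₂ (inj₂ (inj₂ swapped)) where open With 14 refl e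
  go (7 , e) = contradiction e c≢14
  -- Here c would be at least 16, against c ≤ b + c = 14.
  go (suc (suc (suc (suc (suc (suc (suc (suc y))))))) , e) = contradiction (ℕ.≤-trans
      (ℕ.≤-trans (ℕ.*-monoʳ-≤ 2 (ℕ.m≤m+n 8 y)) (ℕ.≤-reflexive (sym e)))
      (subst (c ≤_) (ℤ.+-injective trace) (ℕ.m≤n+m c b)))
    (ℕ.<⇒≱ (ℕ.m≤n+m 15 1))

-- Quotient matrices for w = 5 and w = 6

-- The entry c is w, 2w - 2, 2w - 2, w - 2 for the kinds I to IV; with the cells interchanged it is
-- 4w - 2 minus that.
values₅ values₆ : Kind → Bool → ℕ
values₅ I   false = 5
values₅ I   true  = 13
values₅ II  false = 8
values₅ II  true  = 10
values₅ III false = 8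
values₅ III true  = 10
values₅ IV  false = 3
values₅ IV  true  = 15
values₆ I   false = 6
values₆ I   true  = 16
values₆ II  false = 10
values₆ II  true  = 12
values₆ III false = 10
values₆ III true  = 12
values₆ IV  false = 4
values₆ IV  true  = 18

zeros₅ one₅ : Vec Bool 5
zeros₅ = false ∷ false ∷ false ∷ false ∷ false ∷ []
one₅   = true ∷ false ∷ false ∷ false ∷ false ∷ []

-- Each test vertex lies outside the first cell, where the equation reduces to `adj` = c and both
-- sides evaluate.
value₅ : ∀ κ s {c} → Eigen {10} 5 (λ₂ 5) (pos c) (β ∘ model κ s) → c ≡ values₅ κ s
value₅ I   false eig = sym (ℤ.+-injective (Eigen.at eig (zeros₅ ++ true ∷ true ∷ true ∷ true ∷ true ∷ []) refl))
value₅ I   true  eig = sym (ℤ.+-injective (Eigen.at eig (one₅ ++ true ∷ true ∷ true ∷ true ∷ false ∷ []) refl))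
value₅ II  false eig = sym (ℤ.+-injective (Eigen.at eig (one₅ ++ true ∷ true ∷ true ∷ true ∷ false ∷ []) refl))
value₅ II  true  eig = sym (ℤ.+-injective (Eigen.at eig (zeros₅ ++ true ∷ true ∷ true ∷ true ∷ true ∷ []) refl))
value₅ III false eig = sym (ℤ.+-injective (Eigen.at eig (one₅ ++ true ∷ true ∷ true ∷ true ∷ false ∷ []) refl))
value₅ III true  eig = sym (ℤ.+-injective (Eigen.at eig (zeros₅ ++ true ∷ true ∷ true ∷ true ∷ true ∷ []) refl))
value₅ IV  false eig = sym (ℤ.+-injective (Eigen.at eig (one₅ ++ true ∷ true ∷ true ∷ true ∷ false ∷ []) refl))
value₅ IV  true  eig = sym (ℤ.+-injective (Eigen.at eig (zeros₅ ++ true ∷ true ∷ true ∷ true ∷ true ∷ []) refl))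

value₆ : ∀ κ s {c} → Eigen {12} 6 (λ₂ 6) (pos c) (β ∘ model κ s) → c ≡ values₆ κ s
value₆ I   false eig = sym (ℤ.+-injective (Eigen.at eig (zeros₅ ++ true ∷ true ∷ true ∷ true ∷ true ∷ true ∷ false ∷ []) refl))
value₆ I   true  eig = sym (ℤ.+-injective (Eigen.at eig (one₅ ++ true ∷ true ∷ true ∷ true ∷ true ∷ false ∷ false ∷ []) refl))
value₆ II  false eig = sym (ℤ.+-injective (Eigen.at eig (one₅ ++ true ∷ true ∷ true ∷ true ∷ true ∷ false ∷ false ∷ []) refl))
value₆ II  true  eig = sym (ℤ.+-injective (Eigen.at eig (zeros₅ ++ true ∷ true ∷ true ∷ true ∷ true ∷ true ∷ false ∷ []) refl))
value₆ III false eig = sym (ℤ.+-injective (Eigen.at eig (one₅ ++ true ∷ true ∷ true ∷ true ∷ true ∷ false ∷ false ∷ []) refl))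
value₆ III true  eig = sym (ℤ.+-injective (Eigen.at eig (zeros₅ ++ true ∷ true ∷ true ∷ true ∷ true ∷ true ∷ false ∷ []) refl))
value₆ IV  false eig = sym (ℤ.+-injective (Eigen.at eig (one₅ ++ true ∷ true ∷ true ∷ true ∷ true ∷ false ∷ false ∷ []) refl))
value₆ IV  true  eig = sym (ℤ.+-injective (Eigen.at eig (zeros₅ ++ true ∷ true ∷ true ∷ true ∷ true ∷ true ∷ false ∷ []) refl))

five : ∀ f S → IsEquitable2 {10} {5} f S → IsEigenvalue2 S (eigJ 10 5 2) → AllowedMatrix 5 S
five f S equitable eigenvalue = go (model-eigen is-eigenfunction (Reduction.classify {0} {0} refl refl is-eigenfunction nonconstant))
  where
  open Small {4} f S equitable eigenvalue
  allowed : ∀ κ s → c ≡ values₅ κ s → AllowedMatrix 5 S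
  allowed I   false e = inj₁ (inj₁ straight) where open With 18 refl e
  allowed I   true  e = inj₁ (inj₂ swapped) where open With 18 refl e
  allowed II  false e = inj₂ (inj₁ (inj₁ straight)) where open With 18 refl e
  allowed II  true  e = inj₂ (inj₁ (inj₂ swapped)) where open With 18 refl e
  allowed III false e = inj₂ (inj₁ (inj₁ straight)) where open With 18 refl e
  allowed III true  e = inj₂ (inj₁ (inj₂ swapped)) where open With 18 refl e
  allowed IV  false e = inj₂ (inj₂ (inj₁ straight)) where open With 18 refl e
  allowed IV  true  e = inj₂ (inj₂ (inj₂ swapped)) where open With 18 refl e
  go : (∃₂ λ κ s → Eigen {10} 5 (λ₂ 5) (pos c) (β ∘ model κ s)) → AllowedMatrix 5 S
  go (κ , s , eig) = allowed κ s (value₅ κ s eig)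

six : ∀ f S → IsEquitable2 {12} {6} f S → IsEigenvalue2 S (eigJ 12 6 2) → AllowedMatrix 6 S
six f S equitable eigenvalue = go (model-eigen is-eigenfunction (Reduction.classify {1} {2} refl refl is-eigenfunction nonconstant))
  where
  open Small {5} f S equitable eigenvalue
  allowed : ∀ κ s → c ≡ values₆ κ s → AllowedMatrix 6 S
  allowed I   false e = inj₁ (inj₁ straight) where open With 22 refl e
  allowed I   true  e = inj₁ (inj₂ swapped) where open With 22 refl e
  allowed II  false e = inj₂ (inj₁ (inj₁ straight)) where open With 22 refl e
  allowed II  true  e = inj₂ (inj₁ (inj₂ swapped)) where open With 22 refl e
  allowed III false e = inj₂ (inj₁ (inj₁ straight)) where open With 22 refl e
  allowed III true  e = inj₂ (inj₁ (inj₂ swapped)) where open With 22 refl e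
  allowed IV  false e = inj₂ (inj₂ (inj₁ straight)) where open With 22 refl e
  allowed IV  true  e = inj₂ (inj₂ (inj₂ swapped)) where open With 22 refl e
  go : (∃₂ λ κ s → Eigen {12} 6 (λ₂ 6) (pos c) (β ∘ model κ s)) → AllowedMatrix 6 S
  go (κ , s , eig) = allowed κ s (value₆ κ s eig)

theorem3 : (w : ℕ) → 4 ≤ w →
    (f : Vertex (w + w) w → Bool) → (S : Fin 2 → Fin 2 → ℕ) →
    IsEquitable2 f S →
    IsEigenvalue2 S (eigJ (w + w) w 2) →
    (7 ≤ w →
    PartEquiv f D1-i ⊎ PartEquiv f D1-ii ⊎ PartEquiv f D1-iii ⊎ PartEquiv f D1-iv)
    ×
    ((w ≡ 4 ⊎ w ≡ 5 ⊎ w ≡ 6) →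
    MatEqUpToSwap S (mat2 ((w * w ∸ 3 * w) + 2) (3 * w ∸ 2) w (w * w ∸ w)) ⊎
    MatEqUpToSwap S (mat2 (w * w ∸ 2 * w) (2 * w) (2 * w ∸ 2) ((w * w ∸ 2 * w) + 2)) ⊎
    MatEqUpToSwap S (mat2 (w * w ∸ 3 * w) (3 * w) (w ∸ 2) ((w * w ∸ w) + 2)))
theorem3 w _ f S equitable eigenvalue = large w f equitable eigenvalue , small w f equitable eigenvalue
  where
  by-kind : ∀ {n w} {f : Vertex n w → Bool} → (∃ λ κ → PartEquiv f (partition κ)) →
    PartEquiv f D1-i ⊎ PartEquiv f D1-ii ⊎ PartEquiv f D1-iii ⊎ PartEquiv f D1-iv
  by-kind (I   , e) = inj₁ e
  by-kind (II  , e) = inj₂ (inj₁ e)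
  by-kind (III , e) = inj₂ (inj₂ (inj₁ e))
  by-kind (IV  , e) = inj₂ (inj₂ (inj₂ e))
  large : ∀ w (f : Vertex (w + w) w → Bool) → IsEquitable2 f S → IsEigenvalue2 S (eigJ (w + w) w 2) → 7 ≤ w →
    PartEquiv f D1-i ⊎ PartEquiv f D1-ii ⊎ PartEquiv f D1-iii ⊎ PartEquiv f D1-iv
  large (suc (suc (suc (suc (suc r))))) f equitable eigenvalue _ = by-kind
    (equivalent refl r (r + r) refl (cong (5 +_) (ℕ.+-comm r (5 + r))) f S equitable eigenvalue)
  large 0 f _ _ ()
  large 1 f _ _ (s≤s ())
  large 2 f _ _ (s≤s (s≤s ()))
  large 3 f _ _ (s≤s (s≤s (s≤s ())))
  large 4 f _ _ (s≤s (s≤s (s≤s (s≤s ()))))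
  small : ∀ w (f : Vertex (w + w) w → Bool) → IsEquitable2 f S → IsEigenvalue2 S (eigJ (w + w) w 2) → w ≡ 4 ⊎ w ≡ 5 ⊎ w ≡ 6 → AllowedMatrix w S
  small _ f equitable eigenvalue (inj₁ refl)        = four f S equitable eigenvalue
  small _ f equitable eigenvalue (inj₂ (inj₁ refl)) = five f S equitable eigenvalue
  small _ f equitable eigenvalue (inj₂ (inj₂ refl)) = six f S equitable eigenvalue
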